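{- Let $\gamma$ be a non-zero algebraic number with $\deg\gamma\le 2$. (i) If $\mathbb Q(\gamma)\neq\mathbb Q(i)$ and $\mathbb Q(\gamma)\ne\mathbb Q(i\sqrt3)$, then $\bar M(\gamma)=M(\gamma)$. (ii) If $\gamma=a+bi$ with $a,b\in\mathbb Q$, then $\bar M(\gamma)=M(b)$ if $a=0$, and $\bar M(\gamma)=M(\gamma)$ if $a\neq0$. (iii) If $\gamma=a+b\sqrt{ -3}$ with $a,b\in\mathbb Q$, then $\bar M(\gamma)=M(2a)$ if $a\in\{b,-b\}$, and $\bar M(\gamma)=M(\gamma)$ if $a\notin\{b,-b\}$.
   Context: For a non-zero algebraic number $\gamma$ with minimal polynomial $A\prod_{n=1}^N(x-\gamma_n)$ over $\mathbb Z$ (primitive, $A>0$), $M(\gamma)=A\prod_{n=1}^N\max\{1,|\gamma_n|\}$. The modified Mahler measure is $\bar M(\gamma)=\inf\{M(\zeta\gamma):\zeta\text{ a root of unity}\}$. -}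

module Defs where

open import Data.Empty using (⊥-elim)
open import Data.Integer.Base as ℤ using (ℤ; +_)
import Data.Integer.GCD as ℤ
import Data.Integer.Properties as ℤ
open import Data.Nat.Base as ℕ using (ℕ; zero; suc)
import Data.Nat.Properties as ℕ
open import Data.Product.Base using (Σ; ∃; ∃-syntax; Σ-syntax; _×_; _,_; proj₁; proj₂)
open import Data.Rational.Base as ℚ using (ℚ; mkℚ; 0ℚ; 1ℚ; ½; toℚᵘ; Positive; positive; nonNegative)
  renaming (_+_ to _+ᵠ_; _*_ to _*ᵠ_; _-_ to _-ᵠ_; -_ to -ᵠ_; _⊔_ to _⊔ᵠ_; ∣_∣ to ∣_∣ᵠ; _≤_ to _≤ᵠ_; _<_ to _<ᵠ_)
import Data.Rational.Properties as ℚ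
open import Data.Rational.Solver using (module +-*-Solver)
import Data.Rational.Unnormalised.Base as ℚᵘ
import Data.Rational.Unnormalised.Properties as ℚᵘ
open import Data.Sum.Base using (inj₁; inj₂)
open import Data.Vec.Base using (Vec; []; _∷_; _∷ʳ_; map; zipWith; foldr; last; replicate)
open import Data.Vec.Relation.Binary.Pointwise.Inductive using (Pointwise)
open import Relation.Binary.PropositionalEquality using (_≡_; _≢_; refl; sym; trans; cong; subst)
open import Relation.Nullary.Decidable.Core using (yes; no)

------------------------------------------------------------------------
-- Rational estimates

open +-*-Solver using (solve; _:+_; _:*_; :-_; _:-_; con; _:=_)

module RationalEstimates where
  half+half : ∀ ε → ε *ᵠ ½ +ᵠ ε *ᵠ ½ ≡ ε
  half+half ε = trans (sym (ℚ.*-distribˡ-+ ε ½ ½)) (ℚ.*-identityʳ ε)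

  half>0 : ∀ {ε} → 0ℚ <ᵠ ε → 0ℚ <ᵠ ε *ᵠ ½
  half>0 {ε} ε>0 = ℚ.*-monoˡ-<-pos ½ ε>0

  *-pos : ∀ {p q} → 0ℚ <ᵠ p → 0ℚ <ᵠ q → 0ℚ <ᵠ p *ᵠ q
  *-pos {p} {q} p>0 q>0 =
    subst (_<ᵠ p *ᵠ q) (ℚ.*-zeroˡ q) (ℚ.*-monoˡ-<-pos q {{positive q>0}} p>0)

  *-mono : ∀ {p q r s} → 0ℚ ≤ᵠ p → 0ℚ ≤ᵠ s → p ≤ᵠ q → r ≤ᵠ s → p *ᵠ r ≤ᵠ q *ᵠ s
  *-mono {p} {q} {r} {s} 0≤p 0≤s p≤q r≤s = ℚ.≤-trans
    (ℚ.*-monoˡ-≤-nonNeg p {{nonNegative 0≤p}} r≤s)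
    (ℚ.*-monoʳ-≤-nonNeg s {{nonNegative 0≤s}} p≤q)

  p≤∣p∣ : ∀ p → p ≤ᵠ ∣ p ∣ᵠ
  p≤∣p∣ p with ℚ.≤-total 0ℚ p
  ... | inj₁ 0≤p = ℚ.≤-reflexive (sym (ℚ.0≤p⇒∣p∣≡p 0≤p))
  ... | inj₂ p≤0 = ℚ.≤-trans p≤0 (ℚ.0≤∣p∣ p)

  ∣-∣≤ : ∀ {p q e} → p ≤ᵠ q +ᵠ e → q ≤ᵠ p +ᵠ e → ∣ p -ᵠ q ∣ᵠ ≤ᵠ e
  ∣-∣≤ {p} {q} {e} p≤ q≤ with ℚ.∣p∣≡p∨∣p∣≡-p (p -ᵠ q)
  ... | inj₁ eq = subst (_≤ᵠ e) (sym eq) (subst (p -ᵠ q ≤ᵠ_)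
          (solve 2 (λ q e → q :+ e :- q := e) refl q e) (ℚ.+-monoˡ-≤ (-ᵠ q) p≤))
  ... | inj₂ eq = subst (_≤ᵠ e)
          (trans (solve 2 (λ p q → q :- p := :- (p :- q)) refl p q) (sym eq))
          (subst (q -ᵠ p ≤ᵠ_) (solve 2 (λ p e → p :+ e :- p := e) refl p e)
            (ℚ.+-monoˡ-≤ (-ᵠ p) q≤))

  ∣-∣≤⁻¹ : ∀ {p q e} → ∣ p -ᵠ q ∣ᵠ ≤ᵠ e → p ≤ᵠ q +ᵠ e
  ∣-∣≤⁻¹ {p} {q} {e} h = subst (_≤ᵠ q +ᵠ e) (solve 2 (λ p q → q :+ (p :- q) := p) refl p q)
    (ℚ.+-monoʳ-≤ q (ℚ.≤-trans (p≤∣p∣ (p -ᵠ q)) h))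

  p≤p+q : ∀ p {q} → 0ℚ ≤ᵠ q → p ≤ᵠ p +ᵠ q
  p≤p+q p {q} 0≤q = subst (_≤ᵠ p +ᵠ q) (ℚ.+-identityʳ p) (ℚ.+-monoʳ-≤ p 0≤q)

  ⊔-lub : ∀ {p q r} → p ≤ᵠ r → q ≤ᵠ r → p ⊔ᵠ q ≤ᵠ r
  ⊔-lub = ℚ.⊔-lub

open RationalEstimates

½^_ : ℕ → ℚ
½^ zero  = 1ℚ
½^ suc n = ½^ n *ᵠ ½

module PowersOfHalf where
  ½^>0 : ∀ n → 0ℚ <ᵠ ½^ n
  ½^>0 zero    = ℚ.positive⁻¹ 1ℚ
  ½^>0 (suc n) = half>0 (½^>0 n)

  ½^-step : ∀ n → ½^ (suc n) ≤ᵠ ½^ n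
  ½^-step n = subst (½^ suc n ≤ᵠ_) (half+half (½^ n)) (p≤p+q (½^ suc n) (ℚ.<⇒≤ (½^>0 (suc n))))

  ½^-antimono : ∀ {m n} → m ℕ.≤′ n → ½^ n ≤ᵠ ½^ m
  ½^-antimono (ℕ.≤′-reflexive refl) = ℚ.≤-refl
  ½^-antimono {n = suc n} (ℕ.≤′-step m≤n) = ℚ.≤-trans (½^-step n) (½^-antimono m≤n)

  ι : ℕ → ℚ
  ι zero    = 0ℚ
  ι (suc n) = 1ℚ +ᵠ ι n

  ι-toℚᵘ : ∀ n → toℚᵘ (ι n) ℚᵘ.≃ ℚᵘ.mkℚᵘ (+ n) 0
  ι-toℚᵘ zero    = ℚᵘ.≃-refl
  ι-toℚᵘ (suc n) = ℚᵘ.≃-trans (ℚ.toℚᵘ-homo-+ 1ℚ (ι n))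
    (ℚᵘ.≃-trans (ℚᵘ.+-congʳ (toℚᵘ 1ℚ) (ι-toℚᵘ n))
      (ℚᵘ.*≡* (cong (ℤ._* + 1) (cong (ℤ._+_ (+ 1)) (ℤ.*-identityʳ (+ n))))))

  i≤∣i∣*d : ∀ i d → i ℤ.≤ + ℤ.∣ i ∣ ℤ.* + suc d
  i≤∣i∣*d (+ n) d = subst (+ n ℤ.≤_) (ℤ.pos-* n (suc d)) (ℤ.+≤+ (ℕ.m≤m*n n (suc d)))
  i≤∣i∣*d ℤ.-[1+ n ] d = ℤ.-≤+

  archimedean : ∀ p → ∃[ n ] p ≤ᵠ ι n
  archimedean p@(mkℚ i d _) = ℤ.∣ i ∣ , ℚ.toℚᵘ-cancel-≤
    (ℚᵘ.≤-trans (ℚᵘ.*≤* (subst (ℤ._≤ + ℤ.∣ i ∣ ℤ.* + suc d) (sym (ℤ.*-identityʳ i)) (i≤∣i∣*d i d)))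
      (ℚᵘ.≤-reflexive (ℚᵘ.≃-sym (ι-toℚᵘ ℤ.∣ i ∣))))

  ½^≤1 : ∀ n → ½^ n ≤ᵠ 1ℚ
  ½^≤1 n = ½^-antimono {0} {n} (ℕ.≤⇒≤′ ℕ.z≤n)

  ι*½^≤1 : ∀ n → ι n *ᵠ ½^ n ≤ᵠ 1ℚ
  ι*½^≤1 zero    = subst (_≤ᵠ 1ℚ) (sym (ℚ.*-zeroˡ 1ℚ)) (ℚ.<⇒≤ (ℚ.positive⁻¹ 1ℚ))
  ι*½^≤1 (suc n) = subst (_≤ᵠ 1ℚ)
    (solve 2 (λ k h → (h :+ k :* h) :* con ½ := (con 1ℚ :+ k) :* (h :* con ½)) refl (ι n) (½^ n))
    (ℚ.*-monoʳ-≤-nonNeg ½ (ℚ.+-mono-≤ (½^≤1 n) (ι*½^≤1 n)))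

  small : ∀ c {ε} → 0ℚ <ᵠ ε → ∃[ N ] (∀ n → N ℕ.≤ n → c *ᵠ ½^ n ≤ᵠ ε)
  small c {ε} ε>0 = N , λ n N≤n → ℚ.≤-trans (bound n) (ℚ.≤-trans
      (ℚ.*-monoʳ-≤-nonNeg ε {{nonNegative (ℚ.<⇒≤ ε>0)}} (ℚ.≤-trans
        (ℚ.*-monoˡ-≤-nonNeg (ι N) {{nonNegative (ι≥0 N)}} (½^-antimono {N} {n} (ℕ.≤⇒≤′ N≤n)))
        (ι*½^≤1 N)))
      (ℚ.≤-reflexive (ℚ.*-identityˡ ε)))
    where
    instance
      ε-pos = positive ε>0
      ε≢0 = ℚ.pos⇒nonZero ε
    N = proj₁ (archimedean (c *ᵠ ℚ.1/ ε))
    ι≥0 : ∀ n → 0ℚ ≤ᵠ ι n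
    ι≥0 zero    = ℚ.≤-refl
    ι≥0 (suc n) = ℚ.≤-trans (ι≥0 n) (subst (ι n ≤ᵠ_) (ℚ.+-comm (ι n) 1ℚ) (p≤p+q (ι n) (ℚ.<⇒≤ (ℚ.positive⁻¹ 1ℚ))))
    c≤ : c ≤ᵠ ι N *ᵠ ε
    c≤ = subst (_≤ᵠ ι N *ᵠ ε)
      (trans (ℚ.*-assoc c (ℚ.1/ ε) ε) (trans (cong (c *ᵠ_) (ℚ.*-inverseˡ ε)) (ℚ.*-identityʳ c)))
      (ℚ.*-monoʳ-≤-nonNeg ε {{nonNegative (ℚ.<⇒≤ ε>0)}} (proj₂ (archimedean (c *ᵠ ℚ.1/ ε))))
    bound : ∀ n → c *ᵠ ½^ n ≤ᵠ ι N *ᵠ ½^ n *ᵠ ε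
    bound n = subst (c *ᵠ ½^ n ≤ᵠ_)
      (solve 3 (λ k e h → k :* e :* h := k :* h :* e) refl (ι N) ε (½^ n))
      (ℚ.*-monoʳ-≤-nonNeg (½^ n) {{nonNegative (ℚ.<⇒≤ (½^>0 n))}} c≤)

open PowersOfHalf

------------------------------------------------------------------------
-- Real numbers, as Cauchy sequences of rationals

IsCauchy : (ℕ → ℚ) → Set
IsCauchy x = ∀ ε → 0ℚ <ᵠ ε → ∃[ N ] (∀ m n → N ℕ.≤ m → N ℕ.≤ n → ∣ x m -ᵠ x n ∣ᵠ ≤ᵠ ε)

record ℝ : Set where
  constructor mkℝ
  field
    seq    : ℕ → ℚ
    cauchy : IsCauchy seq

open ℝ public

infix  4 _≈ᴿ_ _≤ᴿ_
infixl 6 _+ᴿ_ _-ᴿ_ _⊔ᴿ_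
infixl 7 _*ᴿ_
infix  8 -ᴿ_

-- These relations are records so that x and y can be inferred from the type.

record _≈ᴿ_ (x y : ℝ) : Set where
  constructor mk≈ᴿ
  field
    eventually≈ : ∀ ε → 0ℚ <ᵠ ε → ∃[ N ] (∀ n → N ℕ.≤ n → ∣ seq x n -ᵠ seq y n ∣ᵠ ≤ᵠ ε)

record _≤ᴿ_ (x y : ℝ) : Set where
  constructor mk≤ᴿ
  field
    eventually≤ : ∀ ε → 0ℚ <ᵠ ε → ∃[ N ] (∀ n → N ℕ.≤ n → seq x n ≤ᵠ seq y n +ᵠ ε)

open _≈ᴿ_ public
open _≤ᴿ_ public

fromℚ : ℚ → ℝ
seq    (fromℚ q) _ = q
cauchy (fromℚ q) ε ε>0 = 0 , λ _ _ _ _ →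
  subst (λ t → ∣ t ∣ᵠ ≤ᵠ ε) (sym (ℚ.+-inverseʳ q)) (ℚ.<⇒≤ ε>0)

module CauchyEstimates where
  -- By symmetry in m and n a one-sided estimate suffices.
  oneSided : ∀ {x : ℕ → ℚ} →
    (∀ ε → 0ℚ <ᵠ ε → ∃[ N ] (∀ m n → N ℕ.≤ m → N ℕ.≤ n → x m ≤ᵠ x n +ᵠ ε)) → IsCauchy x
  oneSided h ε ε>0 with h ε ε>0
  ... | N , f = N , λ m n N≤m N≤n → ∣-∣≤ (f m n N≤m N≤n) (f n m N≤n N≤m)

  oneSided⁻¹ : ∀ (x : ℝ) ε → 0ℚ <ᵠ ε →
    ∃[ N ] (∀ m n → N ℕ.≤ m → N ℕ.≤ n → seq x m ≤ᵠ seq x n +ᵠ ε)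
  oneSided⁻¹ x ε ε>0 with cauchy x ε ε>0
  ... | N , f = N , λ m n N≤m N≤n → ∣-∣≤⁻¹ (f m n N≤m N≤n)

  eventually-bounded : ∀ (x : ℝ) → ∃[ B ] (0ℚ ≤ᵠ B) × ∃[ N ] (∀ n → N ℕ.≤ n → ∣ seq x n ∣ᵠ ≤ᵠ B)
  eventually-bounded x with cauchy x 1ℚ (ℚ.positive⁻¹ 1ℚ)
  ... | N , f = ∣ seq x N ∣ᵠ +ᵠ 1ℚ
      , ℚ.≤-trans (ℚ.0≤∣p∣ (seq x N)) (p≤p+q _ (ℚ.<⇒≤ (ℚ.positive⁻¹ 1ℚ)))
      , N , λ n N≤n → ℚ.≤-trans
          (subst (λ t → ∣ t ∣ᵠ ≤ᵠ ∣ seq x N ∣ᵠ +ᵠ ∣ seq x n -ᵠ seq x N ∣ᵠ) (solve 2 (λ p q → q :+ (p :- q) := p) refl (seq x n) (seq x N))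
            (ℚ.∣p+q∣≤∣p∣+∣q∣ (seq x N) (seq x n -ᵠ seq x N)))
          (ℚ.+-monoʳ-≤ ∣ seq x N ∣ᵠ (f n N N≤n ℕ.≤-refl))

open CauchyEstimates

_+ᴿ_ : ℝ → ℝ → ℝ
seq    (x +ᴿ y) n = seq x n +ᵠ seq y n
cauchy (x +ᴿ y) = oneSided λ ε ε>0 →
  let (M , f) = oneSided⁻¹ x (ε *ᵠ ½) (half>0 ε>0)
      (N , g) = oneSided⁻¹ y (ε *ᵠ ½) (half>0 ε>0)
  in M ℕ.⊔ N , λ m n p q → subst (seq x m +ᵠ seq y m ≤ᵠ_)
       (trans (solve 3 (λ a b h → (a :+ h) :+ (b :+ h) := a :+ b :+ (h :+ h)) refl (seq x n) (seq y n) (ε *ᵠ ½))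
              (cong (seq x n +ᵠ seq y n +ᵠ_) (half+half ε)))
       (ℚ.+-mono-≤ (f m n (ℕ.m⊔n≤o⇒m≤o M N p) (ℕ.m⊔n≤o⇒m≤o M N q))
                   (g m n (ℕ.m⊔n≤o⇒n≤o M N p) (ℕ.m⊔n≤o⇒n≤o M N q)))

-ᴿ_ : ℝ → ℝ
seq    (-ᴿ x) n = -ᵠ seq x n
cauchy (-ᴿ x) ε ε>0 =
  let (N , f) = cauchy x ε ε>0
  in N , λ m n p q → subst (λ t → ∣ t ∣ᵠ ≤ᵠ ε)
       (solve 2 (λ a b → b :- a := :- a :- (:- b)) refl (seq x m) (seq x n)) (f n m q p)

_-ᴿ_ : ℝ → ℝ → ℝ
x -ᴿ y = x +ᴿ (-ᴿ y)

_*ᴿ_ : ℝ → ℝ → ℝ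
seq    (x *ᴿ y) n = seq x n *ᵠ seq y n
cauchy (x *ᴿ y) ε ε>0 =
  let (B , B≥0 , N₁ , b) = eventually-bounded x
      (C , C≥0 , N₂ , c) = eventually-bounded y
      D = B +ᵠ C +ᵠ 1ℚ
      B+C≥0 = ℚ.+-mono-≤ B≥0 C≥0
      D>0 : 0ℚ <ᵠ D
      D>0 = ℚ.+-mono-≤-< B+C≥0 (ℚ.positive⁻¹ 1ℚ)
      δ = ε *ᵠ (ℚ.1/ D) {{ℚ.>-nonZero D>0}}
      δ>0 : 0ℚ <ᵠ δ
      δ>0 = *-pos ε>0 (ℚ.positive⁻¹ _ {{ℚ.1/pos⇒pos D {{positive D>0}}}})
      (N₃ , f) = cauchy x δ δ>0
      (N₄ , g) = cauchy y δ δ>0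
      Dδ : D *ᵠ δ ≡ ε
      Dδ = trans (solve 3 (λ d e i → d :* (e :* i) := e :* (d :* i)) refl D ε _)
                 (trans (cong (ε *ᵠ_) (ℚ.*-inverseʳ D {{ℚ.>-nonZero D>0}})) (ℚ.*-identityʳ ε))
      δ≥0 = ℚ.<⇒≤ δ>0
      B+C≤D : B +ᵠ C ≤ᵠ D
      B+C≤D = p≤p+q (B +ᵠ C) (ℚ.<⇒≤ (ℚ.positive⁻¹ 1ℚ))
  in (N₁ ℕ.⊔ N₂) ℕ.⊔ (N₃ ℕ.⊔ N₄) , λ m n p q →
     let p₁₂ = ℕ.m⊔n≤o⇒m≤o (N₁ ℕ.⊔ N₂) (N₃ ℕ.⊔ N₄) p
         p₃₄ = ℕ.m⊔n≤o⇒n≤o (N₁ ℕ.⊔ N₂) (N₃ ℕ.⊔ N₄) p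
         q₁₂ = ℕ.m⊔n≤o⇒m≤o (N₁ ℕ.⊔ N₂) (N₃ ℕ.⊔ N₄) q
         q₃₄ = ℕ.m⊔n≤o⇒n≤o (N₁ ℕ.⊔ N₂) (N₃ ℕ.⊔ N₄) q
         xm = seq x m ; xn = seq x n ; ym = seq y m ; yn = seq y n
         s : ∣ xm *ᵠ (ym -ᵠ yn) ∣ᵠ ≤ᵠ B *ᵠ δ
         s = subst (_≤ᵠ B *ᵠ δ) (sym (ℚ.∣p*q∣≡∣p∣*∣q∣ xm (ym -ᵠ yn)))
               (*-mono (ℚ.0≤∣p∣ xm) δ≥0 (b m (ℕ.m⊔n≤o⇒m≤o N₁ N₂ p₁₂))
                  (g m n (ℕ.m⊔n≤o⇒n≤o N₃ N₄ p₃₄) (ℕ.m⊔n≤o⇒n≤o N₃ N₄ q₃₄)))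
         t : ∣ yn *ᵠ (xm -ᵠ xn) ∣ᵠ ≤ᵠ C *ᵠ δ
         t = subst (_≤ᵠ C *ᵠ δ) (sym (ℚ.∣p*q∣≡∣p∣*∣q∣ yn (xm -ᵠ xn)))
               (*-mono (ℚ.0≤∣p∣ yn) δ≥0 (c n (ℕ.m⊔n≤o⇒n≤o N₁ N₂ q₁₂))
                  (f m n (ℕ.m⊔n≤o⇒m≤o N₃ N₄ p₃₄) (ℕ.m⊔n≤o⇒m≤o N₃ N₄ q₃₄)))
     in subst (λ t → ∣ t ∣ᵠ ≤ᵠ ε)
          (solve 4 (λ a b c d → a :* (c :- d) :+ d :* (a :- b) := a :* c :- b :* d) refl xm xn ym yn)
          (ℚ.≤-trans (ℚ.∣p+q∣≤∣p∣+∣q∣ (xm *ᵠ (ym -ᵠ yn)) (yn *ᵠ (xm -ᵠ xn)))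
            (ℚ.≤-trans (ℚ.+-mono-≤ s t)
              (subst (B *ᵠ δ +ᵠ C *ᵠ δ ≤ᵠ_) Dδ
                (subst (_≤ᵠ D *ᵠ δ) (ℚ.*-distribʳ-+ δ B C)
                  (ℚ.*-monoʳ-≤-nonNeg δ {{nonNegative δ≥0}} B+C≤D)))))

_⊔ᴿ_ : ℝ → ℝ → ℝ
seq    (x ⊔ᴿ y) n = seq x n ⊔ᵠ seq y n
cauchy (x ⊔ᴿ y) = oneSided λ ε ε>0 →
  let (M , f) = oneSided⁻¹ x ε ε>0
      (N , g) = oneSided⁻¹ y ε ε>0
  in M ℕ.⊔ N , λ m n p q → ⊔-lub
       (ℚ.≤-trans (f m n (ℕ.m⊔n≤o⇒m≤o M N p) (ℕ.m⊔n≤o⇒m≤o M N q))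
                  (ℚ.+-monoˡ-≤ ε (ℚ.p≤p⊔q (seq x n) (seq y n))))
       (ℚ.≤-trans (g m n (ℕ.m⊔n≤o⇒n≤o M N p) (ℕ.m⊔n≤o⇒n≤o M N q))
                  (ℚ.+-monoˡ-≤ ε (ℚ.p≤q⊔p (seq x n) (seq y n))))

-- Bisection: for q ≥ 0, √q lies in [ sqrtLower q n , sqrtLower q n + sqrtWidth q n ].

sqrtWidth : ℚ → ℕ → ℚ
sqrtWidth q n = (1ℚ +ᵠ q) *ᵠ ½^ n

sqrtLower : ℚ → ℕ → ℚ
sqrtLower q zero = 0ℚ
sqrtLower q (suc n) with (sqrtLower q n +ᵠ sqrtWidth q (suc n)) *ᵠ (sqrtLower q n +ᵠ sqrtWidth q (suc n)) ℚ.≤? q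
... | yes _ = sqrtLower q n +ᵠ sqrtWidth q (suc n)
... | no  _ = sqrtLower q n

sqrtWidth≥0 : ∀ {q} → 0ℚ ≤ᵠ q → ∀ n → 0ℚ ≤ᵠ sqrtWidth q n
sqrtWidth≥0 {q} q≥0 n = ℚ.<⇒≤ (*-pos (ℚ.+-mono-<-≤ (ℚ.positive⁻¹ 1ℚ) q≥0) (½^>0 n))

sqrtLower≥0 : ∀ {q} → 0ℚ ≤ᵠ q → ∀ n → 0ℚ ≤ᵠ sqrtLower q n
sqrtLower≥0 q≥0 zero = ℚ.≤-refl
sqrtLower≥0 {q} q≥0 (suc n)
  with (sqrtLower q n +ᵠ sqrtWidth q (suc n)) *ᵠ (sqrtLower q n +ᵠ sqrtWidth q (suc n)) ℚ.≤? q
... | yes _ = ℚ.+-mono-≤ (sqrtLower≥0 q≥0 n) (sqrtWidth≥0 q≥0 (suc n))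
... | no  _ = sqrtLower≥0 q≥0 n

sqrtLower²≤ : ∀ {q} → 0ℚ ≤ᵠ q → ∀ n → sqrtLower q n *ᵠ sqrtLower q n ≤ᵠ q
sqrtLower²≤ q≥0 zero = q≥0
sqrtLower²≤ {q} q≥0 (suc n)
  with (sqrtLower q n +ᵠ sqrtWidth q (suc n)) *ᵠ (sqrtLower q n +ᵠ sqrtWidth q (suc n)) ℚ.≤? q
... | yes p = p
... | no  _ = sqrtLower²≤ q≥0 n

<sqrtUpper² : ∀ {q} → 0ℚ ≤ᵠ q → ∀ n →
  q <ᵠ (sqrtLower q n +ᵠ sqrtWidth q n) *ᵠ (sqrtLower q n +ᵠ sqrtWidth q n)
<sqrtUpper² {q} q≥0 zero = subst (q <ᵠ_)
  (solve 1 (λ q → (q :+ q :* q) :+ (q :+ con 1ℚ) :=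
      (con 0ℚ :+ (con 1ℚ :+ q) :* con 1ℚ) :* (con 0ℚ :+ (con 1ℚ :+ q) :* con 1ℚ)) refl q)
  (subst (_<ᵠ (q +ᵠ q *ᵠ q) +ᵠ (q +ᵠ 1ℚ)) (ℚ.+-identityˡ q)
    (ℚ.+-mono-≤-< (ℚ.+-mono-≤ q≥0 q²≥0)
      (subst (_<ᵠ q +ᵠ 1ℚ) (ℚ.+-identityʳ q) (ℚ.+-monoʳ-< q (ℚ.positive⁻¹ 1ℚ)))))
  where
  q²≥0 : 0ℚ ≤ᵠ q *ᵠ q
  q²≥0 = *-mono ℚ.≤-refl q≥0 q≥0 q≥0
<sqrtUpper² {q} q≥0 (suc n)
  with (sqrtLower q n +ᵠ sqrtWidth q (suc n)) *ᵠ (sqrtLower q n +ᵠ sqrtWidth q (suc n)) ℚ.≤? q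
... | no ¬p = ℚ.≰⇒> ¬p
... | yes _ = subst (λ t → q <ᵠ t *ᵠ t)
        (solve 3 (λ l a h → l :+ a :* h := (l :+ a :* (h :* con ½)) :+ a :* (h :* con ½)) refl
          (sqrtLower q n) (1ℚ +ᵠ q) (½^ n))
        (<sqrtUpper² q≥0 n)

module SqrtEstimates where
  sqrt-close : ∀ {a b η} m n → 0ℚ ≤ᵠ a → 0ℚ ≤ᵠ b → 0ℚ <ᵠ η → sqrtWidth b n ≤ᵠ η →
    a ≤ᵠ b +ᵠ η *ᵠ η → sqrtLower a m ≤ᵠ sqrtLower b n +ᵠ (η +ᵠ η)
  sqrt-close {a} {b} {η} m n a≥0 b≥0 η>0 w≤η a≤ with sqrtLower a m ℚ.≤? sqrtLower b n +ᵠ (η +ᵠ η)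
  ... | yes p = p
  ... | no ¬p = ⊥-elim (ℚ.<-irrefl refl (ℚ.<-≤-trans (ℚ.≤-<-trans a≤ (ℚ.+-monoˡ-< (η *ᵠ η) b<v²)) v²+η²≤a))
    where
    u = sqrtLower b n
    v = u +ᵠ η
    η≥0 = ℚ.<⇒≤ η>0
    u≥0 = sqrtLower≥0 b≥0 n
    v≥0 : 0ℚ ≤ᵠ v
    v≥0 = ℚ.+-mono-≤ u≥0 η≥0
    uw≥0 = ℚ.+-mono-≤ u≥0 (sqrtWidth≥0 b≥0 n)
    b<v² : b <ᵠ v *ᵠ v
    b<v² = ℚ.<-≤-trans (<sqrtUpper² b≥0 n) (*-mono uw≥0 v≥0 (ℚ.+-monoʳ-≤ u w≤η) (ℚ.+-monoʳ-≤ u w≤η))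
    s≤ : u +ᵠ (η +ᵠ η) ≤ᵠ sqrtLower a m
    s≤ = ℚ.<⇒≤ (ℚ.≰⇒> ¬p)
    s≥0 : 0ℚ ≤ᵠ u +ᵠ (η +ᵠ η)
    s≥0 = ℚ.+-mono-≤ u≥0 (ℚ.+-mono-≤ η≥0 η≥0)
    vη≥0 : 0ℚ ≤ᵠ v *ᵠ η
    vη≥0 = *-mono ℚ.≤-refl η≥0 v≥0 η≥0
    v²+η²≤a : v *ᵠ v +ᵠ η *ᵠ η ≤ᵠ a
    v²+η²≤a = ℚ.≤-trans (subst (v *ᵠ v +ᵠ η *ᵠ η ≤ᵠ_)
        (solve 2 (λ u η → (u :+ η) :* (u :+ η) :+ η :* η :+ ((u :+ η) :* η :+ (u :+ η) :* η)
                       := (u :+ (η :+ η)) :* (u :+ (η :+ η))) refl u η)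
        (p≤p+q (v *ᵠ v +ᵠ η *ᵠ η) (ℚ.+-mono-≤ vη≥0 vη≥0)))
      (ℚ.≤-trans (*-mono s≥0 (sqrtLower≥0 a≥0 m) s≤ s≤) (sqrtLower²≤ a≥0 m))

open SqrtEstimates

-- The square root of max(x, 0).
√ᴿ_ : ℝ → ℝ
seq    (√ᴿ x) n = sqrtLower (seq x n ⊔ᵠ 0ℚ) n
cauchy (√ᴿ x) = oneSided λ ε ε>0 →
  let x⁺ = x ⊔ᴿ fromℚ 0ℚ
      η = ε *ᵠ ½
      η>0 = half>0 ε>0
      (M , f) = oneSided⁻¹ x⁺ (η *ᵠ η) (*-pos η>0 η>0)
      (B , B≥0 , N , b) = eventually-bounded x⁺
      (K , k) = small (1ℚ +ᵠ B) η>0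
      x⁺≥0 = λ n → ℚ.p≤q⊔p (seq x n) 0ℚ
  in (M ℕ.⊔ N) ℕ.⊔ K , λ m n p q →
     let p₁ = ℕ.m⊔n≤o⇒m≤o (M ℕ.⊔ N) K p
         q₁ = ℕ.m⊔n≤o⇒m≤o (M ℕ.⊔ N) K q
         x⁺n≤B = ℚ.≤-trans (p≤∣p∣ (seq x⁺ n)) (b n (ℕ.m⊔n≤o⇒n≤o M N q₁))
     in subst (λ t → sqrtLower (seq x⁺ m) m ≤ᵠ sqrtLower (seq x⁺ n) n +ᵠ t) (half+half ε)
          (sqrt-close m n (x⁺≥0 m) (x⁺≥0 n) η>0
            (ℚ.≤-trans
              (ℚ.*-monoʳ-≤-nonNeg (½^ n) {{nonNegative (ℚ.<⇒≤ (½^>0 n))}} (ℚ.+-monoʳ-≤ 1ℚ x⁺n≤B))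
              (k n (ℕ.m⊔n≤o⇒n≤o (M ℕ.⊔ N) K q)))
            (f m n (ℕ.m⊔n≤o⇒m≤o M N p₁) (ℕ.m⊔n≤o⇒m≤o M N q₁)))

IsInfimum : (ℝ → Set) → ℝ → Set
IsInfimum S x =
  (∀ y → S y → x ≤ᴿ y) ×
  (∀ ε → 0ℚ <ᵠ ε → ∃[ y ] S y × y ≤ᴿ x +ᴿ fromℚ ε)

------------------------------------------------------------------------
-- Complex numbers

record ℂ : Set where
  constructor _+i_
  field
    re im : ℝ

open ℂ public

infix  4 _≈_ _,≈_
infixl 6 _+_
infixl 7 _*_
infix  8 -_
infixr 9 _^_

record _≈_ (z w : ℂ) : Set where
  constructor _,≈_
  field
    re≈ : re z ≈ᴿ re w
    im≈ : im z ≈ᴿ im w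

open _≈_ public

ratℂ : ℚ → ℂ
ratℂ q = fromℚ q +i fromℚ 0ℚ

intℂ : ℤ → ℂ
intℂ n = ratℂ (n ℚ./ 1)

0ℂ 1ℂ i i√3 : ℂ
0ℂ  = ratℂ 0ℚ
1ℂ  = ratℂ 1ℚ
i   = fromℚ 0ℚ +i fromℚ 1ℚ
i√3 = fromℚ 0ℚ +i (√ᴿ fromℚ (+ 3 ℚ./ 1))

_+_ _*_ : ℂ → ℂ → ℂ
(a +i b) + (c +i d) = (a +ᴿ c) +i (b +ᴿ d)
(a +i b) * (c +i d) = (a *ᴿ c -ᴿ b *ᴿ d) +i (a *ᴿ d +ᴿ b *ᴿ c)

-_ : ℂ → ℂ
- (a +i b) = (-ᴿ a) +i (-ᴿ b)

_^_ : ℂ → ℕ → ℂ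
z ^ zero  = 1ℂ
z ^ suc n = z * z ^ n

∣_∣ : ℂ → ℝ
∣ a +i b ∣ = √ᴿ (a *ᴿ a +ᴿ b *ᴿ b)

IsRootOfUnity : ℂ → Set
IsRootOfUnity ζ = ∃[ n ] ζ ^ suc n ≈ 1ℂ

-- The subfield of ℂ generated by γ.
data ℚ⟨_⟩ (γ : ℂ) : ℂ → Set where
  rational  : ∀ q → ℚ⟨ γ ⟩ (ratℂ q)
  generator : ℚ⟨ γ ⟩ γ
  sum       : ∀ {z w} → ℚ⟨ γ ⟩ z → ℚ⟨ γ ⟩ w → ℚ⟨ γ ⟩ (z + w)
  negation  : ∀ {z} → ℚ⟨ γ ⟩ z → ℚ⟨ γ ⟩ (- z)
  product   : ∀ {z w} → ℚ⟨ γ ⟩ z → ℚ⟨ γ ⟩ w → ℚ⟨ γ ⟩ (z * w)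
  inverse   : ∀ {z w} → z * w ≈ 1ℂ → ℚ⟨ γ ⟩ z → ℚ⟨ γ ⟩ w
  respects  : ∀ {z w} → z ≈ w → ℚ⟨ γ ⟩ z → ℚ⟨ γ ⟩ w

------------------------------------------------------------------------
-- Minimal polynomials and Mahler measures

-- Polynomials are coefficient vectors, constant coefficient first.

eval : ∀ {n} → Vec ℤ n → ℂ → ℂ
eval []       z = 0ℂ
eval (c ∷ cs) z = intℂ c + z * eval cs z

content : ∀ {n} → Vec ℤ n → ℤ
content = foldr _ ℤ.gcd (+ 0)

-- The coefficients of ∏ᵢ (x − rᵢ).
fromRoots : ∀ {n} → Vec ℂ n → Vec ℂ (suc n)
fromRoots []       = 1ℂ ∷ []
fromRoots (r ∷ rs) = zipWith _+_ (0ℂ ∷ p) (map (- r *_) p ∷ʳ 0ℂ)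
  where p = fromRoots rs

-- The minimal polynomial of γ over ℤ with its factorisation over ℂ; an
-- inhabitant exists precisely when γ is algebraic.  The coefficients having
-- content one says that the polynomial is primitive.
record MinimalPolynomial (γ : ℂ) : Set where
  field
    degree       : ℕ
    coefficients : Vec ℤ (suc degree)
    vanishes     : eval coefficients γ ≈ 0ℂ
    minimal      : ∀ {k} (q : Vec ℤ (suc k)) → q ≢ replicate (suc k) (+ 0) →
                   eval q γ ≈ 0ℂ → degree ℕ.≤ k
    contentOne   : content coefficients ≡ + 1
    leading>0    : + 0 ℤ.< last coefficients
    conjugates   : Vec ℂ degree
    factors      : Pointwise _≈_ (map intℂ coefficients)
                     (map (intℂ (last coefficients) *_) (fromRoots conjugates))

open MinimalPolynomial public using (degree)

M : ∀ {γ} → MinimalPolynomial γ → ℝ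
M f = foldr _ (λ z m → (fromℚ 1ℚ ⊔ᴿ ∣ z ∣) *ᴿ m) (fromℚ (last coefficients ℚ./ 1)) conjugates
  where open MinimalPolynomial f

RotatedMeasure : ℂ → ℝ → Set
RotatedMeasure γ m = ∃[ ζ ] IsRootOfUnity ζ × Σ[ f ∈ MinimalPolynomial (ζ * γ) ] m ≈ᴿ M f

-- IsM̄ γ m states that the modified Mahler measure of γ is m.
IsM̄ : ℂ → ℝ → Set
IsM̄ γ = IsInfimum (RotatedMeasure γ)

{-# OPTIONS --safe #-}

-- Let f = a X² + b X + c be the minimal polynomial of γ, with roots γ₁ and γ₂ (for rational γ
-- take the square of the linear one), and let h be that of β, where βⁿ = γ₁ⁿ.  The trinomial
-- Φ = aⁿ Xⁿ⁺ⁿ − s Xⁿ + cⁿ with s = aⁿ (γ₁ⁿ + γ₂ⁿ) is primitive, since s ≡ (−b)ⁿ modulo a c, so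
-- Φ = u h over ℤ.  Hence the conjugates of β have absolute value |γ₁| or |γ₂|, equally often
-- unless |γ₁| = |γ₂|, because otherwise a power of |γ₁| would be rational.  The contents of
-- Φ(c X) and of a²ⁿ Φ(X / a) are cⁿ and aⁿ, so those of the corresponding transforms of u are its
-- constant and its leading coefficient; with the product of the conjugates this bounds the leading
-- coefficient of u from above, that of h is at least a^(deg h / 2), and M(β) ≥ M(γ) follows if
-- deg h ≥ 2.  If β is rational and γ is not then γ / β is a root of unity ξ of degree 2; its trace
-- is an integer of absolute value at most 1, which leaves ±i and (±1 ± √−3) / 2.
-- Equality and order of reals are ¬¬-stable, so all of this may be argued classically.

module Submission where

open import Defs hiding (_+_; _*_; -_; _^_)
open import Algebra.Bundles using (CommutativeRing)
import Algebra.Solver.Ring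
open import Algebra.Solver.Ring.AlmostCommutativeRing using (_-Raw-AlmostCommutative⟶_; fromCommutativeRing)
open import Data.Empty using (⊥; ⊥-elim)
open import Data.Integer.Base as ℤ using (ℤ; +_; -[1+_])
  renaming (_+_ to _+ᶻ_; _*_ to _*ᶻ_; -_ to -ᶻ_; _^_ to _^ᶻ_)
open import Data.Integer.Divisibility.Signed as ℤ using (divides) renaming (_∣_ to _∣ᶻ_)
import Data.Integer.GCD as ℤ
import Data.Integer.Properties as ℤ
open import Data.Integer.Solver using () renaming (module +-*-Solver to ℤ-Solver)
open import Data.List.Base using ([]; _∷_)
import Data.List.Relation.Unary.All as List
open import Data.List.Relation.Unary.All using ([]; _∷_)
open import Data.Maybe.Base as Maybe using (Maybe)
open import Data.Nat.Base as ℕ using (ℕ; zero; suc; z≤n; s≤s; _≤_)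
import Data.Nat.Coprimality as Coprimality
import Data.Nat.Divisibility as ℕ
import Data.Nat.GCD as ℕ
import Data.Nat.ListAction as ℕ
open import Data.Nat.Primality using (Prime; prime?; euclidsLemma; ¬prime[1]; prime⇒nonZero)
open import Data.Nat.Primality.Factorisation using (factorise; PrimeFactorisation)
import Data.Nat.Properties as ℕ
open import Data.Nat.Solver using () renaming (module +-*-Solver to ℕ-Solver)
open import Data.Product.Base using (∃-syntax; _×_; _,_; proj₁; proj₂)
open import Data.Rational.Base as ℚ using (ℚ; 0ℚ; 1ℚ; ½; positive; nonNegative; ↥_; ↧_; toℚᵘ)
  renaming (_+_ to _+ᵠ_; _*_ to _*ᵠ_; _-_ to _-ᵠ_; -_ to -ᵠ_; _⊔_ to _⊔ᵠ_; ∣_∣ to ∣_∣ᵠ; _≤_ to _≤ᵠ_; _<_ to _<ᵠ_)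
import Data.Rational.Properties as ℚ
open import Data.Rational.Solver using () renaming (module +-*-Solver to ℚ-Solver)
import Data.Rational.Unnormalised.Base as ℚᵘ
import Data.Rational.Unnormalised.Properties as ℚᵘ
open import Data.Sum.Base as Sum using (_⊎_; inj₁; inj₂; [_,_]′)
open import Data.Vec.Base as Vec using (Vec; []; _∷_; _∷ʳ_; zipWith; foldr; last; replicate)
import Data.Vec.Properties as Vec
open import Data.Vec.Relation.Binary.Pointwise.Inductive using (Pointwise; []; _∷_)
open import Data.Vec.Relation.Unary.All using (All; []; _∷_)
open import Function.Base using (id; _∘_)
open import Level using (0ℓ)
open import Relation.Binary.Bundles using (Setoid)
open import Relation.Binary.PropositionalEquality
  using (_≡_; _≢_; _≗_; refl; sym; trans; cong; cong₂; subst; subst₂; module ≡-Reasoning)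
open import Relation.Nullary.Decidable.Core using (Dec; yes; no; dec⇒maybe; from-yes)
open import Relation.Nullary.Negation.Core using (¬_)
open import Relation.Unary using (_≐_)

open RationalEstimates
open PowersOfHalf
open CauchyEstimates

open ℚ-Solver using () renaming (solve to solveᵠ; _:=_ to _:=ᵠ_; _:+_ to _:+ᵠ_; _:*_ to _:*ᵠ_; :-_ to :-ᵠ_; _:-_ to _:-ᵠ_; con to conᵠ)
open ℤ-Solver using () renaming (solve to solveᶻ; _:=_ to _:=ᶻ_; _:+_ to _:+ᶻ_; _:*_ to _:*ᶻ_; :-_ to :-ᶻ_; con to conᶻ)

-- Embedding ℤ into ℚ

-- The root of unity ζ enters only through βⁿ = γⁿ, which makes β a root of a trinomial that depends
-- on n but not on ζ. The delicate quantity is then the leading coefficient of `h`: as a divisor of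
-- aⁿ it is bounded above, whereas a lower bound can only come from the cofactor `u`, an arbitrary
-- primitive polynomial. The two content statements say that a z and c / z are algebraic integers
-- for every root z of `u`; they play the part of p-adic absolute values of the roots and are
-- combined with the product of the roots through plain divisibility in ℕ. When |γ₁| = |γ₂| the
-- degree of `h` may be odd, so the outcome is a divisibility for the square of its leading
-- coefficient. For quadratic γ and deg h = 1 the same estimate would give only the square root of
-- M(γ); this is why a rational β needs the separate argument about ξ, and why exactly the numbers
-- that can be rotated to rational ones are exceptional.

intᵠ : ℤ → ℚ
intᵠ n = n ℚ./ 1

toℚᵘ-intᵠ : ∀ n → toℚᵘ (intᵠ n) ℚᵘ.≃ ℚᵘ.mkℚᵘ n 0
toℚᵘ-intᵠ n = ℚ.toℚᵘ-fromℚᵘ (ℚᵘ.mkℚᵘ n 0)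

intᵠ-+ : ∀ m n → intᵠ (m ℤ.+ n) ≡ intᵠ m ℚ.+ intᵠ n
intᵠ-+ m n = ℚ.toℚᵘ-injective (ℚᵘ.≃-trans (toℚᵘ-intᵠ (m ℤ.+ n)) (ℚᵘ.≃-trans
  (ℚᵘ.*≡* (cong (ℤ._* + 1) (sym (cong₂ ℤ._+_ (ℤ.*-identityʳ m) (ℤ.*-identityʳ n)))))
  (ℚᵘ.≃-sym (ℚᵘ.≃-trans (ℚ.toℚᵘ-homo-+ (intᵠ m) (intᵠ n)) (ℚᵘ.+-cong (toℚᵘ-intᵠ m) (toℚᵘ-intᵠ n))))))

intᵠ-* : ∀ m n → intᵠ (m ℤ.* n) ≡ intᵠ m ℚ.* intᵠ n
intᵠ-* m n = ℚ.toℚᵘ-injective (ℚᵘ.≃-trans (toℚᵘ-intᵠ (m ℤ.* n))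
  (ℚᵘ.≃-sym (ℚᵘ.≃-trans (ℚ.toℚᵘ-homo-* (intᵠ m) (intᵠ n)) (ℚᵘ.*-cong (toℚᵘ-intᵠ m) (toℚᵘ-intᵠ n)))))

intᵠ-neg : ∀ m → intᵠ (ℤ.- m) ≡ ℚ.- intᵠ m
intᵠ-neg m = ℚ.toℚᵘ-injective (ℚᵘ.≃-trans (toℚᵘ-intᵠ (ℤ.- m))
  (ℚᵘ.≃-sym (ℚᵘ.≃-trans (ℚ.toℚᵘ-homo‿- (intᵠ m)) (ℚᵘ.-‿cong (toℚᵘ-intᵠ m)))))

intᵠ-injective : ∀ {m n} → intᵠ m ≡ intᵠ n → m ≡ n
intᵠ-injective {m} {n} eq with ℚᵘ.≃-trans (ℚᵘ.≃-sym (toℚᵘ-intᵠ m)) (ℚᵘ.≃-trans (ℚᵘ.≃-reflexive (cong toℚᵘ eq)) (toℚᵘ-intᵠ n))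
... | ℚᵘ.*≡* h = trans (sym (ℤ.*-identityʳ m)) (trans h (ℤ.*-identityʳ n))

intᵠ-mono : ∀ {m n} → m ℤ.≤ n → intᵠ m ℚ.≤ intᵠ n
intᵠ-mono {m} {n} h = ℚ.toℚᵘ-cancel-≤ (ℚᵘ.≤-trans (ℚᵘ.≤-reflexive (toℚᵘ-intᵠ m))
  (ℚᵘ.≤-trans (ℚᵘ.*≤* (subst₂ ℤ._≤_ (sym (ℤ.*-identityʳ m)) (sym (ℤ.*-identityʳ n)) h)) (ℚᵘ.≤-reflexive (ℚᵘ.≃-sym (toℚᵘ-intᵠ n)))))

intᵠ-cancel : ∀ {m n} → intᵠ m ℚ.≤ intᵠ n → m ℤ.≤ n
intᵠ-cancel {m} {n} h with ℚᵘ.≤-trans (ℚᵘ.≤-reflexive (ℚᵘ.≃-sym (toℚᵘ-intᵠ m)))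
  (ℚᵘ.≤-trans (ℚ.toℚᵘ-mono-≤ h) (ℚᵘ.≤-reflexive (toℚᵘ-intᵠ n)))
... | ℚᵘ.*≤* k = subst₂ ℤ._≤_ (ℤ.*-identityʳ m) (ℤ.*-identityʳ n) k

-- Real numbers as an ordered ring

pointwise : ∀ {x y} → (∀ n → seq x n ≡ seq y n) → x ≈ᴿ y
pointwise {x} {y} h = mk≈ᴿ λ ε ε>0 → 0 , λ n _ →
  subst (λ t → ∣ t ∣ᵠ ≤ᵠ ε) (sym (trans (cong (_-ᵠ seq y n) (h n)) (ℚ.+-inverseʳ (seq y n)))) (ℚ.<⇒≤ ε>0)

pointwise≤ : ∀ {x y} → (∀ n → seq x n ≤ᵠ seq y n) → x ≤ᴿ y
pointwise≤ {x} {y} h = mk≤ᴿ λ ε ε>0 → 0 , λ n _ → ℚ.≤-trans (h n) (p≤p+q (seq y n) (ℚ.<⇒≤ ε>0))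

≈ᴿ⇒≤ᴿ : ∀ {x y} → x ≈ᴿ y → x ≤ᴿ y
≈ᴿ⇒≤ᴿ h = mk≤ᴿ λ ε ε>0 → let (N , f) = eventually≈ h ε ε>0 in N , λ n p → ∣-∣≤⁻¹ (f n p)

≤ᴿ-antisym : ∀ {x y} → x ≤ᴿ y → y ≤ᴿ x → x ≈ᴿ y
≤ᴿ-antisym h k = mk≈ᴿ λ ε ε>0 →
  let (M , f) = eventually≤ h ε ε>0 ; (N , g) = eventually≤ k ε ε>0
  in M ℕ.⊔ N , λ n p → ∣-∣≤ (f n (ℕ.m⊔n≤o⇒m≤o M N p)) (g n (ℕ.m⊔n≤o⇒n≤o M N p))

≤ᴿ-trans : ∀ {x y z} → x ≤ᴿ y → y ≤ᴿ z → x ≤ᴿ z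
≤ᴿ-trans {x} {y} {z} h k = mk≤ᴿ λ ε ε>0 →
  let (M , f) = eventually≤ h (ε *ᵠ ½) (half>0 ε>0) ; (N , g) = eventually≤ k (ε *ᵠ ½) (half>0 ε>0)
  in M ℕ.⊔ N , λ n p → ℚ.≤-trans (f n (ℕ.m⊔n≤o⇒m≤o M N p))
       (subst (seq y n +ᵠ ε *ᵠ ½ ≤ᵠ_)
         (trans (ℚ.+-assoc (seq z n) _ _) (cong (seq z n +ᵠ_) (half+half ε)))
         (ℚ.+-monoˡ-≤ (ε *ᵠ ½) (g n (ℕ.m⊔n≤o⇒n≤o M N p))))

≈ᴿ-refl : ∀ {x} → x ≈ᴿ x
≈ᴿ-refl = pointwise λ _ → refl

≡⇒≈ᴿ : ∀ {x y} → x ≡ y → x ≈ᴿ y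
≡⇒≈ᴿ refl = ≈ᴿ-refl

≈ᴿ-sym : ∀ {x y} → x ≈ᴿ y → y ≈ᴿ x
≈ᴿ-sym {x} {y} h = mk≈ᴿ λ ε ε>0 → let (N , f) = eventually≈ h ε ε>0 in
  N , λ n p → subst (_≤ᵠ ε)
    (trans (sym (ℚ.∣-p∣≡∣p∣ (seq x n -ᵠ seq y n)))
      (cong ∣_∣ᵠ (solveᵠ 2 (λ a b → :-ᵠ (a :-ᵠ b) :=ᵠ b :-ᵠ a) refl (seq x n) (seq y n)))) (f n p)

≈ᴿ-trans : ∀ {x y z} → x ≈ᴿ y → y ≈ᴿ z → x ≈ᴿ z
≈ᴿ-trans h k = ≤ᴿ-antisym (≤ᴿ-trans (≈ᴿ⇒≤ᴿ h) (≈ᴿ⇒≤ᴿ k)) (≤ᴿ-trans (≈ᴿ⇒≤ᴿ (≈ᴿ-sym k)) (≈ᴿ⇒≤ᴿ (≈ᴿ-sym h)))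

≤ᴿ-refl : ∀ {x} → x ≤ᴿ x
≤ᴿ-refl = ≈ᴿ⇒≤ᴿ ≈ᴿ-refl

≤ᴿ-respʳ : ∀ {x y z} → y ≈ᴿ z → x ≤ᴿ y → x ≤ᴿ z
≤ᴿ-respʳ e h = ≤ᴿ-trans h (≈ᴿ⇒≤ᴿ e)

≤ᴿ-respˡ : ∀ {x y z} → x ≈ᴿ z → x ≤ᴿ y → z ≤ᴿ y
≤ᴿ-respˡ e h = ≤ᴿ-trans (≈ᴿ⇒≤ᴿ (≈ᴿ-sym e)) h

infixl 6 _+ʳ_ _⊔ʳ_
infixl 7 _*ʳ_
infix  8 -ʳ_

-- The record ℝ has η-equality, so Agda compares applications of the
-- operations of Defs by unfolding their Cauchy proofs; sealing the operations
-- prevents this.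
opaque
  _+ʳ_ _*ʳ_ _⊔ʳ_ : ℝ → ℝ → ℝ
  _+ʳ_ = _+ᴿ_
  _*ʳ_ = _*ᴿ_
  _⊔ʳ_ = _⊔ᴿ_

  -ʳ_ √ʳ_ : ℝ → ℝ
  -ʳ_ = -ᴿ_
  √ʳ_ = √ᴿ_

  ratʳ : ℚ → ℝ
  ratʳ = fromℚ

  intʳ : ℤ → ℝ
  intʳ n = fromℚ (intᵠ n)

0ʳ 1ʳ : ℝ
0ʳ = intʳ (+ 0)
1ʳ = intʳ (+ 1)

opaque
  unfolding _+ʳ_

  +ʳ-mono : ∀ {x x' y y'} → x ≤ᴿ x' → y ≤ᴿ y' → x +ʳ y ≤ᴿ x' +ʳ y'
  +ʳ-mono {x} {x'} {y} {y'} h k = mk≤ᴿ λ ε ε>0 →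
    let (M , f) = eventually≤ h (ε *ᵠ ½) (half>0 ε>0) ; (N , g) = eventually≤ k (ε *ᵠ ½) (half>0 ε>0)
    in M ℕ.⊔ N , λ n p → subst (seq x n +ᵠ seq y n ≤ᵠ_)
         (trans (solveᵠ 3 (λ a b h → (a :+ᵠ h) :+ᵠ (b :+ᵠ h) :=ᵠ a :+ᵠ b :+ᵠ (h :+ᵠ h)) refl (seq x' n) (seq y' n) (ε *ᵠ ½))
           (cong (seq x' n +ᵠ seq y' n +ᵠ_) (half+half ε)))
         (ℚ.+-mono-≤ (f n (ℕ.m⊔n≤o⇒m≤o M N p)) (g n (ℕ.m⊔n≤o⇒n≤o M N p)))

  -ʳ-cong : ∀ {x y} → x ≈ᴿ y → -ʳ x ≈ᴿ -ʳ y
  -ʳ-cong {x} {y} h = mk≈ᴿ λ ε ε>0 → let (N , f) = eventually≈ (≈ᴿ-sym h) ε ε>0 in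
    N , λ n p → subst (λ t → ∣ t ∣ᵠ ≤ᵠ ε)
      (solveᵠ 2 (λ a b → b :-ᵠ a :=ᵠ (:-ᵠ a) :-ᵠ (:-ᵠ b)) refl (seq x n) (seq y n)) (f n p)

  *ʳ-congʳ : ∀ {x x'} y → x ≈ᴿ x' → x *ʳ y ≈ᴿ x' *ʳ y
  *ʳ-congʳ {x} {x'} y h = mk≈ᴿ λ ε ε>0 →
    let (B , B≥0 , M , b) = eventually-bounded y
        -- The bound `B` may be 0; adding 1 makes the quotient of ε by `D` meaningful.
        D = B +ᵠ 1ℚ
        D>0 : 0ℚ <ᵠ D
        D>0 = ℚ.+-mono-≤-< B≥0 (ℚ.positive⁻¹ 1ℚ)
        δ = ε *ᵠ (ℚ.1/ D) {{ℚ.>-nonZero D>0}}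
        δ>0 : 0ℚ <ᵠ δ
        δ>0 = *-pos ε>0 (ℚ.positive⁻¹ _ {{ℚ.1/pos⇒pos D {{positive D>0}}}})
        Dδ : δ *ᵠ D ≡ ε
        Dδ = trans (ℚ.*-assoc ε _ D) (trans (cong (ε *ᵠ_) (ℚ.*-inverseˡ D {{ℚ.>-nonZero D>0}})) (ℚ.*-identityʳ ε))
        (N , f) = eventually≈ h δ δ>0
    in M ℕ.⊔ N , λ n p → subst₂ _≤ᵠ_
         (trans (sym (ℚ.∣p*q∣≡∣p∣*∣q∣ (seq x n -ᵠ seq x' n) (seq y n)))
           (cong ∣_∣ᵠ (solveᵠ 3 (λ a b c → (a :-ᵠ b) :*ᵠ c :=ᵠ a :*ᵠ c :-ᵠ b :*ᵠ c) refl (seq x n) (seq x' n) (seq y n))))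
         Dδ
         (*-mono (ℚ.0≤∣p∣ _) (ℚ.<⇒≤ D>0) (f n (ℕ.m⊔n≤o⇒n≤o M N p))
           (ℚ.≤-trans (b n (ℕ.m⊔n≤o⇒m≤o M N p)) (p≤p+q B (ℚ.<⇒≤ (ℚ.positive⁻¹ 1ℚ)))))

  +ʳ-assoc : ∀ x y z → (x +ʳ y) +ʳ z ≈ᴿ x +ʳ (y +ʳ z)
  +ʳ-assoc x y z = pointwise λ n → ℚ.+-assoc (seq x n) (seq y n) (seq z n)

  +ʳ-comm : ∀ x y → x +ʳ y ≈ᴿ y +ʳ x
  +ʳ-comm x y = pointwise λ n → ℚ.+-comm (seq x n) (seq y n)

  +ʳ-identityˡ : ∀ x → 0ʳ +ʳ x ≈ᴿ x
  +ʳ-identityˡ x = pointwise λ n → ℚ.+-identityˡ (seq x n)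

  +ʳ-inverseˡ : ∀ x → -ʳ x +ʳ x ≈ᴿ 0ʳ
  +ʳ-inverseˡ x = pointwise λ n → ℚ.+-inverseˡ (seq x n)

  *ʳ-assoc : ∀ x y z → (x *ʳ y) *ʳ z ≈ᴿ x *ʳ (y *ʳ z)
  *ʳ-assoc x y z = pointwise λ n → ℚ.*-assoc (seq x n) (seq y n) (seq z n)

  *ʳ-comm : ∀ x y → x *ʳ y ≈ᴿ y *ʳ x
  *ʳ-comm x y = pointwise λ n → ℚ.*-comm (seq x n) (seq y n)

  *ʳ-identityˡ : ∀ x → 1ʳ *ʳ x ≈ᴿ x
  *ʳ-identityˡ x = pointwise λ n → ℚ.*-identityˡ (seq x n)

  *ʳ-distribʳ : ∀ x y z → (y +ʳ z) *ʳ x ≈ᴿ y *ʳ x +ʳ z *ʳ x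
  *ʳ-distribʳ x y z = pointwise λ n → ℚ.*-distribʳ-+ (seq x n) (seq y n) (seq z n)

  ratʳ-+ : ∀ p q → ratʳ (p +ᵠ q) ≈ᴿ ratʳ p +ʳ ratʳ q
  ratʳ-+ p q = pointwise λ n → refl

  ratʳ-* : ∀ p q → ratʳ (p *ᵠ q) ≈ᴿ ratʳ p *ʳ ratʳ q
  ratʳ-* p q = pointwise λ n → refl

  ratʳ-neg : ∀ p → ratʳ (-ᵠ p) ≈ᴿ -ʳ ratʳ p
  ratʳ-neg p = pointwise λ n → refl

  intʳ≡ratʳ : ∀ n → intʳ n ≡ ratʳ (intᵠ n)
  intʳ≡ratʳ n = refl

  intʳ-+ : ∀ m n → intʳ (m ℤ.+ n) ≈ᴿ intʳ m +ʳ intʳ n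
  intʳ-+ m n = pointwise λ _ → intᵠ-+ m n

  intʳ-* : ∀ m n → intʳ (m ℤ.* n) ≈ᴿ intʳ m *ʳ intʳ n
  intʳ-* m n = pointwise λ _ → intᵠ-* m n

  intʳ-neg : ∀ m → intʳ (ℤ.- m) ≈ᴿ -ʳ intʳ m
  intʳ-neg m = pointwise λ _ → intᵠ-neg m

+ʳ-cong : ∀ {x x' y y'} → x ≈ᴿ x' → y ≈ᴿ y' → x +ʳ y ≈ᴿ x' +ʳ y'
+ʳ-cong h k = ≤ᴿ-antisym (+ʳ-mono (≈ᴿ⇒≤ᴿ h) (≈ᴿ⇒≤ᴿ k)) (+ʳ-mono (≈ᴿ⇒≤ᴿ (≈ᴿ-sym h)) (≈ᴿ⇒≤ᴿ (≈ᴿ-sym k)))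

*ʳ-cong : ∀ {x x' y y'} → x ≈ᴿ x' → y ≈ᴿ y' → x *ʳ y ≈ᴿ x' *ʳ y'
*ʳ-cong {x} {x'} {y} {y'} h k = ≈ᴿ-trans (*ʳ-congʳ y h)
  (≈ᴿ-trans (*ʳ-comm x' y) (≈ᴿ-trans (*ʳ-congʳ x' k) (*ʳ-comm y' x')))

ℝ-setoid : Setoid 0ℓ 0ℓ
ℝ-setoid = record { _≈_ = _≈ᴿ_ ; isEquivalence = record { refl = ≈ᴿ-refl ; sym = ≈ᴿ-sym ; trans = ≈ᴿ-trans } }

ℝ-commutativeRing : CommutativeRing 0ℓ 0ℓ
ℝ-commutativeRing = record
  { Carrier = ℝ ; _≈_ = _≈ᴿ_ ; _+_ = _+ʳ_ ; _*_ = _*ʳ_ ; -_ = -ʳ_ ; 0# = 0ʳ ; 1# = 1ʳ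
  ; isCommutativeRing = record
    { isRing = record
      { +-isAbelianGroup = record
        { isGroup = record
          { isMonoid = record
            { isSemigroup = record
              { isMagma = record
                { isEquivalence = Setoid.isEquivalence ℝ-setoid
                ; ∙-cong = +ʳ-cong }
              ; assoc = +ʳ-assoc }
            ; identity = comm∧idˡ⇒id +ʳ-comm +ʳ-identityˡ }
          ; inverse = comm∧invˡ⇒inv +ʳ-comm +ʳ-inverseˡ
          ; ⁻¹-cong = -ʳ-cong }
        ; comm = +ʳ-comm }
      ; *-cong = *ʳ-cong
      ; *-assoc = *ʳ-assoc
      ; *-identity = comm∧idˡ⇒id *ʳ-comm *ʳ-identityˡ
      ; distrib = comm∧distrʳ⇒distr +ʳ-cong *ʳ-comm *ʳ-distribʳ }
    ; *-comm = *ʳ-comm } }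
  where
  open import Algebra.Consequences.Setoid ℝ-setoid

private
  ℝ-morphism : ℤ.+-*-rawRing -Raw-AlmostCommutative⟶ fromCommutativeRing ℝ-commutativeRing
  ℝ-morphism = record { ⟦_⟧ = intʳ ; +-homo = intʳ-+ ; *-homo = intʳ-* ; -‿homo = intʳ-neg ; 0-homo = ≈ᴿ-refl ; 1-homo = ≈ᴿ-refl }

  intʳ-≟ : ∀ m n → Maybe (intʳ m ≈ᴿ intʳ n)
  intʳ-≟ m n = Maybe.map (≡⇒≈ᴿ ∘ cong intʳ) (dec⇒maybe (m ℤ.≟ n))

module ℝ-Solver = Algebra.Solver.Ring ℤ.+-*-rawRing (fromCommutativeRing ℝ-commutativeRing) ℝ-morphism intʳ-≟
open ℝ-Solver using () renaming (solve to solveʳ; _:=_ to _:=ʳ_; _:+_ to _:+ʳ_; _:*_ to _:*ʳ_; :-_ to :-ʳ_; con to conʳ)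

-- Uniform error bounds for the bisection square root

sqrtLower≤ : ∀ B {q} → 0ℚ ≤ᵠ B → 0ℚ ≤ᵠ q → q ≤ᵠ B → ∀ n → sqrtLower q n ≤ᵠ 1ℚ +ᵠ B
sqrtLower≤ B {q} B≥0 q≥0 q≤B n with sqrtLower q n ℚ.≤? 1ℚ +ᵠ B
... | yes p = p
-- A value above `D` = 1 + B would have a square of at least D² ≥ D > B ≥ q.
... | no ¬p = ⊥-elim (ℚ.<-irrefl refl (ℚ.<-≤-trans B<D (ℚ.≤-trans
        (subst (_≤ᵠ D *ᵠ D) (ℚ.*-identityʳ D) (*-mono D≥0 D≥0 ℚ.≤-refl (p≤p+q 1ℚ B≥0)))
        (ℚ.≤-trans (*-mono D≥0 (sqrtLower≥0 q≥0 n) D≤s D≤s) (ℚ.≤-trans (sqrtLower²≤ q≥0 n) q≤B)))))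
  where
  D = 1ℚ +ᵠ B
  D≥0 : 0ℚ ≤ᵠ D
  D≥0 = ℚ.+-mono-≤ (ℚ.<⇒≤ (ℚ.positive⁻¹ 1ℚ)) B≥0
  D≤s = ℚ.<⇒≤ (ℚ.≰⇒> ¬p)
  B<D : B <ᵠ D
  B<D = subst (_<ᵠ D) (ℚ.+-identityˡ B) (ℚ.+-monoˡ-< B (ℚ.positive⁻¹ 1ℚ))

-- For the bracket from s to s + w the left-hand side is (s + w)² - s². The radicand of `√ᴿ` changes
-- with the stage n, so the decay must depend on the bound `B` and not on `q`.
sqrt-defect≤ : ∀ B {q} → 0ℚ ≤ᵠ B → 0ℚ ≤ᵠ q → q ≤ᵠ B → ∀ n →
  sqrtWidth q n *ᵠ (sqrtLower q n +ᵠ sqrtLower q n +ᵠ sqrtWidth q n)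
    ≤ᵠ (1ℚ +ᵠ B) *ᵠ ((1ℚ +ᵠ B) +ᵠ (1ℚ +ᵠ B) +ᵠ (1ℚ +ᵠ B)) *ᵠ ½^ n
sqrt-defect≤ B {q} B≥0 q≥0 q≤B n = ℚ.≤-trans
  (*-mono (sqrtWidth≥0 q≥0 n) 3D≥0 w≤ (ℚ.+-mono-≤ (ℚ.+-mono-≤ s≤ s≤) (ℚ.≤-trans w≤ D½≤D)))
  (ℚ.≤-reflexive (solveᵠ 3 (λ a b h → a :*ᵠ h :*ᵠ b :=ᵠ a :*ᵠ b :*ᵠ h) refl D (D +ᵠ D +ᵠ D) (½^ n)))
  where
  D = 1ℚ +ᵠ B
  D≥0 : 0ℚ ≤ᵠ D
  D≥0 = ℚ.+-mono-≤ (ℚ.<⇒≤ (ℚ.positive⁻¹ 1ℚ)) B≥0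
  3D≥0 : 0ℚ ≤ᵠ D +ᵠ D +ᵠ D
  3D≥0 = ℚ.+-mono-≤ (ℚ.+-mono-≤ D≥0 D≥0) D≥0
  s≤ = sqrtLower≤ B B≥0 q≥0 q≤B n
  w≤ : sqrtWidth q n ≤ᵠ D *ᵠ ½^ n
  w≤ = ℚ.*-monoʳ-≤-nonNeg (½^ n) {{nonNegative (ℚ.<⇒≤ (½^>0 n))}} (ℚ.+-monoʳ-≤ 1ℚ q≤B)
  D½≤D : D *ᵠ ½^ n ≤ᵠ D
  D½≤D = subst (D *ᵠ ½^ n ≤ᵠ_) (ℚ.*-identityʳ D) (ℚ.*-monoˡ-≤-nonNeg D {{nonNegative D≥0}} (½^≤1 n))

-- Comparison of reals with rationals

opaque
  unfolding _+ʳ_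

  ratʳ-mono : ∀ {p q} → p ≤ᵠ q → ratʳ p ≤ᴿ ratʳ q
  ratʳ-mono h = pointwise≤ λ _ → h

  ≤ᴿ-archimedean : ∀ {x} → (∀ ε → 0ℚ <ᵠ ε → x ≤ᴿ ratʳ ε) → x ≤ᴿ 0ʳ
  ≤ᴿ-archimedean {x} h = mk≤ᴿ λ ε ε>0 →
    let (N , f) = eventually≤ (h (ε *ᵠ ½) (half>0 ε>0)) (ε *ᵠ ½) (half>0 ε>0)
    in N , λ n p → subst (seq x n ≤ᵠ_) (trans (half+half ε) (sym (ℚ.+-identityˡ ε))) (f n p)

  ratʳ-cancel-≤ : ∀ {p q} → ratʳ p ≤ᴿ ratʳ q → p ≤ᵠ q
  ratʳ-cancel-≤ {p} {q} h with p ℚ.≤? q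
  ... | yes p≤q = p≤q
  -- For r strictly between q and p, the inequality of reals used with slack r - q gives p ≤ r,
  -- contradicting r < p.
  ... | no p≰q = ⊥-elim (let (r , q<r , r<p) = ℚ.<-dense (ℚ.≰⇒> p≰q) in absurd r q<r r<p)
    where
    absurd : ∀ r → q <ᵠ r → r <ᵠ p → ⊥
    absurd r q<r r<p = ℚ.<-irrefl {p} refl (ℚ.≤-<-trans {p} {r} {p} p≤r r<p)
      where
      r-q>0 : 0ℚ <ᵠ r -ᵠ q
      r-q>0 = subst (_<ᵠ r -ᵠ q) (ℚ.+-inverseʳ q) (ℚ.+-monoˡ-< (-ᵠ q) {q} {r} q<r)
      p≤r : p ≤ᵠ r
      p≤r = let (N , f) = eventually≤ h (r -ᵠ q) r-q>0 in
        subst (p ≤ᵠ_) (solveᵠ 2 (λ q r → q :+ᵠ (r :-ᵠ q) :=ᵠ r) refl q r) (f N ℕ.≤-refl)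

  -- Some term `seq x N` is within δ of all later ones. Comparing this single rational with b + δ,
  -- the midpoint of b and a, leaves room δ on either side.
  separate : ∀ x a b δ → 0ℚ <ᵠ δ → b +ᵠ δ +ᵠ δ ≡ a → x ≤ᴿ ratʳ a ⊎ ratʳ b ≤ᴿ x
  separate x a b δ δ>0 eq = compare (oneSided⁻¹ x δ δ>0)
    where
    cancel : ∀ a b → a +ᵠ b +ᵠ -ᵠ b ≡ a
    cancel = solveᵠ 2 (λ a b → a :+ᵠ b :+ᵠ :-ᵠ b :=ᵠ a) refl
    split : ∀ N → (∀ m n → N ℕ.≤ m → N ℕ.≤ n → seq x m ≤ᵠ seq x n +ᵠ δ) → Dec (seq x N ≤ᵠ b +ᵠ δ) →
      x ≤ᴿ ratʳ a ⊎ ratʳ b ≤ᴿ x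
    split N f (yes p) = inj₁ (mk≤ᴿ λ η η>0 → N , λ n N≤n → ℚ.≤-trans {seq x n} {a} {a +ᵠ η}
            (ℚ.≤-trans {seq x n} {seq x N +ᵠ δ} {a} (f n N N≤n ℕ.≤-refl)
              (subst (seq x N +ᵠ δ ≤ᵠ_) eq (ℚ.+-monoˡ-≤ δ {seq x N} {b +ᵠ δ} p)))
            (p≤p+q a {η} (ℚ.<⇒≤ {0ℚ} {η} η>0)))
    split N f (no ¬p) = inj₂ (mk≤ᴿ λ η η>0 → N , λ n N≤n → ℚ.≤-trans {b} {seq x n} {seq x n +ᵠ η}
            (subst₂ _≤ᵠ_ (cancel b δ) (cancel (seq x n) δ)
              (ℚ.+-monoˡ-≤ (-ᵠ δ) {b +ᵠ δ} {seq x n +ᵠ δ}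
                (ℚ.≤-trans {b +ᵠ δ} {seq x N} {seq x n +ᵠ δ} (ℚ.<⇒≤ {b +ᵠ δ} {seq x N} (ℚ.≰⇒> {seq x N} {b +ᵠ δ} ¬p)) (f N n ℕ.≤-refl N≤n))))
            (p≤p+q (seq x n) {η} (ℚ.<⇒≤ {0ℚ} {η} η>0)))
    compare : (∃[ N ] (∀ m n → N ℕ.≤ m → N ℕ.≤ n → seq x m ≤ᵠ seq x n +ᵠ δ)) → x ≤ᴿ ratʳ a ⊎ ratʳ b ≤ᴿ x
    compare (N , f) = split N f (seq x N ℚ.≤? b +ᵠ δ)

ratʳ-injective : ∀ {p q} → ratʳ p ≈ᴿ ratʳ q → p ≡ q
ratʳ-injective h = ℚ.≤-antisym (ratʳ-cancel-≤ (≈ᴿ⇒≤ᴿ h)) (ratʳ-cancel-≤ (≈ᴿ⇒≤ᴿ (≈ᴿ-sym h)))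

ratʳ-0 : ratʳ 0ℚ ≡ 0ʳ
ratʳ-0 = sym (intʳ≡ratʳ (+ 0))

ratʳ-1 : ratʳ 1ℚ ≡ 1ʳ
ratʳ-1 = sym (intʳ≡ratʳ (+ 1))

ratʳ-nonneg : ∀ {p} → 0ℚ ≤ᵠ p → 0ʳ ≤ᴿ ratʳ p
ratʳ-nonneg {p} h = subst (_≤ᴿ ratʳ p) ratʳ-0 (ratʳ-mono {0ℚ} {p} h)

≤ᴿ-cotransitive : ∀ x ε → 0ℚ <ᵠ ε → x ≤ᴿ ratʳ ε ⊎ ratʳ (ε *ᵠ ½) ≤ᴿ x
≤ᴿ-cotransitive x ε ε>0 = separate x ε (ε *ᵠ ½) (ε *ᵠ ½ *ᵠ ½) (half>0 {ε *ᵠ ½} (half>0 {ε} ε>0))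
  (trans (ℚ.+-assoc (ε *ᵠ ½) (ε *ᵠ ½ *ᵠ ½) (ε *ᵠ ½ *ᵠ ½))
    (trans (cong (ε *ᵠ ½ +ᵠ_) (half+half (ε *ᵠ ½))) (half+half ε)))

-- Maxima, products and square roots in the order

opaque
  unfolding _+ʳ_

  x≤x⊔y : ∀ x y → x ≤ᴿ x ⊔ʳ y
  x≤x⊔y x y = pointwise≤ λ n → ℚ.p≤p⊔q (seq x n) (seq y n)

  y≤x⊔y : ∀ x y → y ≤ᴿ x ⊔ʳ y
  y≤x⊔y x y = pointwise≤ λ n → ℚ.p≤q⊔p (seq x n) (seq y n)

  ⊔ʳ-lub : ∀ {x y z} → x ≤ᴿ z → y ≤ᴿ z → x ⊔ʳ y ≤ᴿ z
  ⊔ʳ-lub h k = mk≤ᴿ λ ε ε>0 →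
    let (M , f) = eventually≤ h ε ε>0 ; (N , g) = eventually≤ k ε ε>0
    in M ℕ.⊔ N , λ n p → ⊔-lub (f n (ℕ.m⊔n≤o⇒m≤o M N p)) (g n (ℕ.m⊔n≤o⇒n≤o M N p))

  -- The terms of a non-negative real are bounded below only up to ε, whereas those of a positive
  -- part are non-negative themselves. `*ʳ-nonneg` therefore replaces its factors by their positive
  -- parts.
  ⁺*⁺-nonneg : ∀ x y → 0ʳ ≤ᴿ (x ⊔ʳ 0ʳ) *ʳ (y ⊔ʳ 0ʳ)
  ⁺*⁺-nonneg x y = pointwise≤ λ n →
    *-mono ℚ.≤-refl (ℚ.p≤q⊔p (seq y n) 0ℚ) (ℚ.p≤q⊔p (seq x n) 0ℚ) (ℚ.p≤q⊔p (seq y n) 0ℚ)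

  √-nonneg : ∀ x → 0ʳ ≤ᴿ √ʳ x
  √-nonneg x = pointwise≤ λ n → sqrtLower≥0 (ℚ.p≤q⊔p (seq x n) 0ℚ) n

  √-square⁺ : ∀ x → √ʳ x *ʳ √ʳ x ≈ᴿ x ⊔ʳ 0ʳ
  √-square⁺ x = mk≈ᴿ λ ε ε>0 →
    let (B , B≥0 , N , b) = eventually-bounded (x ⊔ʳ 0ʳ)
        D = 1ℚ +ᵠ B
        (K , k) = small (D *ᵠ (D +ᵠ D +ᵠ D)) ε>0
    in N ℕ.⊔ K , λ n p →
    let q = seq (x ⊔ʳ 0ʳ) n
        q≥0 = ℚ.p≤q⊔p (seq x n) 0ℚ
        s = sqrtLower q n
        w = sqrtWidth q n
        q≤B = ℚ.≤-trans (p≤∣p∣ q) (b n (ℕ.m⊔n≤o⇒m≤o N K p))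
    in ∣-∣≤ (ℚ.≤-trans (sqrtLower²≤ q≥0 n) (p≤p+q q (ℚ.<⇒≤ ε>0)))
         (ℚ.≤-trans (ℚ.<⇒≤ (<sqrtUpper² q≥0 n)) (ℚ.≤-trans
           (ℚ.≤-reflexive (solveᵠ 2 (λ s w → (s :+ᵠ w) :*ᵠ (s :+ᵠ w) :=ᵠ s :*ᵠ s :+ᵠ w :*ᵠ (s :+ᵠ s :+ᵠ w)) refl s w))
           (ℚ.+-monoʳ-≤ (s *ᵠ s) (ℚ.≤-trans (sqrt-defect≤ B B≥0 q≥0 q≤B n) (k n (ℕ.m⊔n≤o⇒n≤o N K p))))))

x≤y⇒0≤y-x : ∀ {x y} → x ≤ᴿ y → 0ʳ ≤ᴿ y +ʳ -ʳ x
x≤y⇒0≤y-x {x} {y} h = ≤ᴿ-respˡ (solveʳ 1 (λ x → x :+ʳ :-ʳ x :=ʳ conʳ (+ 0)) ≈ᴿ-refl x) (+ʳ-mono h ≤ᴿ-refl)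

0≤y-x⇒x≤y : ∀ {x y} → 0ʳ ≤ᴿ y +ʳ -ʳ x → x ≤ᴿ y
0≤y-x⇒x≤y {x} {y} h = ≤ᴿ-respˡ (solveʳ 1 (λ x → conʳ (+ 0) :+ʳ x :=ʳ x) ≈ᴿ-refl x)
  (≤ᴿ-respʳ (solveʳ 2 (λ x y → y :+ʳ :-ʳ x :+ʳ x :=ʳ y) ≈ᴿ-refl x y) (+ʳ-mono h ≤ᴿ-refl))

⁺-nonneg : ∀ {x} → 0ʳ ≤ᴿ x → x ⊔ʳ 0ʳ ≈ᴿ x
⁺-nonneg {x} h = ≤ᴿ-antisym (⊔ʳ-lub ≤ᴿ-refl h) (x≤x⊔y x 0ʳ)

*ʳ-nonneg : ∀ {x y} → 0ʳ ≤ᴿ x → 0ʳ ≤ᴿ y → 0ʳ ≤ᴿ x *ʳ y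
*ʳ-nonneg {x} {y} h k = ≤ᴿ-respʳ (*ʳ-cong (⁺-nonneg h) (⁺-nonneg k)) (⁺*⁺-nonneg x y)

*ʳ-monoʳ : ∀ z {x y} → 0ʳ ≤ᴿ z → x ≤ᴿ y → z *ʳ x ≤ᴿ z *ʳ y
*ʳ-monoʳ z {x} {y} z≥0 h = 0≤y-x⇒x≤y (≤ᴿ-respʳ
  (solveʳ 3 (λ x y z → z :*ʳ (y :+ʳ :-ʳ x) :=ʳ z :*ʳ y :+ʳ :-ʳ (z :*ʳ x)) ≈ᴿ-refl x y z)
  (*ʳ-nonneg z≥0 (x≤y⇒0≤y-x h)))

*ʳ-mono : ∀ {x x' y y'} → 0ʳ ≤ᴿ x → 0ʳ ≤ᴿ y' → x ≤ᴿ x' → y ≤ᴿ y' → x *ʳ y ≤ᴿ x' *ʳ y'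
*ʳ-mono {x} {x'} {y} {y'} x≥0 y'≥0 h k = ≤ᴿ-trans (*ʳ-monoʳ x x≥0 k)
  (≤ᴿ-respˡ (*ʳ-comm y' x) (≤ᴿ-respʳ (*ʳ-comm y' x') (*ʳ-monoʳ y' y'≥0 h)))

+ʳ-nonneg : ∀ {x y} → 0ʳ ≤ᴿ x → 0ʳ ≤ᴿ y → 0ʳ ≤ᴿ x +ʳ y
+ʳ-nonneg h k = ≤ᴿ-respˡ (+ʳ-identityˡ 0ʳ) (+ʳ-mono h k)

⊔ʳ-cong : ∀ {x x' y y'} → x ≈ᴿ x' → y ≈ᴿ y' → x ⊔ʳ y ≈ᴿ x' ⊔ʳ y'
⊔ʳ-cong h k = ≤ᴿ-antisym (mono h k) (mono (≈ᴿ-sym h) (≈ᴿ-sym k))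
  where
  mono : ∀ {x x' y y'} → x ≈ᴿ x' → y ≈ᴿ y' → x ⊔ʳ y ≤ᴿ x' ⊔ʳ y'
  mono {x} {x'} {y} {y'} h k = ⊔ʳ-lub (≤ᴿ-trans (≈ᴿ⇒≤ᴿ h) (x≤x⊔y x' y')) (≤ᴿ-trans (≈ᴿ⇒≤ᴿ k) (y≤x⊔y x' y'))

√-square : ∀ {x} → 0ʳ ≤ᴿ x → √ʳ x *ʳ √ʳ x ≈ᴿ x
√-square {x} h = ≈ᴿ-trans (√-square⁺ x) (⁺-nonneg h)

-- Cauchy moduli decide approximate inequalities, so _≤ᴿ_ is ¬¬-stable and
-- classical reasoning is available below the relations _≤ᴿ_ and _≈ᴿ_.

positive≰0 : ∀ {ε} → 0ℚ <ᵠ ε → ¬ (ratʳ ε ≤ᴿ 0ʳ)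
positive≰0 {ε} ε>0 h = ℚ.<-irrefl {0ℚ} refl
  (ℚ.<-≤-trans {0ℚ} {ε} {0ℚ} ε>0 (ratʳ-cancel-≤ {ε} {0ℚ} (subst (ratʳ ε ≤ᴿ_) (sym ratʳ-0) h)))

≤0-stable : ∀ {x} → ¬ ¬ (x ≤ᴿ 0ʳ) → x ≤ᴿ 0ʳ
≤0-stable {x} h = ≤ᴿ-archimedean bound
  where
  bound : ∀ ε → 0ℚ <ᵠ ε → x ≤ᴿ ratʳ ε
  bound ε ε>0 = [ id , (λ q → ⊥-elim (h λ x≤0 → positive≰0 {ε *ᵠ ½} (half>0 {ε} ε>0) (≤ᴿ-trans q x≤0))) ]′
    (≤ᴿ-cotransitive x ε ε>0)

-- If no positive rational lies below x, cotransitivity has to return its first alternative for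
-- every ε, and then x ≤ 0.
≰0⇒bounded-below : ∀ {x} → ¬ (x ≤ᴿ 0ʳ) → ¬ ¬ (∃[ δ ] 0ℚ <ᵠ δ × ratʳ δ ≤ᴿ x)
≰0⇒bounded-below {x} h k = h (≤ᴿ-archimedean bound)
  where
  bound : ∀ ε → 0ℚ <ᵠ ε → x ≤ᴿ ratʳ ε
  bound ε ε>0 = [ id , (λ q → ⊥-elim (k (ε *ᵠ ½ , half>0 {ε} ε>0 , q))) ]′ (≤ᴿ-cotransitive x ε ε>0)

x≤y⇒x-y≤0 : ∀ {x y} → x ≤ᴿ y → x +ʳ -ʳ y ≤ᴿ 0ʳ
x≤y⇒x-y≤0 {x} {y} h = ≤ᴿ-respʳ (solveʳ 1 (λ y → y :+ʳ :-ʳ y :=ʳ conʳ (+ 0)) ≈ᴿ-refl y) (+ʳ-mono h ≤ᴿ-refl)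

x-y≤0⇒x≤y : ∀ {x y} → x +ʳ -ʳ y ≤ᴿ 0ʳ → x ≤ᴿ y
x-y≤0⇒x≤y {x} {y} h = ≤ᴿ-respˡ (solveʳ 2 (λ x y → x :+ʳ :-ʳ y :+ʳ y :=ʳ x) ≈ᴿ-refl x y)
  (≤ᴿ-respʳ (+ʳ-identityˡ y) (+ʳ-mono h ≤ᴿ-refl))

≤ᴿ-stable : ∀ {x y} → ¬ ¬ (x ≤ᴿ y) → x ≤ᴿ y
≤ᴿ-stable h = x-y≤0⇒x≤y (≤0-stable λ k → h λ x≤y → k (x≤y⇒x-y≤0 x≤y))

≈ᴿ-stable : ∀ {x y} → ¬ ¬ (x ≈ᴿ y) → x ≈ᴿ y
≈ᴿ-stable h = ≤ᴿ-antisym (≤ᴿ-stable λ k → h λ e → k (≈ᴿ⇒≤ᴿ e)) (≤ᴿ-stable λ k → h λ e → k (≈ᴿ⇒≤ᴿ (≈ᴿ-sym e)))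

≤ᴿ-total : ∀ x y → ¬ ¬ (x ≤ᴿ y ⊎ y ≤ᴿ x)
≤ᴿ-total x y k = k (inj₁ (≤ᴿ-stable λ x≰y → ≰0⇒bounded-below (λ h → x≰y (x-y≤0⇒x≤y h))
  λ (δ , δ>0 , δ≤x-y) → k (inj₂ (0≤y-x⇒x≤y (≤ᴿ-trans (ratʳ-nonneg {δ} (ℚ.<⇒≤ δ>0)) δ≤x-y)))))

ratʳ-cancelˡ : ∀ {p q} → p *ᵠ q ≡ 1ℚ → ∀ x → ratʳ p *ʳ (ratʳ q *ʳ x) ≈ᴿ x
ratʳ-cancelˡ {p} {q} pq≡1 x = ≈ᴿ-trans (≈ᴿ-sym (*ʳ-assoc (ratʳ p) (ratʳ q) x))
  (≈ᴿ-trans (*ʳ-congʳ x (≈ᴿ-trans (≈ᴿ-sym (ratʳ-* p q)) (≡⇒≈ᴿ (trans (cong ratʳ pq≡1) ratʳ-1))))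
    (*ʳ-identityˡ x))

*ʳ-cancel-pos : ∀ {δ x y} → 0ℚ <ᵠ δ → ratʳ δ *ʳ x ≤ᴿ ratʳ δ *ʳ y → x ≤ᴿ y
*ʳ-cancel-pos {δ} {x} {y} δ>0 h = cancel ((ℚ.1/ δ) {{ℚ.>-nonZero δ>0}}) (ℚ.*-inverseˡ δ {{ℚ.>-nonZero δ>0}})
    (ℚ.<⇒≤ (ℚ.positive⁻¹ ((ℚ.1/ δ) {{ℚ.>-nonZero δ>0}}) {{ℚ.1/pos⇒pos δ {{positive δ>0}}}}))
  where
  cancel : ∀ δ⁻¹ → δ⁻¹ *ᵠ δ ≡ 1ℚ → 0ℚ ≤ᵠ δ⁻¹ → x ≤ᴿ y
  cancel δ⁻¹ eq δ⁻¹≥0 = ≤ᴿ-respˡ (ratʳ-cancelˡ {δ⁻¹} {δ} eq x) (≤ᴿ-respʳ (ratʳ-cancelˡ {δ⁻¹} {δ} eq y)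
    (*ʳ-monoʳ (ratʳ δ⁻¹) (ratʳ-nonneg {δ⁻¹} δ⁻¹≥0) h))

-- A positive real comes without an inverse; it is replaced by a positive rational lower bound δ,
-- and δ y ≤ x y ≤ 0 is divided by δ.
*ʳ-≤0 : ∀ {x y} → 0ʳ ≤ᴿ y → x *ʳ y ≤ᴿ 0ʳ → ¬ (x ≤ᴿ 0ʳ) → y ≤ᴿ 0ʳ
*ʳ-≤0 {x} {y} y≥0 xy≤0 x≰0 = ≤0-stable {y} λ y≰0 → ≰0⇒bounded-below {x} x≰0 λ (δ , δ>0 , δ≤x) → y≰0 (bound δ δ>0 δ≤x)
  where
  zeroʳ : ∀ x → 0ʳ ≈ᴿ x *ʳ 0ʳ
  zeroʳ = solveʳ 1 (λ x → conʳ (+ 0) :=ʳ x :*ʳ conʳ (+ 0)) ≈ᴿ-refl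
  bound : ∀ δ → 0ℚ <ᵠ δ → ratʳ δ ≤ᴿ x → y ≤ᴿ 0ʳ
  bound δ δ>0 δ≤x = *ʳ-cancel-pos {δ} {y} {0ʳ} δ>0 (≤ᴿ-respʳ (zeroʳ (ratʳ δ)) (≤ᴿ-trans
    (*ʳ-mono {ratʳ δ} {x} {y} {y} (ratʳ-nonneg {δ} (ℚ.<⇒≤ {0ℚ} {δ} δ>0)) y≥0 δ≤x (≤ᴿ-refl {y})) xy≤0))

-- Powers and roots of non-negative reals

infixr 9 _^ʳ_

_^ʳ_ : ℝ → ℕ → ℝ
x ^ʳ zero  = 1ʳ
x ^ʳ suc n = x *ʳ x ^ʳ n

^ʳ-cong : ∀ {x y} n → x ≈ᴿ y → x ^ʳ n ≈ᴿ y ^ʳ n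
^ʳ-cong zero    h = ≈ᴿ-refl
^ʳ-cong (suc n) h = *ʳ-cong h (^ʳ-cong n h)

0≤1 : 0ʳ ≤ᴿ 1ʳ
0≤1 = subst (0ʳ ≤ᴿ_) ratʳ-1 (ratʳ-nonneg {1ℚ} (ℚ.<⇒≤ (ℚ.positive⁻¹ 1ℚ)))

^ʳ-nonneg : ∀ {x} n → 0ʳ ≤ᴿ x → 0ʳ ≤ᴿ x ^ʳ n
^ʳ-nonneg zero    h = 0≤1
^ʳ-nonneg (suc n) h = *ʳ-nonneg h (^ʳ-nonneg n h)

^ʳ-≤0 : ∀ {x} n → 0ʳ ≤ᴿ x → x ^ʳ n ≤ᴿ 0ʳ → x ≤ᴿ 0ʳ
^ʳ-≤0 zero    x≥0 h = ⊥-elim (positive≰0 {1ℚ} (ℚ.positive⁻¹ 1ℚ) (subst (_≤ᴿ 0ʳ) (sym ratʳ-1) h))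
^ʳ-≤0 (suc n) x≥0 h = ≤0-stable λ x≰0 → x≰0 (^ʳ-≤0 n x≥0 (*ʳ-≤0 (^ʳ-nonneg n x≥0) h x≰0))

-- Serves the injectivity of powers: writing y = x + t, the bound yⁿ ≤ xⁿ leaves tⁿ ≤ 0 and hence t
-- ≤ 0, with neither division nor a strict order.
^ʳ-superadditive : ∀ {x y} n → 0ʳ ≤ᴿ x → 0ʳ ≤ᴿ y → x ^ʳ suc n +ʳ y ^ʳ suc n ≤ᴿ (x +ʳ y) ^ʳ suc n
^ʳ-superadditive {x} {y} zero x≥0 y≥0 = ≈ᴿ⇒≤ᴿ
  (solveʳ 2 (λ x y → x :*ʳ conʳ (+ 1) :+ʳ y :*ʳ conʳ (+ 1) :=ʳ (x :+ʳ y) :*ʳ conʳ (+ 1)) ≈ᴿ-refl x y)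
^ʳ-superadditive {x} {y} (suc n) x≥0 y≥0 = ≤ᴿ-trans
  (≤ᴿ-respˡ (+ʳ-identityʳ' _) (≤ᴿ-respʳ
    (solveʳ 4 (λ x y a b → x :*ʳ a :+ʳ y :*ʳ b :+ʳ (x :*ʳ b :+ʳ y :*ʳ a) :=ʳ (x :+ʳ y) :*ʳ (a :+ʳ b)) ≈ᴿ-refl
      x y (x ^ʳ suc n) (y ^ʳ suc n))
    (+ʳ-mono ≤ᴿ-refl (+ʳ-nonneg (*ʳ-nonneg x≥0 (^ʳ-nonneg (suc n) y≥0)) (*ʳ-nonneg y≥0 (^ʳ-nonneg (suc n) x≥0))))))
  (*ʳ-monoʳ (x +ʳ y) (+ʳ-nonneg x≥0 y≥0) (^ʳ-superadditive n x≥0 y≥0))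
  where
  +ʳ-identityʳ' : ∀ x → x +ʳ 0ʳ ≈ᴿ x
  +ʳ-identityʳ' = solveʳ 1 (λ x → x :+ʳ conʳ (+ 0) :=ʳ x) ≈ᴿ-refl

^ʳ-cancel-≤ : ∀ {x y} n → 0ʳ ≤ᴿ x → x ≤ᴿ y → y ^ʳ suc n ≤ᴿ x ^ʳ suc n → y ≤ᴿ x
^ʳ-cancel-≤ {x} {y} n x≥0 x≤y h = x-y≤0⇒x≤y (^ʳ-≤0 (suc n) t≥0 (≤ᴿ-respˡ
    (solveʳ 2 (λ a b → a :+ʳ b :+ʳ :-ʳ a :=ʳ b) ≈ᴿ-refl (x ^ʳ suc n) (t ^ʳ suc n))
    (x≤y⇒x-y≤0 (≤ᴿ-trans (^ʳ-superadditive n x≥0 t≥0)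
      (≤ᴿ-respˡ (^ʳ-cong (suc n) (solveʳ 2 (λ x y → y :=ʳ x :+ʳ (y :+ʳ :-ʳ x)) ≈ᴿ-refl x y)) h)))))
  where
  t = y +ʳ -ʳ x
  t≥0 = x≤y⇒0≤y-x x≤y

^ʳ-injective : ∀ {x y} n → 0ʳ ≤ᴿ x → 0ʳ ≤ᴿ y → x ^ʳ suc n ≈ᴿ y ^ʳ suc n → x ≈ᴿ y
^ʳ-injective {x} {y} n x≥0 y≥0 h = ≈ᴿ-stable λ k → ≤ᴿ-total x y λ
  { (inj₁ x≤y) → k (≤ᴿ-antisym x≤y (^ʳ-cancel-≤ n x≥0 x≤y (≈ᴿ⇒≤ᴿ (≈ᴿ-sym h))))
  ; (inj₂ y≤x) → k (≤ᴿ-antisym (^ʳ-cancel-≤ n y≥0 y≤x (≈ᴿ⇒≤ᴿ h)) y≤x) }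

square-injective : ∀ {x y} → 0ʳ ≤ᴿ x → 0ʳ ≤ᴿ y → x *ʳ x ≈ᴿ y *ʳ y → x ≈ᴿ y
square-injective {x} {y} x≥0 y≥0 h = ^ʳ-injective 1 x≥0 y≥0
  (≈ᴿ-trans (e x) (≈ᴿ-trans h (≈ᴿ-sym (e y))))
  where
  e : ∀ x → x ^ʳ 2 ≈ᴿ x *ʳ x
  e = solveʳ 1 (λ x → x :*ʳ (x :*ʳ conʳ (+ 1)) :=ʳ x :*ʳ x) ≈ᴿ-refl

√-cong : ∀ {x y} → x ≈ᴿ y → √ʳ x ≈ᴿ √ʳ y
√-cong {x} {y} h = square-injective (√-nonneg x) (√-nonneg y)
  (≈ᴿ-trans (√-square⁺ x) (≈ᴿ-trans (⊔ʳ-cong h ≈ᴿ-refl) (≈ᴿ-sym (√-square⁺ y))))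

square-nonneg : ∀ x → 0ʳ ≤ᴿ x *ʳ x
square-nonneg x = ≤ᴿ-stable λ k → ≤ᴿ-total 0ʳ x λ
  { (inj₁ h) → k (*ʳ-nonneg h h)
  ; (inj₂ h) → k (≤ᴿ-respʳ (solveʳ 1 (λ x → (conʳ (+ 0) :+ʳ :-ʳ x) :*ʳ (conʳ (+ 0) :+ʳ :-ʳ x) :=ʳ x :*ʳ x) ≈ᴿ-refl x)
      (*ʳ-nonneg (x≤y⇒0≤y-x h) (x≤y⇒0≤y-x h))) }

square≤0 : ∀ {x} → x *ʳ x ≤ᴿ 0ʳ → x ≈ᴿ 0ʳ
square≤0 {x} h = ≈ᴿ-stable λ k → ≤ᴿ-total 0ʳ x λ
  { (inj₁ p) → k (≤ᴿ-antisym (root p h) p)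
  ; (inj₂ p) → k (≤ᴿ-antisym p (0≤y-x⇒x≤y (≤ᴿ-respʳ (solveʳ 1 (λ x → x :=ʳ x :+ʳ :-ʳ conʳ (+ 0)) ≈ᴿ-refl x)
      (x-y≤0⇒x≤y (root (x≤y⇒0≤y-x p) (≤ᴿ-respˡ (solveʳ 1 (λ x → x :*ʳ x :=ʳ (conʳ (+ 0) :+ʳ :-ʳ x) :*ʳ (conʳ (+ 0) :+ʳ :-ʳ x)) ≈ᴿ-refl x) h)))))) }
  where
  root : ∀ {x} → 0ʳ ≤ᴿ x → x *ʳ x ≤ᴿ 0ʳ → x ≤ᴿ 0ʳ
  root {x} p h = ^ʳ-≤0 2 p (≤ᴿ-respˡ (solveʳ 1 (λ x → x :*ʳ x :=ʳ x :*ʳ (x :*ʳ conʳ (+ 1))) ≈ᴿ-refl x) h)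

-- Complex numbers

≈-refl : ∀ {z} → z ≈ z
≈-refl = ≈ᴿ-refl ,≈ ≈ᴿ-refl

≈-sym : ∀ {z w} → z ≈ w → w ≈ z
≈-sym (h ,≈ k) = ≈ᴿ-sym h ,≈ ≈ᴿ-sym k

≈-trans : ∀ {z w v} → z ≈ w → w ≈ v → z ≈ v
≈-trans (h ,≈ k) (h' ,≈ k') = ≈ᴿ-trans h h' ,≈ ≈ᴿ-trans k k'

≡⇒≈ : ∀ {z w} → z ≡ w → z ≈ w
≡⇒≈ refl = ≈-refl

≈-stable : ∀ {z w} → ¬ ¬ (z ≈ w) → z ≈ w
≈-stable h = ≈ᴿ-stable (λ k → h λ e → k (re≈ e)) ,≈ ≈ᴿ-stable (λ k → h λ e → k (im≈ e))

infixl 6 _+ᶜ_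
infixl 7 _*ᶜ_
infix  8 -ᶜ_

opaque
  _+ᶜ_ _*ᶜ_ : ℂ → ℂ → ℂ
  z +ᶜ w = (re z +ʳ re w) +i (im z +ʳ im w)
  z *ᶜ w = (re z *ʳ re w +ʳ -ʳ (im z *ʳ im w)) +i (re z *ʳ im w +ʳ im z *ʳ re w)

  -ᶜ_ conj : ℂ → ℂ
  -ᶜ z = (-ʳ re z) +i (-ʳ im z)
  conj z = re z +i (-ʳ im z)

  realᶜ : ℝ → ℂ
  realᶜ x = x +i 0ʳ

  iᶜ : ℂ
  iᶜ = 0ʳ +i 1ʳ

  re-+ : ∀ z w → re (z +ᶜ w) ≡ re z +ʳ re w
  re-+ z w = refl

  re-conj : ∀ z → re (conj z) ≡ re z
  re-conj z = refl

  re-realᶜ : ∀ x → re (realᶜ x) ≡ x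
  re-realᶜ x = refl

  +ᶜ-cong : ∀ {x x' y y'} → x ≈ x' → y ≈ y' → x +ᶜ y ≈ x' +ᶜ y'
  +ᶜ-cong (a ,≈ b) (c ,≈ d) = +ʳ-cong a c ,≈ +ʳ-cong b d

  *ᶜ-cong : ∀ {x x' y y'} → x ≈ x' → y ≈ y' → x *ᶜ y ≈ x' *ᶜ y'
  *ᶜ-cong (a ,≈ b) (c ,≈ d) = +ʳ-cong (*ʳ-cong a c) (-ʳ-cong (*ʳ-cong b d)) ,≈ +ʳ-cong (*ʳ-cong a d) (*ʳ-cong b c)

  -ᶜ-cong : ∀ {x y} → x ≈ y → -ᶜ x ≈ -ᶜ y
  -ᶜ-cong (a ,≈ b) = -ʳ-cong a ,≈ -ʳ-cong b

  conj-cong : ∀ {x y} → x ≈ y → conj x ≈ conj y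
  conj-cong (a ,≈ b) = a ,≈ -ʳ-cong b

  realᶜ-cong : ∀ {x y} → x ≈ᴿ y → realᶜ x ≈ realᶜ y
  realᶜ-cong a = a ,≈ ≈ᴿ-refl

  realᶜ-injective : ∀ {x y} → realᶜ x ≈ realᶜ y → x ≈ᴿ y
  realᶜ-injective = re≈

  +ᶜ-assoc : ∀ x y z → (x +ᶜ y) +ᶜ z ≈ x +ᶜ (y +ᶜ z)
  +ᶜ-assoc x y z = +ʳ-assoc (re x) (re y) (re z) ,≈ +ʳ-assoc (im x) (im y) (im z)

  +ᶜ-comm : ∀ x y → x +ᶜ y ≈ y +ᶜ x
  +ᶜ-comm x y = +ʳ-comm (re x) (re y) ,≈ +ʳ-comm (im x) (im y)

  realᶜ-+ : ∀ x y → realᶜ (x +ʳ y) ≈ realᶜ x +ᶜ realᶜ y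
  realᶜ-+ x y = ≈ᴿ-refl ,≈ ≈ᴿ-sym (+ʳ-identityˡ 0ʳ)

  realᶜ-* : ∀ x y → realᶜ (x *ʳ y) ≈ realᶜ x *ᶜ realᶜ y
  realᶜ-* x y = solveʳ 2 (λ x y → x :*ʳ y :=ʳ x :*ʳ y :+ʳ :-ʳ (conʳ (+ 0) :*ʳ conʳ (+ 0))) ≈ᴿ-refl x y
            ,≈ solveʳ 2 (λ x y → conʳ (+ 0) :=ʳ x :*ʳ conʳ (+ 0) :+ʳ conʳ (+ 0) :*ʳ y) ≈ᴿ-refl x y

  realᶜ-neg : ∀ x → realᶜ (-ʳ x) ≈ -ᶜ realᶜ x
  realᶜ-neg x = ≈ᴿ-refl ,≈ solveʳ 0 (conʳ (+ 0) :=ʳ :-ʳ conʳ (+ 0)) ≈ᴿ-refl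

  +ᶜ-identityˡ : ∀ x → realᶜ 0ʳ +ᶜ x ≈ x
  +ᶜ-identityˡ x = +ʳ-identityˡ (re x) ,≈ +ʳ-identityˡ (im x)

  +ᶜ-inverseˡ : ∀ x → -ᶜ x +ᶜ x ≈ realᶜ 0ʳ
  +ᶜ-inverseˡ x = +ʳ-inverseˡ (re x) ,≈ +ʳ-inverseˡ (im x)

  *ᶜ-assoc : ∀ x y z → (x *ᶜ y) *ᶜ z ≈ x *ᶜ (y *ᶜ z)
  *ᶜ-assoc x y z =
       solveʳ 6 (λ a b c d e f → (a :*ʳ c :+ʳ :-ʳ (b :*ʳ d)) :*ʳ e :+ʳ :-ʳ ((a :*ʳ d :+ʳ b :*ʳ c) :*ʳ f)
                  :=ʳ a :*ʳ (c :*ʳ e :+ʳ :-ʳ (d :*ʳ f)) :+ʳ :-ʳ (b :*ʳ (c :*ʳ f :+ʳ d :*ʳ e))) ≈ᴿ-refl (re x) (im x) (re y) (im y) (re z) (im z)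
    ,≈ solveʳ 6 (λ a b c d e f → (a :*ʳ c :+ʳ :-ʳ (b :*ʳ d)) :*ʳ f :+ʳ (a :*ʳ d :+ʳ b :*ʳ c) :*ʳ e
                  :=ʳ a :*ʳ (c :*ʳ f :+ʳ d :*ʳ e) :+ʳ b :*ʳ (c :*ʳ e :+ʳ :-ʳ (d :*ʳ f))) ≈ᴿ-refl (re x) (im x) (re y) (im y) (re z) (im z)

  *ᶜ-comm : ∀ x y → x *ᶜ y ≈ y *ᶜ x
  *ᶜ-comm x y =
       solveʳ 4 (λ a b c d → a :*ʳ c :+ʳ :-ʳ (b :*ʳ d) :=ʳ c :*ʳ a :+ʳ :-ʳ (d :*ʳ b)) ≈ᴿ-refl (re x) (im x) (re y) (im y)
    ,≈ solveʳ 4 (λ a b c d → a :*ʳ d :+ʳ b :*ʳ c :=ʳ c :*ʳ b :+ʳ d :*ʳ a) ≈ᴿ-refl (re x) (im x) (re y) (im y)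

  *ᶜ-identityˡ : ∀ x → realᶜ 1ʳ *ᶜ x ≈ x
  *ᶜ-identityˡ x =
       solveʳ 2 (λ a b → conʳ (+ 1) :*ʳ a :+ʳ :-ʳ (conʳ (+ 0) :*ʳ b) :=ʳ a) ≈ᴿ-refl (re x) (im x)
    ,≈ solveʳ 2 (λ a b → conʳ (+ 1) :*ʳ b :+ʳ conʳ (+ 0) :*ʳ a :=ʳ b) ≈ᴿ-refl (re x) (im x)

  *ᶜ-distribʳ : ∀ x y z → (y +ᶜ z) *ᶜ x ≈ y *ᶜ x +ᶜ z *ᶜ x
  *ᶜ-distribʳ x y z =
       solveʳ 6 (λ a b c d e f → (c :+ʳ e) :*ʳ a :+ʳ :-ʳ ((d :+ʳ f) :*ʳ b) :=ʳ (c :*ʳ a :+ʳ :-ʳ (d :*ʳ b)) :+ʳ (e :*ʳ a :+ʳ :-ʳ (f :*ʳ b)))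
         ≈ᴿ-refl (re x) (im x) (re y) (im y) (re z) (im z)
    ,≈ solveʳ 6 (λ a b c d e f → (c :+ʳ e) :*ʳ b :+ʳ (d :+ʳ f) :*ʳ a :=ʳ (c :*ʳ b :+ʳ d :*ʳ a) :+ʳ (e :*ʳ b :+ʳ f :*ʳ a))
         ≈ᴿ-refl (re x) (im x) (re y) (im y) (re z) (im z)

  conj-+ : ∀ x y → conj (x +ᶜ y) ≈ conj x +ᶜ conj y
  conj-+ x y = ≈ᴿ-refl ,≈ solveʳ 2 (λ b d → :-ʳ (b :+ʳ d) :=ʳ :-ʳ b :+ʳ :-ʳ d) ≈ᴿ-refl (im x) (im y)

  conj-* : ∀ x y → conj (x *ᶜ y) ≈ conj x *ᶜ conj y
  conj-* x y =
       solveʳ 4 (λ a b c d → a :*ʳ c :+ʳ :-ʳ (b :*ʳ d) :=ʳ a :*ʳ c :+ʳ :-ʳ ((:-ʳ b) :*ʳ (:-ʳ d))) ≈ᴿ-refl (re x) (im x) (re y) (im y)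
    ,≈ solveʳ 4 (λ a b c d → :-ʳ (a :*ʳ d :+ʳ b :*ʳ c) :=ʳ a :*ʳ (:-ʳ d) :+ʳ (:-ʳ b) :*ʳ c) ≈ᴿ-refl (re x) (im x) (re y) (im y)

  conj-realᶜ : ∀ x → conj (realᶜ x) ≈ realᶜ x
  conj-realᶜ x = ≈ᴿ-refl ,≈ solveʳ 0 (:-ʳ conʳ (+ 0) :=ʳ conʳ (+ 0)) ≈ᴿ-refl

normSq : ℂ → ℝ
normSq z = re z *ʳ re z +ʳ im z *ʳ im z

opaque
  unfolding _+ᶜ_

  *ᶜ-conj : ∀ z → z *ᶜ conj z ≈ realᶜ (normSq z)
  *ᶜ-conj z =
       solveʳ 2 (λ a b → a :*ʳ a :+ʳ :-ʳ (b :*ʳ (:-ʳ b)) :=ʳ a :*ʳ a :+ʳ b :*ʳ b) ≈ᴿ-refl (re z) (im z)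
    ,≈ solveʳ 2 (λ a b → a :*ʳ (:-ʳ b) :+ʳ b :*ʳ a :=ʳ conʳ (+ 0)) ≈ᴿ-refl (re z) (im z)

  normSq-* : ∀ z w → normSq (z *ᶜ w) ≈ᴿ normSq z *ʳ normSq w
  normSq-* z w = solveʳ 4 (λ a b c d →
      (a :*ʳ c :+ʳ :-ʳ (b :*ʳ d)) :*ʳ (a :*ʳ c :+ʳ :-ʳ (b :*ʳ d)) :+ʳ (a :*ʳ d :+ʳ b :*ʳ c) :*ʳ (a :*ʳ d :+ʳ b :*ʳ c)
      :=ʳ (a :*ʳ a :+ʳ b :*ʳ b) :*ʳ (c :*ʳ c :+ʳ d :*ʳ d)) ≈ᴿ-refl (re z) (im z) (re w) (im w)

  normSq-realᶜ : ∀ x → normSq (realᶜ x) ≈ᴿ x *ʳ x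
  normSq-realᶜ x = solveʳ 1 (λ x → x :*ʳ x :+ʳ conʳ (+ 0) :*ʳ conʳ (+ 0) :=ʳ x :*ʳ x) ≈ᴿ-refl x

  normSq-conj : ∀ z → normSq (conj z) ≈ᴿ normSq z
  normSq-conj z = solveʳ 2 (λ a b → a :*ʳ a :+ʳ (:-ʳ b) :*ʳ (:-ʳ b) :=ʳ a :*ʳ a :+ʳ b :*ʳ b) ≈ᴿ-refl (re z) (im z)

  normSq≤0 : ∀ {z} → normSq z ≤ᴿ 0ʳ → z ≈ realᶜ 0ʳ
  normSq≤0 {z} h = square≤0 (≤ᴿ-trans (≤ᴿ-respˡ (solveʳ 1 (λ a → a :+ʳ conʳ (+ 0) :=ʳ a) ≈ᴿ-refl (re z *ʳ re z))
                      (+ʳ-mono ≤ᴿ-refl (square-nonneg (im z)))) h)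
                ,≈ square≤0 (≤ᴿ-trans (≤ᴿ-respˡ (+ʳ-identityˡ (im z *ʳ im z))
                      (+ʳ-mono (square-nonneg (re z)) ≤ᴿ-refl)) h)

ℂ-setoid : Setoid 0ℓ 0ℓ
ℂ-setoid = record { _≈_ = _≈_ ; isEquivalence = record { refl = ≈-refl ; sym = ≈-sym ; trans = ≈-trans } }

ℂ-commutativeRing : CommutativeRing 0ℓ 0ℓ
ℂ-commutativeRing = record
  { Carrier = ℂ ; _≈_ = _≈_ ; _+_ = _+ᶜ_ ; _*_ = _*ᶜ_ ; -_ = -ᶜ_ ; 0# = realᶜ 0ʳ ; 1# = realᶜ 1ʳ
  ; isCommutativeRing = record
    { isRing = record
      { +-isAbelianGroup = record
        { isGroup = record
          { isMonoid = record
            { isSemigroup = record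
              { isMagma = record
                { isEquivalence = Setoid.isEquivalence ℂ-setoid
                ; ∙-cong = +ᶜ-cong }
              ; assoc = +ᶜ-assoc }
            ; identity = comm∧idˡ⇒id +ᶜ-comm +ᶜ-identityˡ }
          ; inverse = comm∧invˡ⇒inv +ᶜ-comm +ᶜ-inverseˡ
          ; ⁻¹-cong = -ᶜ-cong }
        ; comm = +ᶜ-comm }
      ; *-cong = *ᶜ-cong
      ; *-assoc = *ᶜ-assoc
      ; *-identity = comm∧idˡ⇒id *ᶜ-comm *ᶜ-identityˡ
      ; distrib = comm∧distrʳ⇒distr +ᶜ-cong *ᶜ-comm *ᶜ-distribʳ }
    ; *-comm = *ᶜ-comm } }
  where
  open import Algebra.Consequences.Setoid ℂ-setoid

intᶜ : ℤ → ℂ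
intᶜ n = realᶜ (intʳ n)

ratᶜ : ℚ → ℂ
ratᶜ q = realᶜ (ratʳ q)

0ᶜ 1ᶜ : ℂ
0ᶜ = intᶜ (+ 0)
1ᶜ = intᶜ (+ 1)

intᶜ-+ : ∀ m n → intᶜ (m ℤ.+ n) ≈ intᶜ m +ᶜ intᶜ n
intᶜ-+ m n = ≈-trans (realᶜ-cong (intʳ-+ m n)) (realᶜ-+ (intʳ m) (intʳ n))

intᶜ-* : ∀ m n → intᶜ (m ℤ.* n) ≈ intᶜ m *ᶜ intᶜ n
intᶜ-* m n = ≈-trans (realᶜ-cong (intʳ-* m n)) (realᶜ-* (intʳ m) (intʳ n))

intᶜ-neg : ∀ m → intᶜ (ℤ.- m) ≈ -ᶜ intᶜ m
intᶜ-neg m = ≈-trans (realᶜ-cong (intʳ-neg m)) (realᶜ-neg (intʳ m))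

private
  ℂ-morphism : ℤ.+-*-rawRing -Raw-AlmostCommutative⟶ fromCommutativeRing ℂ-commutativeRing
  ℂ-morphism = record { ⟦_⟧ = intᶜ ; +-homo = intᶜ-+ ; *-homo = intᶜ-* ; -‿homo = intᶜ-neg ; 0-homo = ≈-refl ; 1-homo = ≈-refl }

  intᶜ-≟ : ∀ m n → Maybe (intᶜ m ≈ intᶜ n)
  intᶜ-≟ m n = Maybe.map (≡⇒≈ ∘ cong intᶜ) (dec⇒maybe (m ℤ.≟ n))

module ℂ-Solver = Algebra.Solver.Ring ℤ.+-*-rawRing (fromCommutativeRing ℂ-commutativeRing) ℂ-morphism intᶜ-≟
open ℂ-Solver using () renaming (solve to solveᶜ; _:=_ to _:=ᶜ_; _:+_ to _:+ᶜ_; _:*_ to _:*ᶜ_; :-_ to :-ᶜ_; con to conᶜ)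

-- Passage from the operations of the statement to the sealed ones

opaque
  unfolding _+ʳ_

  fromℚ≡ratʳ : ∀ q → fromℚ q ≡ ratʳ q
  fromℚ≡ratʳ q = refl

  *ᴿ≡*ʳ : ∀ x y → x *ᴿ y ≡ x *ʳ y
  *ᴿ≡*ʳ x y = refl

  +ᴿ≡+ʳ : ∀ x y → x +ᴿ y ≡ x +ʳ y
  +ᴿ≡+ʳ x y = refl

  -ᴿ≡-ʳ : ∀ x → -ᴿ x ≡ -ʳ x
  -ᴿ≡-ʳ x = refl

  ⊔ᴿ≡⊔ʳ : ∀ x y → x ⊔ᴿ y ≡ x ⊔ʳ y
  ⊔ᴿ≡⊔ʳ x y = refl

  √ᴿ≡√ʳ : ∀ x → √ᴿ x ≡ √ʳ x
  √ᴿ≡√ʳ x = refl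

private
  +*≡+* : ∀ a b c d → a *ᴿ b +ᴿ c *ᴿ d ≡ a *ʳ b +ʳ c *ʳ d
  +*≡+* a b c d = trans (+ᴿ≡+ʳ (a *ᴿ b) (c *ᴿ d)) (cong₂ _+ʳ_ (*ᴿ≡*ʳ a b) (*ᴿ≡*ʳ c d))

  -*≡-* : ∀ a b c d → a *ᴿ b +ᴿ (-ᴿ (c *ᴿ d)) ≡ a *ʳ b +ʳ -ʳ (c *ʳ d)
  -*≡-* a b c d = trans (+ᴿ≡+ʳ (a *ᴿ b) (-ᴿ (c *ᴿ d)))
    (cong₂ _+ʳ_ (*ᴿ≡*ʳ a b) (trans (-ᴿ≡-ʳ (c *ᴿ d)) (cong -ʳ_ (*ᴿ≡*ʳ c d))))

opaque
  unfolding _+ᶜ_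

  +≡+ᶜ : ∀ z w → z Defs.+ w ≡ z +ᶜ w
  +≡+ᶜ (a +i b) (c +i d) = cong₂ _+i_ (+ᴿ≡+ʳ a c) (+ᴿ≡+ʳ b d)

  *≡*ᶜ : ∀ z w → z Defs.* w ≡ z *ᶜ w
  *≡*ᶜ (a +i b) (c +i d) = cong₂ _+i_ (-*≡-* a c b d) (+*≡+* a d b c)

  -≡-ᶜ : ∀ z → Defs.- z ≡ -ᶜ z
  -≡-ᶜ (a +i b) = cong₂ _+i_ (-ᴿ≡-ʳ a) (-ᴿ≡-ʳ b)

  ratℂ≡ratᶜ : ∀ q → ratℂ q ≡ ratᶜ q
  ratℂ≡ratᶜ q = cong₂ _+i_ (fromℚ≡ratʳ q) (trans (fromℚ≡ratʳ 0ℚ) ratʳ-0)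

  i≡iᶜ : i ≡ iᶜ
  i≡iᶜ = cong₂ _+i_ (trans (fromℚ≡ratʳ 0ℚ) ratʳ-0) (trans (fromℚ≡ratʳ 1ℚ) ratʳ-1)

intℂ≡intᶜ : ∀ n → intℂ n ≡ intᶜ n
intℂ≡intᶜ n = trans (ratℂ≡ratᶜ (intᵠ n)) (cong realᶜ (sym (intʳ≡ratʳ n)))

1ℂ≡1ᶜ : 1ℂ ≡ 1ᶜ
1ℂ≡1ᶜ = intℂ≡intᶜ (+ 1)

0ℂ≡0ᶜ : 0ℂ ≡ 0ᶜ
0ℂ≡0ᶜ = intℂ≡intᶜ (+ 0)

-- Absolute values and cancellation

modulus : ℂ → ℝ
modulus z = √ʳ normSq z

∣∣≡modulus : ∀ z → ∣ z ∣ ≡ modulus z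
∣∣≡modulus (a +i b) = trans (√ᴿ≡√ʳ (a *ᴿ a +ᴿ b *ᴿ b)) (cong √ʳ_ (+*≡+* a a b b))

normSq-cong : ∀ {z w} → z ≈ w → normSq z ≈ᴿ normSq w
normSq-cong (a ,≈ b) = +ʳ-cong (*ʳ-cong a a) (*ʳ-cong b b)

normSq-nonneg : ∀ z → 0ʳ ≤ᴿ normSq z
normSq-nonneg z = +ʳ-nonneg (square-nonneg (re z)) (square-nonneg (im z))

modulus-cong : ∀ {z w} → z ≈ w → modulus z ≈ᴿ modulus w
modulus-cong h = √-cong (normSq-cong h)

modulus-nonneg : ∀ z → 0ʳ ≤ᴿ modulus z
modulus-nonneg z = √-nonneg (normSq z)

modulus-square : ∀ z → modulus z *ʳ modulus z ≈ᴿ normSq z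
modulus-square z = √-square (normSq-nonneg z)

modulus-unique : ∀ {z x} → 0ʳ ≤ᴿ x → normSq z ≈ᴿ x *ʳ x → modulus z ≈ᴿ x
modulus-unique {z} x≥0 h = square-injective (modulus-nonneg z) x≥0 (≈ᴿ-trans (modulus-square z) h)

modulus-* : ∀ z w → modulus (z *ᶜ w) ≈ᴿ modulus z *ʳ modulus w
modulus-* z w = modulus-unique (*ʳ-nonneg (modulus-nonneg z) (modulus-nonneg w))
  (≈ᴿ-trans (normSq-* z w) (≈ᴿ-trans (*ʳ-cong (≈ᴿ-sym (modulus-square z)) (≈ᴿ-sym (modulus-square w)))
    (solveʳ 2 (λ a b → a :*ʳ a :*ʳ (b :*ʳ b) :=ʳ a :*ʳ b :*ʳ (a :*ʳ b)) ≈ᴿ-refl (modulus z) (modulus w))))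

intʳ-mono : ∀ {m n} → m ℤ.≤ n → intʳ m ≤ᴿ intʳ n
intʳ-mono {m} {n} h = subst₂ _≤ᴿ_ (sym (intʳ≡ratʳ m)) (sym (intʳ≡ratʳ n)) (ratʳ-mono (intᵠ-mono h))

intʳ-cancel-≤ : ∀ {m n} → intʳ m ≤ᴿ intʳ n → m ℤ.≤ n
intʳ-cancel-≤ {m} {n} h = intᵠ-cancel (ratʳ-cancel-≤ (subst₂ _≤ᴿ_ (intʳ≡ratʳ m) (intʳ≡ratʳ n) h))

intʳ-injective : ∀ {m n} → intʳ m ≈ᴿ intʳ n → m ≡ n
intʳ-injective h = ℤ.≤-antisym (intʳ-cancel-≤ (≈ᴿ⇒≤ᴿ h)) (intʳ-cancel-≤ (≈ᴿ⇒≤ᴿ (≈ᴿ-sym h)))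

intᶜ-injective : ∀ {m n} → intᶜ m ≈ intᶜ n → m ≡ n
intᶜ-injective h = intʳ-injective (realᶜ-injective h)

natʳ : ℕ → ℝ
natʳ n = intʳ (+ n)

natʳ-nonneg : ∀ n → 0ʳ ≤ᴿ natʳ n
natʳ-nonneg n = intʳ-mono (ℤ.+≤+ ℕ.z≤n)

∣∣*∣∣ : ∀ n → + ℤ.∣ n ∣ ℤ.* + ℤ.∣ n ∣ ≡ n ℤ.* n
∣∣*∣∣ (+ n)        = refl
∣∣*∣∣ -[1+ n ] = refl

modulus-intᶜ : ∀ n → modulus (intᶜ n) ≈ᴿ natʳ ℤ.∣ n ∣
modulus-intᶜ n = modulus-unique (natʳ-nonneg ℤ.∣ n ∣) (≈ᴿ-trans (normSq-realᶜ (intʳ n))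
  (≈ᴿ-trans (≈ᴿ-sym (intʳ-* n n)) (≈ᴿ-trans (≡⇒≈ᴿ (cong intʳ (sym (∣∣*∣∣ n)))) (intʳ-* (+ ℤ.∣ n ∣) (+ ℤ.∣ n ∣)))))

modulus-conj : ∀ z → modulus (conj z) ≈ᴿ modulus z
modulus-conj z = √-cong (normSq-conj z)

-- By multiplicativity of |z|². The double negation stays because no finite amount of information
-- tells which factor vanishes.
*ᶜ-domain : ∀ {z w} → z *ᶜ w ≈ 0ᶜ → ¬ ¬ (z ≈ 0ᶜ ⊎ w ≈ 0ᶜ)
*ᶜ-domain {z} {w} h k = k (inj₂ (normSq≤0 (*ʳ-≤0 (normSq-nonneg w) zw≤0 λ z≤0 → k (inj₁ (normSq≤0 z≤0)))))
  where
  zw≤0 : normSq z *ʳ normSq w ≤ᴿ 0ʳ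
  zw≤0 = ≈ᴿ⇒≤ᴿ (≈ᴿ-trans (≈ᴿ-sym (normSq-* z w)) (≈ᴿ-trans (normSq-cong h) (≈ᴿ-trans (normSq-realᶜ 0ʳ)
    (solveʳ 0 (conʳ (+ 0) :*ʳ conʳ (+ 0) :=ʳ conʳ (+ 0)) ≈ᴿ-refl))))

infixr 9 _^ᶜ_

_^ᶜ_ : ℂ → ℕ → ℂ
z ^ᶜ zero  = 1ᶜ
z ^ᶜ suc n = z *ᶜ z ^ᶜ n

^≡^ᶜ : ∀ z n → z Defs.^ n ≡ z ^ᶜ n
^≡^ᶜ z zero    = 1ℂ≡1ᶜ
^≡^ᶜ z (suc n) = trans (*≡*ᶜ z (z Defs.^ n)) (cong (z *ᶜ_) (^≡^ᶜ z n))

^ᶜ-cong : ∀ {z w} n → z ≈ w → z ^ᶜ n ≈ w ^ᶜ n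
^ᶜ-cong zero    h = ≈-refl
^ᶜ-cong (suc n) h = *ᶜ-cong h (^ᶜ-cong n h)

modulus-1 : modulus 1ᶜ ≈ᴿ 1ʳ
modulus-1 = modulus-intᶜ (+ 1)

modulus-^ : ∀ z n → modulus (z ^ᶜ n) ≈ᴿ modulus z ^ʳ n
modulus-^ z zero    = modulus-1
modulus-^ z (suc n) = ≈ᴿ-trans (modulus-* z (z ^ᶜ n)) (*ʳ-cong ≈ᴿ-refl (modulus-^ z n))

-- Integer polynomials

^ᶻ-≢0 : ∀ {x} n → x ≢ + 0 → x ^ᶻ n ≢ + 0
^ᶻ-≢0 zero    x≢0 ()
^ᶻ-≢0 {x} (suc n) x≢0 e = [ x≢0 , ^ᶻ-≢0 n x≢0 ]′ (ℤ.i*j≡0⇒i≡0∨j≡0 x e)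

∣∣-^ : ∀ x n → ℤ.∣ x ^ᶻ n ∣ ≡ ℤ.∣ x ∣ ℕ.^ n
∣∣-^ x zero    = refl
∣∣-^ x (suc n) = trans (ℤ.abs-* x (x ^ᶻ n)) (cong (ℤ.∣ x ∣ ℕ.*_) (∣∣-^ x n))

-- A polynomial over ℤ is its sequence of coefficients, together with a bound
-- on the indices of the non-zero ones where one is needed.

Bounded : ℕ → (ℕ → ℤ) → Set
Bounded n f = ∀ i → n ℕ.≤ i → f i ≡ + 0

-- The Cauchy product, with the constant coefficient of the left factor split off: inductions run
-- along the shift `f ∘ suc`.
conv : (ℕ → ℤ) → (ℕ → ℤ) → ℕ → ℤ
conv f g zero    = f 0 *ᶻ g 0
conv f g (suc k) = f 0 *ᶻ g (suc k) +ᶻ conv (f ∘ suc) g k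

Bounded-suc : ∀ {n f} → Bounded (suc n) f → Bounded n (f ∘ suc)
Bounded-suc b i n≤i = b (suc i) (s≤s n≤i)

Bounded-weaken : ∀ {m n f} → m ℕ.≤ n → Bounded m f → Bounded n f
Bounded-weaken m≤n b i n≤i = b i (ℕ.≤-trans m≤n n≤i)

conv-cong : ∀ {f f' g g'} → f ≗ f' → g ≗ g' → conv f g ≗ conv f' g'
conv-cong p q zero    = cong₂ _*ᶻ_ (p 0) (q 0)
conv-cong p q (suc k) = cong₂ _+ᶻ_ (cong₂ _*ᶻ_ (p 0) (q (suc k))) (conv-cong (p ∘ suc) q k)

-- The mirror image of the defining recursion, for inductions that shorten the right factor.
conv-consʳ : ∀ f g k → conv f g (suc k) ≡ f (suc k) *ᶻ g 0 +ᶻ conv f (g ∘ suc) k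
conv-consʳ f g zero    = ℤ.+-comm (f 0 *ᶻ g 1) (f 1 *ᶻ g 0)
conv-consʳ f g (suc k) = trans (cong (f 0 *ᶻ g (suc (suc k)) +ᶻ_) (conv-consʳ (f ∘ suc) g k))
  (solveᶻ 3 (λ a b c → a :+ᶻ (b :+ᶻ c) :=ᶻ b :+ᶻ (a :+ᶻ c)) refl
    (f 0 *ᶻ g (suc (suc k))) (f (suc (suc k)) *ᶻ g 0) (conv (f ∘ suc) (g ∘ suc) k))

conv-scaleˡ : ∀ m f g k → conv (λ i → m *ᶻ f i) g k ≡ m *ᶻ conv f g k
conv-scaleˡ m f g zero    = ℤ.*-assoc m (f 0) (g 0)
conv-scaleˡ m f g (suc k) = trans (cong (m *ᶻ f 0 *ᶻ g (suc k) +ᶻ_) (conv-scaleˡ m (f ∘ suc) g k))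
  (solveᶻ 4 (λ m a b c → m :*ᶻ a :*ᶻ b :+ᶻ m :*ᶻ c :=ᶻ m :*ᶻ (a :*ᶻ b :+ᶻ c)) refl m (f 0) (g (suc k)) (conv (f ∘ suc) g k))

conv-scaleʳ : ∀ m f g k → conv f (λ i → m *ᶻ g i) k ≡ m *ᶻ conv f g k
conv-scaleʳ m f g zero    = solveᶻ 3 (λ m a b → a :*ᶻ (m :*ᶻ b) :=ᶻ m :*ᶻ (a :*ᶻ b)) refl m (f 0) (g 0)
conv-scaleʳ m f g (suc k) = trans (cong (f 0 *ᶻ (m *ᶻ g (suc k)) +ᶻ_) (conv-scaleʳ m (f ∘ suc) g k))
  (solveᶻ 4 (λ m a b c → a :*ᶻ (m :*ᶻ b) :+ᶻ m :*ᶻ c :=ᶻ m :*ᶻ (a :*ᶻ b :+ᶻ c)) refl m (f 0) (g (suc k)) (conv (f ∘ suc) g k))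

conv-zeroˡ : ∀ {f} g → (∀ i → f i ≡ + 0) → ∀ k → conv f g k ≡ + 0
conv-zeroˡ g z k = trans (conv-cong {g = g} z (λ _ → refl) k) (conv-scaleˡ (+ 0) (λ _ → + 0) g k)

conv-∣ˡ : ∀ {m f} g → (∀ i → m ∣ᶻ f i) → ∀ k → m ∣ᶻ conv f g k
conv-∣ˡ g h zero    = ℤ.∣m⇒∣m*n (g 0) (h 0)
conv-∣ˡ g h (suc k) = ℤ.∣m∣n⇒∣m+n (ℤ.∣m⇒∣m*n (g (suc k)) (h 0)) (conv-∣ˡ g (h ∘ suc) k)

conv-leading : ∀ d e {f g} → Bounded (suc d) f → Bounded (suc e) g → conv f g (d ℕ.+ e) ≡ f d *ᶻ g e
conv-leading zero zero bf bg = refl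
conv-leading zero (suc e) {f} {g} bf bg = trans
  (cong (f 0 *ᶻ g (suc e) +ᶻ_) (conv-zeroˡ g (λ i → bf (suc i) (s≤s z≤n)) e)) (ℤ.+-identityʳ _)
conv-leading (suc d) e {f} {g} bf bg = trans
  (cong₂ _+ᶻ_ (trans (cong (f 0 *ᶻ_) (bg _ (s≤s (ℕ.m≤n+m e d)))) (ℤ.*-zeroʳ (f 0)))
    (conv-leading d e (Bounded-suc bf) bg))
  (ℤ.+-identityˡ _)

-- The coefficients of f(x X) and of y^d f(X / y).

conv-weight : ∀ x f g k → conv (λ i → f i *ᶻ x ^ᶻ i) (λ i → g i *ᶻ x ^ᶻ i) k ≡ conv f g k *ᶻ x ^ᶻ k
conv-weight x f g zero = solveᶻ 2 (λ a b → (a :*ᶻ conᶻ (+ 1)) :*ᶻ (b :*ᶻ conᶻ (+ 1)) :=ᶻ a :*ᶻ b :*ᶻ conᶻ (+ 1)) refl (f 0) (g 0)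
conv-weight x f g (suc k) = begin
  f 0 *ᶻ + 1 *ᶻ (g (suc k) *ᶻ (x *ᶻ x ^ᶻ k)) +ᶻ conv (λ i → f (suc i) *ᶻ (x *ᶻ x ^ᶻ i)) ĝ k
    ≡⟨ cong (f 0 *ᶻ + 1 *ᶻ (g (suc k) *ᶻ (x *ᶻ x ^ᶻ k)) +ᶻ_)
        (trans (conv-cong {g = ĝ} (λ i → solveᶻ 3 (λ a x y → a :*ᶻ (x :*ᶻ y) :=ᶻ x :*ᶻ (a :*ᶻ y)) refl (f (suc i)) x (x ^ᶻ i)) (λ _ → refl) k)
          (trans (conv-scaleˡ x (λ i → f (suc i) *ᶻ x ^ᶻ i) ĝ k) (cong (x *ᶻ_) (conv-weight x (f ∘ suc) g k)))) ⟩
  f 0 *ᶻ + 1 *ᶻ (g (suc k) *ᶻ (x *ᶻ x ^ᶻ k)) +ᶻ x *ᶻ (conv (f ∘ suc) g k *ᶻ x ^ᶻ k)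
    ≡⟨ solveᶻ 5 (λ a b c x y → a :*ᶻ conᶻ (+ 1) :*ᶻ (b :*ᶻ (x :*ᶻ y)) :+ᶻ x :*ᶻ (c :*ᶻ y) :=ᶻ (a :*ᶻ b :+ᶻ c) :*ᶻ (x :*ᶻ y)) refl
         (f 0) (g (suc k)) (conv (f ∘ suc) g k) x (x ^ᶻ k) ⟩
  (f 0 *ᶻ g (suc k) +ᶻ conv (f ∘ suc) g k) *ᶻ (x *ᶻ x ^ᶻ k) ∎
  where
  open ≡-Reasoning
  ĝ = λ i → g i *ᶻ x ^ᶻ i

conv-coweight : ∀ y d e {f g} → Bounded (suc d) f → Bounded (suc e) g → ∀ k →
  conv (λ i → f i *ᶻ y ^ᶻ (d ℕ.∸ i)) (λ i → g i *ᶻ y ^ᶻ (e ℕ.∸ i)) k ≡ conv f g k *ᶻ y ^ᶻ (d ℕ.+ e ℕ.∸ k)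
conv-coweight y d e {f} {g} bf bg zero = trans
  (solveᶻ 4 (λ a b u v → a :*ᶻ u :*ᶻ (b :*ᶻ v) :=ᶻ a :*ᶻ b :*ᶻ (u :*ᶻ v)) refl (f 0) (g 0) (y ^ᶻ d) (y ^ᶻ e))
  (cong (f 0 *ᶻ g 0 *ᶻ_) (sym (ℤ.^-distribˡ-+-* y d e)))
conv-coweight y d e {f} {g} bf bg (suc k) = trans
  (cong₂ _+ᶻ_ (trans (solveᶻ 4 (λ a b u v → a :*ᶻ u :*ᶻ (b :*ᶻ v) :=ᶻ a :*ᶻ (u :*ᶻ (b :*ᶻ v))) refl (f 0) (g (suc k)) (y ^ᶻ d) (y ^ᶻ (e ℕ.∸ suc k)))
                (trans (cong (f 0 *ᶻ_) (head (suc k ℕ.≤? e))) (sym (ℤ.*-assoc (f 0) _ _))))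
              (tail d bf))
  (sym (ℤ.*-distribʳ-+ (y ^ᶻ (d ℕ.+ e ℕ.∸ suc k)) (f 0 *ᶻ g (suc k)) (conv (f ∘ suc) g k)))
  where
  head : Dec (suc k ℕ.≤ e) → y ^ᶻ d *ᶻ (g (suc k) *ᶻ y ^ᶻ (e ℕ.∸ suc k)) ≡ g (suc k) *ᶻ y ^ᶻ (d ℕ.+ e ℕ.∸ suc k)
  head (yes k<e) = trans
    (solveᶻ 3 (λ a u v → u :*ᶻ (a :*ᶻ v) :=ᶻ a :*ᶻ (u :*ᶻ v)) refl (g (suc k)) (y ^ᶻ d) (y ^ᶻ (e ℕ.∸ suc k)))
    (cong (g (suc k) *ᶻ_) (trans (sym (ℤ.^-distribˡ-+-* y d (e ℕ.∸ suc k))) (cong (y ^ᶻ_) (sym (ℕ.+-∸-assoc d k<e)))))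
  -- Beyond the degree of `g` truncated subtraction spoils the exponents, but there the coefficient
  -- is 0.
  head (no k≮e) rewrite bg (suc k) (ℕ.≰⇒> k≮e) = ℤ.*-zeroʳ (y ^ᶻ d)
  tail : ∀ d {f} → Bounded (suc d) f →
    conv (λ i → f (suc i) *ᶻ y ^ᶻ (d ℕ.∸ suc i)) (λ i → g i *ᶻ y ^ᶻ (e ℕ.∸ i)) k ≡ conv (f ∘ suc) g k *ᶻ y ^ᶻ (d ℕ.+ e ℕ.∸ suc k)
  tail zero {f} bf = trans (conv-zeroˡ _ (λ i → trans (cong (_*ᶻ + 1) (f≡0 i)) refl) k)
    (sym (trans (cong (_*ᶻ y ^ᶻ (e ℕ.∸ suc k)) (conv-zeroˡ g f≡0 k)) refl))
    where
    f≡0 : ∀ i → f (suc i) ≡ + 0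
    f≡0 i = bf (suc i) (s≤s z≤n)
  tail (suc d) bf = conv-coweight y d e (Bounded-suc bf) bg k

-- Gauss's lemma and contents

euclidᶻ : ∀ {p} → Prime p → ∀ x y → + p ∣ᶻ x *ᶻ y → (+ p ∣ᶻ x) ⊎ (+ p ∣ᶻ y)
euclidᶻ {p} pr x y h = Sum.map ℤ.∣ᵤ⇒∣ ℤ.∣ᵤ⇒∣
  (euclidsLemma ℤ.∣ x ∣ ℤ.∣ y ∣ pr (subst (p ℕ.∣_) (ℤ.abs-* x y) (ℤ.∣⇒∣ᵤ h)))

Primitive : (ℕ → ℤ) → Set
Primitive f = ∀ {p} → Prime p → ¬ (∀ i → + p ∣ᶻ f i)

∣-zero : ∀ {m x} → x ≡ + 0 → m ∣ᶻ x
∣-zero {m} refl = divides (+ 0) refl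

-- The polynomials over the field with p elements have no zero divisors. Since p divides one of the
-- two constant coefficients, that coefficient may be dropped: up to a shift the product changes by
-- multiples of p only.
prime-∣-conv : ∀ {p} → Prime p → ∀ m n f g → Bounded m f → Bounded n g →
  (∀ k → + p ∣ᶻ conv f g k) → (∀ i → + p ∣ᶻ f i) ⊎ (∀ i → + p ∣ᶻ g i)
prime-∣-conv pr zero    n       f g bf bg h = inj₁ λ i → ∣-zero (bf i z≤n)
prime-∣-conv pr (suc m) zero    f g bf bg h = inj₂ λ i → ∣-zero (bg i z≤n)
prime-∣-conv {p} pr (suc m) (suc n) f g bf bg h with euclidᶻ pr (f 0) (g 0) (h 0)
... | inj₁ p∣f₀ = Sum.map (cons p∣f₀) id (prime-∣-conv pr m (suc n) (f ∘ suc) g (Bounded-suc bf) bg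
        λ k → ℤ.∣m+n∣m⇒∣n (h (suc k)) (ℤ.∣m⇒∣m*n (g (suc k)) p∣f₀))
  where
  cons : + p ∣ᶻ f 0 → (∀ i → + p ∣ᶻ f (suc i)) → ∀ i → + p ∣ᶻ f i
  cons h₀ h zero    = h₀
  cons h₀ h (suc i) = h i
... | inj₂ p∣g₀ = Sum.map id (cons p∣g₀) (prime-∣-conv pr (suc m) n f (g ∘ suc) bf (Bounded-suc bg)
        λ k → ℤ.∣m+n∣m⇒∣n (subst (+ p ∣ᶻ_) (conv-consʳ f g k) (h (suc k))) (ℤ.∣n⇒∣m*n (f (suc k)) p∣g₀))
  where
  cons : + p ∣ᶻ g 0 → (∀ i → + p ∣ᶻ g (suc i)) → ∀ i → + p ∣ᶻ g i
  cons h₀ h zero    = h₀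
  cons h₀ h (suc i) = h i

Bounded-cancel : ∀ {n f m q} → m ≢ + 0 → (∀ i → f i ≡ m *ᶻ q i) → Bounded n f → Bounded n q
Bounded-cancel {m = m} {q} m≢0 e b i n≤i with ℤ.i*j≡0⇒i≡0∨j≡0 m (trans (sym (e i)) (b i n≤i))
... | inj₁ m≡0 = ⊥-elim (m≢0 m≡0)
... | inj₂ q≡0 = q≡0

prime≢0 : ∀ {p} → Prime p → + p ≢ + 0
prime≢0 pr eq = ℕ.≢-nonZero⁻¹ _ {{prime⇒nonZero pr}} (ℤ.+-injective eq)

factor : ∀ {m} (f : ℕ → ℤ) → (∀ i → m ∣ᶻ f i) → ∃[ q ] (∀ i → f i ≡ m *ᶻ q i)
factor {m} f h = (λ i → ℤ._∣_.quotient (h i)) , λ i → trans (ℤ._∣_.equality (h i)) (ℤ.*-comm _ m)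

∣-cancelˡ : ∀ {c m x} → c ≢ + 0 → c *ᶻ m ∣ᶻ c *ᶻ x → m ∣ᶻ x
∣-cancelˡ {c} c≢0 = ℤ.*-cancelˡ-∣ c {{ℤ.≢-nonZero c≢0}}

private
  -- The primes, with multiplicity, are stripped one at a time: `g` being primitive, each divides
  -- all of `f` and cancels from both sides.
  gauss-product : ∀ {n n'} g → Primitive g → Bounded n g → ∀ ps → List.All Prime ps → ∀ f → Bounded n' f →
    (∀ k → + ℕ.product ps ∣ᶻ conv f g k) → ∀ i → + ℕ.product ps ∣ᶻ f i
  gauss-product g prim bg [] [] f bf h i = divides (f i) (sym (ℤ.*-identityʳ (f i)))
  gauss-product g prim bg (p ∷ ps) (pr ∷ prs) f bf h =
    [ divide , (λ k → ⊥-elim (prim pr k)) ]′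
      (prime-∣-conv pr _ _ f g bf bg λ k → ℤ.∣-trans (divides (+ ℕ.product ps) (trans (ℤ.pos-* p (ℕ.product ps)) (ℤ.*-comm (+ p) _))) (h k))
    where
    divide : (∀ i → + p ∣ᶻ f i) → ∀ i → + (p ℕ.* ℕ.product ps) ∣ᶻ f i
    divide p∣f with factor f p∣f
    ... | q , e = λ i → subst₂ _∣ᶻ_ (sym (ℤ.pos-* p (ℕ.product ps))) (sym (e i))
        (ℤ.*-monoʳ-∣ (+ p) (gauss-product g prim bg ps prs q (Bounded-cancel (prime≢0 pr) e bf)
          (λ k → ∣-cancelˡ (prime≢0 pr) (subst₂ _∣ᶻ_ (ℤ.pos-* p (ℕ.product ps))
            (trans (conv-cong e (λ _ → refl) k) (conv-scaleˡ (+ p) q g k)) (h k))) i))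

gauss : ∀ {n n' m} f g → Primitive g → Bounded n' f → Bounded n g → m ≢ + 0 →
  (∀ k → m ∣ᶻ conv f g k) → ∀ i → m ∣ᶻ f i
gauss {m = m} f g prim bf bg m≢0 h i = ℤ.∣-trans ℤ.m∣∣m∣ (subst (λ t → + t ∣ᶻ _) (sym isFactorisation)
    (gauss-product g prim bg factors factorsPrime f bf (λ k → subst (λ t → + t ∣ᶻ _) isFactorisation (ℤ.∣-trans ℤ.∣m∣∣m (h k))) i))
  where
  open PrimeFactorisation (factorise ℤ.∣ m ∣ {{ℕ.≢-nonZero (m≢0 ∘ ℤ.∣i∣≡0⇒i≡0)}})

-- Pseudo-division yields a quotient only after multiplication by a constant c. As `h` is primitive,
-- Gauss's lemma moves c into the quotient, where it cancels.
primitive-quotient : ∀ {m n c} (P q h : ℕ → ℤ) → Primitive h → Bounded n h → Bounded m q → c ≢ + 0 → (∀ i → c *ᶻ P i ≡ conv q h i) →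
  ∃[ u ] Bounded m u × (∀ i → P i ≡ conv u h i)
primitive-quotient {c = c} P q h prim bh bq c≢0 eq =
  let (u , eu) = factor q (gauss q h prim bq bh c≢0 (λ i → subst (c ∣ᶻ_) (eq i) (ℤ.∣m⇒∣m*n (P i) ℤ.∣-refl)))
  in u , Bounded-cancel c≢0 eu bq , λ i → ℤ.*-cancelˡ-≡ c (P i) (conv u h i) {{ℤ.≢-nonZero c≢0}}
       (trans (eq i) (trans (conv-cong {g = h} eu (λ _ → refl) i) (conv-scaleˡ c u h i)))

contentℕ : ℕ → (ℕ → ℤ) → ℕ
contentℕ zero    f = 0
contentℕ (suc n) f = ℕ.gcd ℤ.∣ f 0 ∣ (contentℕ n (f ∘ suc))

contentℕ-∣ : ∀ n f → Bounded n f → ∀ i → + contentℕ n f ∣ᶻ f i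
contentℕ-∣ zero    f b i       = ∣-zero (b i z≤n)
contentℕ-∣ (suc n) f b zero    = ℤ.∣ᵤ⇒∣ (ℕ.gcd[m,n]∣m ℤ.∣ f 0 ∣ _)
contentℕ-∣ (suc n) f b (suc i) =
  ℤ.∣-trans (ℤ.∣ᵤ⇒∣ (ℕ.gcd[m,n]∣n ℤ.∣ f 0 ∣ (contentℕ n (f ∘ suc)))) (contentℕ-∣ n (f ∘ suc) (Bounded-suc b) i)

contentℕ-greatest : ∀ n f {m} → (∀ i → + m ∣ᶻ f i) → m ℕ.∣ contentℕ n f
contentℕ-greatest zero    f h = _ ℕ.∣0
contentℕ-greatest (suc n) f h = ℕ.gcd-greatest (ℤ.∣⇒∣ᵤ (h 0)) (contentℕ-greatest n (f ∘ suc) (h ∘ suc))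

-- The non-zero coefficient at `t` keeps the content from being 0, so that dividing by it makes
-- sense.
primitivePart : ∀ n f → Bounded n f → ∀ t → f t ≢ + 0 →
  ∃[ c ] c ≢ + 0 × ∃[ q ] (∀ i → f i ≡ c *ᶻ q i) × Primitive q
primitivePart n f b t ft≢0 with factor f (contentℕ-∣ n f b)
... | q , e = + c , c≢0 , q , e , prim
  where
  c = contentℕ n f
  c≢0 : + c ≢ + 0
  c≢0 eq = ft≢0 (trans (e t) (cong (_*ᶻ q t) eq))
  prim : Primitive q
  prim {p} pr h = ¬prime[1] (subst Prime (ℕ.∣1⇒≡1 (ℕ.*-cancelʳ-∣ c {{ℕ.≢-nonZero (c≢0 ∘ cong +_)}}
    (subst (p ℕ.* c ℕ.∣_) (sym (ℕ.*-identityˡ c)) (contentℕ-greatest n f λ i →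
      subst₂ _∣ᶻ_ (trans (ℤ.*-comm (+ c) (+ p)) (sym (ℤ.pos-* p c))) (sym (e i)) (ℤ.*-monoʳ-∣ (+ c) (h i)))))) pr)

-- The contents of f and g divide f_s and g_t, so if their product is divisible
-- by f_s g_t then the content of f is f_s.
conv-content : ∀ {m n} f g → Bounded m f → Bounded n g → ∀ s t → f s ≢ + 0 → g t ≢ + 0 →
  (∀ k → f s *ᶻ g t ∣ᶻ conv f g k) → ∀ i → f s ∣ᶻ f i
conv-content {m} {n} f g bf bg s t fs≢0 gt≢0 h i with primitivePart n g bg t gt≢0
... | c , c≢0 , q , e , prim = ℤ.∣-trans (ℤ.∣m⇒∣m*n (q t) ℤ.∣-refl)
    (gauss f q prim bf (Bounded-cancel c≢0 e bg) nonzero divided i)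
  where
  nonzero : f s *ᶻ q t ≢ + 0
  nonzero eq = [ fs≢0 , (λ q≡0 → gt≢0 (trans (e t) (trans (cong (c *ᶻ_) q≡0) (ℤ.*-zeroʳ c)))) ]′ (ℤ.i*j≡0⇒i≡0∨j≡0 (f s) eq)
  divided : ∀ k → f s *ᶻ q t ∣ᶻ conv f q k
  divided k = ∣-cancelˡ c≢0 (subst₂ _∣ᶻ_
    (trans (cong (f s *ᶻ_) (e t)) (solveᶻ 3 (λ a b c → a :*ᶻ (c :*ᶻ b) :=ᶻ c :*ᶻ (a :*ᶻ b)) refl (f s) (q t) c))
    (trans (conv-cong {f} (λ _ → refl) e k) (conv-scaleʳ c f q k)) (h k))

-- Write P = P₀ + X P′ and let Aᵏ P′ = q h + r, where A is the leading coefficient of `h`. After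
-- multiplication by A X the remainder reaches degree e + 1 with coefficient A rₑ; subtracting rₑ h
-- removes it, and rₑ becomes the constant coefficient of the new quotient.
pseudoDivision : ∀ e h → Bounded (suc (suc e)) h → ∀ D P → Bounded (D ℕ.+ suc e) P →
  ∃[ k ] ∃[ q ] ∃[ r ] Bounded D q × Bounded (suc e) r × (∀ i → h (suc e) ^ᶻ k *ᶻ P i ≡ conv q h i +ᶻ r i)
pseudoDivision e h bh zero P bP = 0 , (λ _ → + 0) , P , (λ _ _ → refl) , bP ,
  λ i → trans (ℤ.*-identityˡ (P i)) (sym (trans (cong (_+ᶻ P i) (conv-zeroˡ h (λ _ → refl) i)) (ℤ.+-identityˡ (P i))))
pseudoDivision e h bh (suc D) P bP with pseudoDivision e h bh D (P ∘ suc) (Bounded-suc bP)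
... | k , q , r , bq , br , eq = suc k , q' , r' , bq' , br' , eq'
  where
  A = h (suc e)
  q' r' : ℕ → ℤ
  q' zero    = r e
  q' (suc i) = A *ᶻ q i
  r' zero    = A ^ᶻ suc k *ᶻ P 0 +ᶻ -ᶻ (r e *ᶻ h 0)
  r' (suc i) = A *ᶻ r i +ᶻ -ᶻ (r e *ᶻ h (suc i))
  bq' : Bounded (suc D) q'
  bq' (suc i) (s≤s D≤i) = trans (cong (A *ᶻ_) (bq i D≤i)) (ℤ.*-zeroʳ A)
  br' : Bounded (suc e) r'
  br' (suc i) (s≤s e≤i) with ℕ.m≤n⇒m<n∨m≡n e≤i
  ... | inj₂ refl = solveᶻ 2 (λ a b → a :*ᶻ b :+ᶻ :-ᶻ (b :*ᶻ a) :=ᶻ conᶻ (+ 0)) refl A (r e)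
  ... | inj₁ e<i  = trans (cong₂ (λ u v → A *ᶻ u +ᶻ -ᶻ (r e *ᶻ v)) (br i e<i) (bh (suc i) (s≤s e<i)))
      (solveᶻ 2 (λ a b → a :*ᶻ conᶻ (+ 0) :+ᶻ :-ᶻ (b :*ᶻ conᶻ (+ 0)) :=ᶻ conᶻ (+ 0)) refl A (r e))
  eq' : ∀ i → A ^ᶻ suc k *ᶻ P i ≡ conv q' h i +ᶻ r' i
  eq' zero    = solveᶻ 2 (λ x y → x :=ᶻ y :+ᶻ (x :+ᶻ :-ᶻ y)) refl (A ^ᶻ suc k *ᶻ P 0) (r e *ᶻ h 0)
  eq' (suc i) = trans (ℤ.*-assoc A (A ^ᶻ k) (P (suc i))) (trans (cong (A *ᶻ_) (eq i))
    (trans (solveᶻ 4 (λ a c r t → a :*ᶻ (c :+ᶻ r) :=ᶻ t :+ᶻ a :*ᶻ c :+ᶻ (a :*ᶻ r :+ᶻ :-ᶻ t)) refl A (conv q h i) (r i) (r e *ᶻ h (suc i)))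
      (cong (λ c → r e *ᶻ h (suc i) +ᶻ c +ᶻ (A *ᶻ r i +ᶻ -ᶻ (r e *ᶻ h (suc i)))) (sym (conv-scaleˡ A q h i)))))

-- Factors of the trinomials with roots the n-th roots of γ₁ⁿ and γ₂ⁿ

prime-divisor : ∀ {x} → x ≢ 0 → x ≢ 1 → ∃[ p ] Prime p × p ℕ.∣ x
prime-divisor {x} x≢0 x≢1 with factorise x {{ℕ.≢-nonZero x≢0}}
... | record { factors = [] ; isFactorisation = e } = ⊥-elim (x≢1 e)
... | record { factors = p ∷ ps ; isFactorisation = e ; factorsPrime = pr ∷ _ } =
  p , pr , subst (p ℕ.∣_) (sym e) (ℕ.m∣m*n (ℕ.product ps))

prime-∣-^ : ∀ {p} → Prime p → ∀ x n → p ℕ.∣ x ℕ.^ n → p ℕ.∣ x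
prime-∣-^ pr x zero    h = ⊥-elim (¬prime[1] (subst Prime (ℕ.∣1⇒≡1 h) pr))
prime-∣-^ pr x (suc n) h = [ id , prime-∣-^ pr x n ]′ (euclidsLemma x (x ℕ.^ n) pr h)

module _ where
  open ℕ-Solver using (solve; _:=_; _:*_)

  private
    square-∣ : ∀ {v x} → v ℕ.∣ x → v ℕ.* v ℕ.∣ x ℕ.* x
    square-∣ h = ℕ.*-pres-∣ h h

    ^-double : ∀ x i → x ℕ.^ i ℕ.* x ℕ.^ i ≡ x ℕ.^ (i ℕ.+ i)
    ^-double x i = sym (ℕ.^-distribˡ-+-* x i i)

    x∣w² : ∀ x y w K J L → .{{ℕ.NonZero J}} → Coprimality.Coprime x y → K ≡ J ℕ.* L → x ℕ.* K ℕ.∣ y ℕ.* (w ℕ.* w ℕ.* J) → x ℕ.∣ w ℕ.* w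
    x∣w² x y w K J L cop refl h = Coprimality.coprime-divisor cop (ℕ.∣-trans (ℕ.m∣m*n L) (ℕ.*-cancelʳ-∣ J (subst₂ ℕ._∣_
      (solve 3 (λ x j l → x :* (j :* l) := x :* l :* j) refl x J L)
      (solve 3 (λ y w j → y :* (w :* j) := y :* w :* j) refl y (w ℕ.* w) J) h)))

  -- Put U² = x e and α^D = y e in lowest terms, so that x κ^D = y v².  For
  -- 2i ≤ D the first divisibility, and for 2i ≥ D the second one, shows x ∣ wᵢ².
  square-∣-power : ∀ α κ D U v (w : ℕ → ℕ) → α ≢ 0 → κ ≢ 0 → U ≢ 0 →
    U ℕ.* U ℕ.* κ ℕ.^ D ≡ v ℕ.* v ℕ.* α ℕ.^ D →
    (∀ i → v ℕ.∣ w i ℕ.* κ ℕ.^ i) → (∀ i → U ℕ.∣ w i ℕ.* α ℕ.^ (D ℕ.∸ i)) →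
    (∀ {p} → Prime p → ¬ (∀ i → p ℕ.∣ w i)) → U ℕ.* U ℕ.∣ α ℕ.^ D
  square-∣-power α κ D U v w α≢0 κ≢0 U≢0 eq v∣ U∣ prim = conclude (e ℕ.≟ 0) (x ℕ.≟ 0) (x ℕ.≟ 1)
    where
    instance
      α-nonZero : ℕ.NonZero α
      α-nonZero = ℕ.≢-nonZero α≢0
      κ-nonZero : ℕ.NonZero κ
      κ-nonZero = ℕ.≢-nonZero κ≢0
    e = ℕ.gcd (U ℕ.* U) (α ℕ.^ D)
    e∣U² = ℕ.gcd[m,n]∣m (U ℕ.* U) (α ℕ.^ D)
    e∣α^D = ℕ.gcd[m,n]∣n (U ℕ.* U) (α ℕ.^ D)
    x = ℕ.quotient e∣U²
    y = ℕ.quotient e∣α^D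
    U²≡xe : U ℕ.* U ≡ x ℕ.* e
    U²≡xe = ℕ._∣_.equality e∣U²
    α^D≡ye : α ℕ.^ D ≡ y ℕ.* e
    α^D≡ye = ℕ._∣_.equality e∣α^D
    coprime : e ≢ 0 → Coprimality.Coprime x y
    coprime e≢0 {d} (d∣x , d∣y) = ℕ.∣1⇒≡1 (ℕ.*-cancelʳ-∣ e {{ℕ.≢-nonZero e≢0}} (subst (d ℕ.* e ℕ.∣_) (sym (ℕ.*-identityˡ e))
      (ℕ.gcd-greatest (subst (d ℕ.* e ℕ.∣_) (sym U²≡xe) (ℕ.*-monoˡ-∣ e d∣x))
                      (subst (d ℕ.* e ℕ.∣_) (sym α^D≡ye) (ℕ.*-monoˡ-∣ e d∣y)))))
    xκ^D≡yv² : e ≢ 0 → x ℕ.* κ ℕ.^ D ≡ y ℕ.* (v ℕ.* v)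
    xκ^D≡yv² e≢0 = ℕ.*-cancelʳ-≡ _ _ e {{ℕ.≢-nonZero e≢0}} (trans
      (solve 3 (λ x k e → x :* k :* e := x :* e :* k) refl x (κ ℕ.^ D) e)
      (trans (cong (ℕ._* κ ℕ.^ D) (sym U²≡xe)) (trans eq (trans (cong (v ℕ.* v ℕ.*_) α^D≡ye)
        (solve 3 (λ v y e → v :* (y :* e) := y :* v :* e) refl (v ℕ.* v) y e)))))
    x∣ : e ≢ 0 → ∀ i → Dec (i ℕ.+ i ℕ.≤ D) → x ℕ.∣ w i ℕ.* w i
    -- The square of `v∣ i`, multiplied by y, reads x κ^D ∣ y wᵢ² κ^(2i). Cancel κ^(2i) and use that
    -- x is coprime to y.
    x∣ e≢0 i (yes 2i≤D) = x∣w² x y (w i) (κ ℕ.^ D) (κ ℕ.^ (i ℕ.+ i)) (κ ℕ.^ (D ℕ.∸ (i ℕ.+ i))) {{ℕ.m^n≢0 κ (i ℕ.+ i)}} (coprime e≢0)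
      (trans (cong (κ ℕ.^_) (sym (ℕ.m+[n∸m]≡n 2i≤D))) (ℕ.^-distribˡ-+-* κ (i ℕ.+ i) _))
      (subst₂ ℕ._∣_ (sym (xκ^D≡yv² e≢0)) (cong (y ℕ.*_)
          (trans (solve 2 (λ w k → w :* k :* (w :* k) := w :* w :* (k :* k)) refl (w i) (κ ℕ.^ i)) (cong (w i ℕ.* w i ℕ.*_) (^-double κ i))))
        (ℕ.*-monoʳ-∣ y (square-∣ (v∣ i))))
    -- Here y U² = y x e = x α^D takes the place of y v² = x κ^D, and α^(2j) with j = D - i is
    -- cancelled.
    x∣ e≢0 i (no 2i≰D) = x∣w² x y (w i) (α ℕ.^ D) (α ℕ.^ (j ℕ.+ j)) (α ℕ.^ (D ℕ.∸ (j ℕ.+ j))) {{ℕ.m^n≢0 α (j ℕ.+ j)}} (coprime e≢0)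
      (trans (cong (α ℕ.^_) (sym (ℕ.m+[n∸m]≡n 2j≤D))) (ℕ.^-distribˡ-+-* α (j ℕ.+ j) _))
      (subst₂ ℕ._∣_
        (trans (cong (y ℕ.*_) U²≡xe) (trans (solve 3 (λ x y e → y :* (x :* e) := x :* (y :* e)) refl x y e) (cong (x ℕ.*_) (sym α^D≡ye))))
        (cong (y ℕ.*_) (trans (solve 2 (λ w k → w :* k :* (w :* k) := w :* w :* (k :* k)) refl (w i) (α ℕ.^ j)) (cong (w i ℕ.* w i ℕ.*_) (^-double α j))))
        (ℕ.*-monoʳ-∣ y (square-∣ (U∣ i))))
      where
      j = D ℕ.∸ i
      2j≤D : j ℕ.+ j ℕ.≤ D
      2j≤D with i ℕ.≤? D
      ... | no i≰D rewrite ℕ.m≤n⇒m∸n≡0 (ℕ.<⇒≤ (ℕ.≰⇒> i≰D)) = z≤n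
      ... | yes i≤D = ℕ.≤-trans (ℕ.+-monoʳ-≤ j (ℕ.m≤n+o⇒m∸n≤o D i (ℕ.<⇒≤ (ℕ.≰⇒> 2i≰D)))) (ℕ.≤-reflexive (ℕ.m∸n+n≡m i≤D))
    conclude : Dec (e ≡ 0) → Dec (x ≡ 0) → Dec (x ≡ 1) → U ℕ.* U ℕ.∣ α ℕ.^ D
    conclude (yes e≡0) _ _ = ⊥-elim (ℕ.≢-nonZero⁻¹ (α ℕ.^ D) {{ℕ.m^n≢0 α D}} (trans α^D≡ye (trans (cong (y ℕ.*_) e≡0) (ℕ.*-zeroʳ y))))
    conclude (no e≢0) (yes x≡0) _ = ⊥-elim (U≢0 ([ id , id ]′ (ℕ.m*n≡0⇒m≡0∨n≡0 U (trans U²≡xe (cong (ℕ._* e) x≡0)))))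
    conclude (no e≢0) (no x≢0) (yes x≡1) = subst (ℕ._∣ α ℕ.^ D) (sym (trans U²≡xe (trans (cong (ℕ._* e) x≡1) (ℕ.*-identityˡ e)))) e∣α^D
    -- A prime factor of x would divide every wᵢ. So x = 1, which means U² = e.
    conclude (no e≢0) (no x≢0) (no x≢1) with prime-divisor x≢0 x≢1
    ... | p , pr , p∣x = ⊥-elim (prim pr λ i →
      [ id , id ]′ (euclidsLemma (w i) (w i) pr (ℕ.∣-trans p∣x (x∣ e≢0 i (i ℕ.+ i ℕ.≤? D)))))

mono : ℕ → ℤ → ℕ → ℤ
mono zero    c zero    = c
mono zero    c (suc i) = + 0
mono (suc k) c zero    = + 0
mono (suc k) c (suc i) = mono k c i

mono-≡ : ∀ k c → mono k c k ≡ c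
mono-≡ zero    c = refl
mono-≡ (suc k) c = mono-≡ k c

mono-≢ : ∀ {k i} c → i ≢ k → mono k c i ≡ + 0
mono-≢ {zero}  {zero}  c h = ⊥-elim (h refl)
mono-≢ {zero}  {suc i} c h = refl
mono-≢ {suc k} {zero}  c h = refl
mono-≢ {suc k} {suc i} c h = mono-≢ {k} {i} c (h ∘ cong suc)

mono-Bounded : ∀ {n} k c → k ℕ.< n → Bounded n (mono k c)
mono-Bounded k c k<n i n≤i = mono-≢ {k} {i} c λ { refl → ℕ.<-irrefl refl (ℕ.<-≤-trans k<n n≤i) }

mono-∣ : ∀ k c {m} i (y : ℕ → ℤ) → m ∣ᶻ c *ᶻ y k → m ∣ᶻ mono k c i *ᶻ y i
mono-∣ k c i y h with i ℕ.≟ k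
... | yes refl = subst (λ t → _ ∣ᶻ t *ᶻ y i) (sym (mono-≡ k c)) h
... | no i≢k  = ∣-zero (cong (_*ᶻ y i) (mono-≢ {k} {i} c i≢k))

-- If a X² + b X + c has roots γ₁ and γ₂ then powerSum n = aⁿ (γ₁ⁿ + γ₂ⁿ), and
-- the roots of powerTrinomial n are the n-th roots of γ₁ⁿ and γ₂ⁿ.
module Quadratic (a b c : ℤ) where
  powerSum : ℕ → ℤ
  powerSum zero          = + 2
  powerSum (suc zero)    = -ᶻ b
  powerSum (suc (suc n)) = -ᶻ b *ᶻ powerSum (suc n) +ᶻ -ᶻ (a *ᶻ c *ᶻ powerSum n)

  -- Modulo a c the recursion loses its second term and becomes multiplication by -b.
  powerSum-mod : ∀ n → ∃[ t ] powerSum (suc n) ≡ (-ᶻ b) ^ᶻ suc n +ᶻ a *ᶻ c *ᶻ t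
  powerSum-mod zero = + 0 , solveᶻ 2 (λ b m → b :=ᶻ b :*ᶻ conᶻ (+ 1) :+ᶻ m :*ᶻ conᶻ (+ 0)) refl (-ᶻ b) (a *ᶻ c)
  powerSum-mod (suc n) = let (t , e) = powerSum-mod n in
    -ᶻ b *ᶻ t +ᶻ -ᶻ powerSum n ,
    trans (cong (λ s → -ᶻ b *ᶻ s +ᶻ -ᶻ (a *ᶻ c *ᶻ powerSum n)) e)
      (solveᶻ 5 (λ b x m t s → b :*ᶻ (x :+ᶻ m :*ᶻ t) :+ᶻ :-ᶻ (m :*ᶻ s) :=ᶻ b :*ᶻ x :+ᶻ m :*ᶻ (b :*ᶻ t :+ᶻ :-ᶻ s)) refl
        (-ᶻ b) ((-ᶻ b) ^ᶻ suc n) (a *ᶻ c) t (powerSum n))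

  powerTrinomial : ℕ → ℕ → ℤ
  powerTrinomial n i = mono 0 (c ^ᶻ n) i +ᶻ mono n (-ᶻ powerSum n) i +ᶻ mono (n ℕ.+ n) (a ^ᶻ n) i

  Coprime₃ : Set
  Coprime₃ = ∀ {p} → Prime p → + p ∣ᶻ a → + p ∣ᶻ b → + p ∣ᶻ c → ⊥

  prime-∣-^ᶻ : ∀ {p} → Prime p → ∀ x n → + p ∣ᶻ x ^ᶻ n → + p ∣ᶻ x
  prime-∣-^ᶻ pr x zero    h = ⊥-elim (¬prime[1] (subst Prime (ℕ.∣1⇒≡1 (ℤ.∣⇒∣ᵤ h)) pr))
  prime-∣-^ᶻ pr x (suc n) h = [ id , prime-∣-^ᶻ pr x n ]′ (euclidᶻ pr x (x ^ᶻ n) h)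

  module _ (m : ℕ) where
    private n = suc m
    trinomial-0 : powerTrinomial n 0 ≡ c ^ᶻ n
    trinomial-0 = trans (ℤ.+-identityʳ _) (ℤ.+-identityʳ (c ^ᶻ n))

    trinomial-n : powerTrinomial n n ≡ -ᶻ powerSum n
    trinomial-n = trans (cong₂ (λ x y → + 0 +ᶻ x +ᶻ y) (mono-≡ n (-ᶻ powerSum n))
        (mono-≢ {n ℕ.+ n} {n} (a ^ᶻ n) (λ e → ℕ.m≢1+m+n n (trans e (ℕ.+-suc n m)))))
      (trans (ℤ.+-identityʳ _) (ℤ.+-identityˡ _))

    trinomial-2n : powerTrinomial n (n ℕ.+ n) ≡ a ^ᶻ n
    trinomial-2n = trans (cong₂ (λ x y → + 0 +ᶻ x +ᶻ y)
        (mono-≢ {n} {n ℕ.+ n} (-ᶻ powerSum n) (λ e → ℕ.m≢1+m+n n (trans (sym e) (ℕ.+-suc n m)))) (mono-≡ (n ℕ.+ n) (a ^ᶻ n)))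
      (ℤ.+-identityˡ _)

    trinomial-Bounded : Bounded (suc (n ℕ.+ n)) (powerTrinomial n)
    trinomial-Bounded i 2n<i = cong₂ _+ᶻ_ (cong₂ _+ᶻ_
        (mono-Bounded {suc (n ℕ.+ n)} 0 (c ^ᶻ n) (s≤s z≤n) i 2n<i)
        (mono-Bounded {suc (n ℕ.+ n)} n (-ᶻ powerSum n) (s≤s (ℕ.m≤m+n n n)) i 2n<i))
      (mono-Bounded {suc (n ℕ.+ n)} (n ℕ.+ n) (a ^ᶻ n) ℕ.≤-refl i 2n<i)

    trinomial-primitive : Coprime₃ → Primitive (powerTrinomial n)
    trinomial-primitive cop {p} pr h = cop pr p∣a p∣b p∣c
      where
      p∣c = prime-∣-^ᶻ pr c n (subst (+ p ∣ᶻ_) trinomial-0 (h 0))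
      p∣a = prime-∣-^ᶻ pr a n (subst (+ p ∣ᶻ_) trinomial-2n (h (n ℕ.+ n)))
      p∣s : + p ∣ᶻ powerSum n
      p∣s = subst (+ p ∣ᶻ_) (ℤ.neg-involutive (powerSum n)) (ℤ.∣m⇒∣-m (subst (+ p ∣ᶻ_) trinomial-n (h n)))
      p∣b : + p ∣ᶻ b
      p∣b = let (t , e) = powerSum-mod m in subst (+ p ∣ᶻ_) (ℤ.neg-involutive b) (ℤ.∣m⇒∣-m
        (prime-∣-^ᶻ pr (-ᶻ b) n (ℤ.∣m+n∣n⇒∣m (subst (+ p ∣ᶻ_) e p∣s) (ℤ.∣m⇒∣m*n t (ℤ.∣m⇒∣m*n c p∣a)))))

    private
      distrib₃ : ∀ x y z w → (x +ᶻ y +ᶻ z) *ᶻ w ≡ x *ᶻ w +ᶻ y *ᶻ w +ᶻ z *ᶻ w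
      distrib₃ = solveᶻ 4 (λ x y z w → (x :+ᶻ y :+ᶻ z) :*ᶻ w :=ᶻ x :*ᶻ w :+ᶻ y :*ᶻ w :+ᶻ z :*ᶻ w) refl

    trinomial-weight : ∀ i → c ^ᶻ n ∣ᶻ powerTrinomial n i *ᶻ c ^ᶻ i
    trinomial-weight i = subst (c ^ᶻ n ∣ᶻ_) (sym (distrib₃ (mono 0 (c ^ᶻ n) i) (mono n (-ᶻ powerSum n) i) (mono (n ℕ.+ n) (a ^ᶻ n) i) (c ^ᶻ i))) (ℤ.∣m∣n⇒∣m+n (ℤ.∣m∣n⇒∣m+n
        (mono-∣ 0 (c ^ᶻ n) i (c ^ᶻ_) (ℤ.∣m⇒∣m*n (+ 1) ℤ.∣-refl))
        (mono-∣ n (-ᶻ powerSum n) i (c ^ᶻ_) (ℤ.∣n⇒∣m*n (-ᶻ powerSum n) ℤ.∣-refl)))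
        (mono-∣ (n ℕ.+ n) (a ^ᶻ n) i (c ^ᶻ_) (ℤ.∣n⇒∣m*n (a ^ᶻ n)
          (subst (c ^ᶻ n ∣ᶻ_) (sym (ℤ.^-distribˡ-+-* c n n)) (ℤ.∣m⇒∣m*n (c ^ᶻ n) ℤ.∣-refl)))))

    trinomial-coweight : ∀ i → a ^ᶻ n ∣ᶻ powerTrinomial n i *ᶻ a ^ᶻ (n ℕ.+ n ℕ.∸ i)
    trinomial-coweight i = subst (a ^ᶻ n ∣ᶻ_) (sym (distrib₃ (mono 0 (c ^ᶻ n) i) (mono n (-ᶻ powerSum n) i) (mono (n ℕ.+ n) (a ^ᶻ n) i) (w i))) (ℤ.∣m∣n⇒∣m+n (ℤ.∣m∣n⇒∣m+n
        (mono-∣ 0 (c ^ᶻ n) i w (ℤ.∣n⇒∣m*n (c ^ᶻ n)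
          (subst (a ^ᶻ n ∣ᶻ_) (sym (ℤ.^-distribˡ-+-* a n n)) (ℤ.∣m⇒∣m*n (a ^ᶻ n) ℤ.∣-refl))))
        (mono-∣ n (-ᶻ powerSum n) i w (ℤ.∣n⇒∣m*n (-ᶻ powerSum n) (ℤ.∣-reflexive (cong (a ^ᶻ_) (sym (ℕ.m+n∸n≡m n n)))))))
        (mono-∣ (n ℕ.+ n) (a ^ᶻ n) i w (ℤ.∣m⇒∣m*n (w (n ℕ.+ n)) ℤ.∣-refl)))
      where
      w : ℕ → ℤ
      w i = a ^ᶻ (n ℕ.+ n ℕ.∸ i)

    -- The last hypothesis says that the absolute values of the roots of h have
    -- the same geometric mean as |γ₁| and |γ₂|.
    leading-bound : ∀ {d D h u} → Coprime₃ → a ≢ + 0 → c ≢ + 0 → Bounded (suc d) h → Bounded (suc D) u → D ℕ.+ d ≡ n ℕ.+ n →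
      (∀ i → powerTrinomial n i ≡ conv u h i) →
      ℤ.∣ h 0 ∣ ℕ.* ℤ.∣ h 0 ∣ ℕ.* ℤ.∣ a ∣ ℕ.^ d ≡ ℤ.∣ h d ∣ ℕ.* ℤ.∣ h d ∣ ℕ.* ℤ.∣ c ∣ ℕ.^ d →
      ℤ.∣ a ∣ ℕ.^ d ℕ.∣ ℤ.∣ h d ∣ ℕ.* ℤ.∣ h d ∣
    leading-bound {d} {D} {h} {u} cop a≢0 c≢0 bh bu D+d≡2n Φ≡uh norm = ℕ.divides z A²≡
      where
      open ℕ-Solver using (solve; _:=_; _:*_)
      α = ℤ.∣ a ∣ ; κ = ℤ.∣ c ∣ ; U = ℤ.∣ u D ∣ ; V = ℤ.∣ u 0 ∣ ; A = ℤ.∣ h d ∣ ; C = ℤ.∣ h 0 ∣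
      α≢0 : α ≢ 0
      α≢0 = a≢0 ∘ ℤ.∣i∣≡0⇒i≡0
      κ≢0 : κ ≢ 0
      κ≢0 = c≢0 ∘ ℤ.∣i∣≡0⇒i≡0
      leading : a ^ᶻ n ≡ u D *ᶻ h d
      leading = trans (sym trinomial-2n) (trans (cong (powerTrinomial n) (sym D+d≡2n)) (trans (Φ≡uh (D ℕ.+ d)) (conv-leading D d bu bh)))
      constant : c ^ᶻ n ≡ u 0 *ᶻ h 0
      constant = trans (sym trinomial-0) (Φ≡uh 0)
      α^n : α ℕ.^ n ≡ U ℕ.* A
      α^n = trans (sym (∣∣-^ a n)) (trans (cong ℤ.∣_∣ leading) (ℤ.abs-* (u D) (h d)))
      κ^n : κ ℕ.^ n ≡ V ℕ.* C
      κ^n = trans (sym (∣∣-^ c n)) (trans (cong ℤ.∣_∣ constant) (ℤ.abs-* (u 0) (h 0)))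
      α^-nonZero : ∀ k → ℕ.NonZero (α ℕ.^ k)
      α^-nonZero k = ℕ.m^n≢0 α k {{ℕ.≢-nonZero α≢0}}
      κ^-nonZero : ∀ k → ℕ.NonZero (κ ℕ.^ k)
      κ^-nonZero k = ℕ.m^n≢0 κ k {{ℕ.≢-nonZero κ≢0}}
      U≢0 : U ≢ 0
      U≢0 e = ℕ.≢-nonZero⁻¹ (α ℕ.^ n) {{α^-nonZero n}} (trans α^n (cong (ℕ._* A) e))
      A≢0 : A ≢ 0
      A≢0 e = ℕ.≢-nonZero⁻¹ (α ℕ.^ n) {{α^-nonZero n}} (trans α^n (trans (cong (U ℕ.*_) e) (ℕ.*-zeroʳ U)))
      V≢0 : V ≢ 0
      V≢0 e = ℕ.≢-nonZero⁻¹ (κ ℕ.^ n) {{κ^-nonZero n}} (trans κ^n (cong (ℕ._* C) e))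
      C≢0 : C ≢ 0
      C≢0 e = ℕ.≢-nonZero⁻¹ (κ ℕ.^ n) {{κ^-nonZero n}} (trans κ^n (trans (cong (V ℕ.*_) e) (ℕ.*-zeroʳ V)))
      α^2n : α ℕ.^ d ℕ.* α ℕ.^ D ≡ U ℕ.* A ℕ.* (U ℕ.* A)
      α^2n = trans (sym (ℕ.^-distribˡ-+-* α d D)) (trans (cong (α ℕ.^_) (trans (ℕ.+-comm d D) D+d≡2n))
        (trans (ℕ.^-distribˡ-+-* α n n) (cong₂ ℕ._*_ α^n α^n)))
      κ^2n : κ ℕ.^ d ℕ.* κ ℕ.^ D ≡ V ℕ.* C ℕ.* (V ℕ.* C)
      κ^2n = trans (sym (ℕ.^-distribˡ-+-* κ d D)) (trans (cong (κ ℕ.^_) (trans (ℕ.+-comm d D) D+d≡2n))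
        (trans (ℕ.^-distribˡ-+-* κ n n) (cong₂ ℕ._*_ κ^n κ^n)))
      -- The product of the roots has the same shape for Φ, by `α^2n` and `κ^2n`, and for `h`, by
      -- `norm`; dividing one relation by the other gives it for the cofactor.
      norm-u : U ℕ.* U ℕ.* κ ℕ.^ D ≡ V ℕ.* V ℕ.* α ℕ.^ D
      norm-u = ℕ.*-cancelʳ-≡ _ _ (α ℕ.^ d ℕ.* κ ℕ.^ d) {{ℕ.m*n≢0 (α ℕ.^ d) (κ ℕ.^ d) {{α^-nonZero d}} {{κ^-nonZero d}}}} (begin
        U ℕ.* U ℕ.* κ ℕ.^ D ℕ.* (α ℕ.^ d ℕ.* κ ℕ.^ d)
          ≡⟨ solve 4 (λ u kD ad kd → u :* u :* kD :* (ad :* kd) := u :* u :* ad :* (kd :* kD)) refl U (κ ℕ.^ D) (α ℕ.^ d) (κ ℕ.^ d) ⟩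
        U ℕ.* U ℕ.* α ℕ.^ d ℕ.* (κ ℕ.^ d ℕ.* κ ℕ.^ D)
          ≡⟨ cong (U ℕ.* U ℕ.* α ℕ.^ d ℕ.*_) κ^2n ⟩
        U ℕ.* U ℕ.* α ℕ.^ d ℕ.* (V ℕ.* C ℕ.* (V ℕ.* C))
          ≡⟨ solve 4 (λ u ad v c → u :* u :* ad :* (v :* c :* (v :* c)) := u :* u :* (v :* v) :* (c :* c :* ad)) refl U (α ℕ.^ d) V C ⟩
        U ℕ.* U ℕ.* (V ℕ.* V) ℕ.* (C ℕ.* C ℕ.* α ℕ.^ d)
          ≡⟨ cong (U ℕ.* U ℕ.* (V ℕ.* V) ℕ.*_) norm ⟩
        U ℕ.* U ℕ.* (V ℕ.* V) ℕ.* (A ℕ.* A ℕ.* κ ℕ.^ d)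
          ≡⟨ solve 4 (λ u v a kd → u :* u :* (v :* v) :* (a :* a :* kd) := v :* v :* kd :* (u :* a :* (u :* a))) refl U V A (κ ℕ.^ d) ⟩
        V ℕ.* V ℕ.* κ ℕ.^ d ℕ.* (U ℕ.* A ℕ.* (U ℕ.* A))
          ≡⟨ cong (V ℕ.* V ℕ.* κ ℕ.^ d ℕ.*_) (sym α^2n) ⟩
        V ℕ.* V ℕ.* κ ℕ.^ d ℕ.* (α ℕ.^ d ℕ.* α ℕ.^ D)
          ≡⟨ solve 4 (λ v kd ad aD → v :* v :* kd :* (ad :* aD) := v :* v :* aD :* (ad :* kd)) refl V (κ ℕ.^ d) (α ℕ.^ d) (α ℕ.^ D) ⟩
        V ℕ.* V ℕ.* α ℕ.^ D ℕ.* (α ℕ.^ d ℕ.* κ ℕ.^ d) ∎)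
        where open ≡-Reasoning
      u-primitive : Primitive u
      u-primitive pr k = trinomial-primitive cop pr λ i → subst (_ ∣ᶻ_) (sym (Φ≡uh i)) (conv-∣ˡ h k i)
      scaled≢0 : ∀ x {y} k → ℤ.∣ x ∣ ≢ 0 → y ≢ + 0 → x *ᶻ y ^ᶻ k ≢ + 0
      scaled≢0 x k x≢0 y≢0 e = [ x≢0 ∘ cong ℤ.∣_∣ , ^ᶻ-≢0 k y≢0 ]′ (ℤ.i*j≡0⇒i≡0∨j≡0 x e)
      scaled-Bounded : ∀ {m} f (w : ℕ → ℤ) → Bounded m f → Bounded m (λ i → f i *ᶻ w i)
      scaled-Bounded f w b i m≤i = cong (_*ᶻ w i) (b i m≤i)
      -- In terms of the roots z of `u`, this says that c / z is an algebraic integer, and `U∣` says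
      -- the same of a z.
      V∣ : ∀ i → V ℕ.∣ ℤ.∣ u i ∣ ℕ.* κ ℕ.^ i
      V∣ i = subst (V ℕ.∣_) (trans (ℤ.abs-* (u i) (c ^ᶻ i)) (cong (ℤ.∣ u i ∣ ℕ.*_) (∣∣-^ c i))) (ℤ.∣⇒∣ᵤ {u 0}
        (ℤ.∣-trans (ℤ.∣m⇒∣m*n (+ 1) ℤ.∣-refl)
          (conv-content (λ i → u i *ᶻ c ^ᶻ i) (λ i → h i *ᶻ c ^ᶻ i) (scaled-Bounded u (c ^ᶻ_) bu) (scaled-Bounded h (c ^ᶻ_) bh) 0 0
            (scaled≢0 (u 0) 0 V≢0 c≢0) (scaled≢0 (h 0) 0 C≢0 c≢0)
            (λ k → subst₂ _∣ᶻ_ (trans constant (solveᶻ 2 (λ x y → x :*ᶻ y :=ᶻ x :*ᶻ conᶻ (+ 1) :*ᶻ (y :*ᶻ conᶻ (+ 1))) refl (u 0) (h 0)))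
              (trans (cong (_*ᶻ c ^ᶻ k) (Φ≡uh k)) (sym (conv-weight c u h k))) (trinomial-weight k)) i)))
      U∣ : ∀ i → U ℕ.∣ ℤ.∣ u i ∣ ℕ.* α ℕ.^ (D ℕ.∸ i)
      U∣ i = subst (U ℕ.∣_) (trans (ℤ.abs-* (u i) (a ^ᶻ (D ℕ.∸ i))) (cong (ℤ.∣ u i ∣ ℕ.*_) (∣∣-^ a (D ℕ.∸ i)))) (ℤ.∣⇒∣ᵤ {u D}
        (ℤ.∣-trans (ℤ.∣m⇒∣m*n (a ^ᶻ (D ℕ.∸ D)) ℤ.∣-refl)
          (conv-content (λ i → u i *ᶻ a ^ᶻ (D ℕ.∸ i)) (λ i → h i *ᶻ a ^ᶻ (d ℕ.∸ i))
            (scaled-Bounded u (λ i → a ^ᶻ (D ℕ.∸ i)) bu) (scaled-Bounded h (λ i → a ^ᶻ (d ℕ.∸ i)) bh) D d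
            (scaled≢0 (u D) (D ℕ.∸ D) U≢0 a≢0) (scaled≢0 (h d) (d ℕ.∸ d) A≢0 a≢0)
            (λ k → subst₂ _∣ᶻ_ (trans leading (cong₂ _*ᶻ_ (unit (u D) D) (unit (h d) d)))
              (trans (cong₂ (λ x m → x *ᶻ a ^ᶻ (m ℕ.∸ k)) (Φ≡uh k) (sym D+d≡2n)) (sym (conv-coweight a D d bu bh k))) (trinomial-coweight k)) i)))
        where
        unit : ∀ x m → x ≡ x *ᶻ a ^ᶻ (m ℕ.∸ m)
        unit x m = trans (sym (ℤ.*-identityʳ x)) (cong (λ k → x *ᶻ a ^ᶻ k) (sym (ℕ.n∸n≡0 m)))
      U²∣α^D : U ℕ.* U ℕ.∣ α ℕ.^ D
      U²∣α^D = square-∣-power α κ D U V (λ i → ℤ.∣ u i ∣) α≢0 κ≢0 U≢0 norm-u V∣ U∣ (λ pr k → u-primitive pr (λ i → ℤ.∣ᵤ⇒∣ (k i)))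
      z = ℕ.quotient U²∣α^D
      A²≡ : A ℕ.* A ≡ z ℕ.* α ℕ.^ d
      A²≡ = ℕ.*-cancelʳ-≡ _ _ (U ℕ.* U) {{ℕ.m*n≢0 U U {{ℕ.≢-nonZero U≢0}} {{ℕ.≢-nonZero U≢0}}}} (begin
        A ℕ.* A ℕ.* (U ℕ.* U)           ≡⟨ solve 2 (λ a u → a :* a :* (u :* u) := u :* a :* (u :* a)) refl A U ⟩
        U ℕ.* A ℕ.* (U ℕ.* A)           ≡⟨ sym α^2n ⟩
        α ℕ.^ d ℕ.* α ℕ.^ D             ≡⟨ cong (α ℕ.^ d ℕ.*_) (ℕ._∣_.equality U²∣α^D) ⟩
        α ℕ.^ d ℕ.* (z ℕ.* (U ℕ.* U))   ≡⟨ solve 3 (λ x z u → x :* (z :* u) := z :* x :* u) refl (α ℕ.^ d) z (U ℕ.* U) ⟩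
        z ℕ.* α ℕ.^ d ℕ.* (U ℕ.* U)     ∎)
        where open ≡-Reasoning

-- Minimal polynomials

intᶜ-cancelˡ : ∀ {m z} → m ≢ + 0 → intᶜ m *ᶜ z ≈ 0ᶜ → z ≈ 0ᶜ
intᶜ-cancelˡ m≢0 h = ≈-stable λ k → *ᶜ-domain h [ (λ e → m≢0 (intᶜ-injective e)) , k ]′

-- Horner evaluation as in `eval`, but with the length as a mere bound, so that shifts, sums and
-- products never have to match vector lengths.
evalF : ℕ → (ℕ → ℤ) → ℂ → ℂ
evalF zero    f z = 0ᶜ
evalF (suc n) f z = intᶜ (f 0) +ᶜ z *ᶜ evalF n (f ∘ suc) z

evalF-congᶜ : ∀ n f {z w} → z ≈ w → evalF n f z ≈ evalF n f w
evalF-congᶜ zero    f h = ≈-refl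
evalF-congᶜ (suc n) f h = +ᶜ-cong ≈-refl (*ᶜ-cong h (evalF-congᶜ n (f ∘ suc) h))

evalF-cong : ∀ n {f g} → f ≗ g → ∀ z → evalF n f z ≈ evalF n g z
evalF-cong zero    h z = ≈-refl
evalF-cong (suc n) h z = +ᶜ-cong (≡⇒≈ (cong intᶜ (h 0))) (*ᶜ-cong ≈-refl (evalF-cong n (h ∘ suc) z))

evalF-scale : ∀ n m f z → evalF n (λ i → m *ᶻ f i) z ≈ intᶜ m *ᶜ evalF n f z
evalF-scale zero    m f z = solveᶜ 1 (λ m → conᶜ (+ 0) :=ᶜ m :*ᶜ conᶜ (+ 0)) ≈-refl (intᶜ m)
evalF-scale (suc n) m f z = ≈-trans (+ᶜ-cong (intᶜ-* m (f 0)) (*ᶜ-cong (≈-refl {z}) (evalF-scale n m (f ∘ suc) z)))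
  (solveᶜ 4 (λ m a z v → m :*ᶜ a :+ᶜ z :*ᶜ (m :*ᶜ v) :=ᶜ m :*ᶜ (a :+ᶜ z :*ᶜ v)) ≈-refl (intᶜ m) (intᶜ (f 0)) z (evalF n (f ∘ suc) z))

evalF-+ : ∀ n f g z → evalF n (λ i → f i +ᶻ g i) z ≈ evalF n f z +ᶜ evalF n g z
evalF-+ zero    f g z = solveᶜ 0 (conᶜ (+ 0) :=ᶜ conᶜ (+ 0) :+ᶜ conᶜ (+ 0)) ≈-refl
evalF-+ (suc n) f g z = ≈-trans (+ᶜ-cong (intᶜ-+ (f 0) (g 0)) (*ᶜ-cong (≈-refl {z}) (evalF-+ n (f ∘ suc) (g ∘ suc) z)))
  (solveᶜ 5 (λ a b z v w → a :+ᶜ b :+ᶜ z :*ᶜ (v :+ᶜ w) :=ᶜ a :+ᶜ z :*ᶜ v :+ᶜ (b :+ᶜ z :*ᶜ w)) ≈-refl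
    (intᶜ (f 0)) (intᶜ (g 0)) z (evalF n (f ∘ suc) z) (evalF n (g ∘ suc) z))

evalF-zero : ∀ n {f} → (∀ i → f i ≡ + 0) → ∀ z → evalF n f z ≈ 0ᶜ
evalF-zero zero    h z = ≈-refl
evalF-zero (suc n) h z = ≈-trans (+ᶜ-cong (≡⇒≈ (cong intᶜ (h 0))) (*ᶜ-cong ≈-refl (evalF-zero n (h ∘ suc) z)))
  (solveᶜ 1 (λ z → conᶜ (+ 0) :+ᶜ z :*ᶜ conᶜ (+ 0) :=ᶜ conᶜ (+ 0)) ≈-refl z)

evalF-extend : ∀ {m n} f → Bounded m f → m ℕ.≤ n → ∀ z → evalF n f z ≈ evalF m f z
evalF-extend {n = n} f b z≤n     z = evalF-zero n (λ i → b i z≤n) z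
evalF-extend f b (s≤s h) z = +ᶜ-cong ≈-refl (*ᶜ-cong ≈-refl (evalF-extend (f ∘ suc) (Bounded-suc b) h z))

-- Factors of lengths m and n have a product of length m + n - 1; the spare place lets m = 0 fit the
-- same formula.
evalF-conv : ∀ m n f g → Bounded m f → Bounded n g → ∀ z → evalF (m ℕ.+ n) (conv f g) z ≈ evalF m f z *ᶜ evalF n g z
evalF-conv zero    n f g bf bg z = ≈-trans (evalF-zero n (conv-zeroˡ g λ i → bf i z≤n) z)
  (solveᶜ 1 (λ x → conᶜ (+ 0) :=ᶜ conᶜ (+ 0) :*ᶜ x) ≈-refl (evalF n g z))
evalF-conv (suc m) n f g bf bg z = ≈-trans
  (+ᶜ-cong (intᶜ-* (f 0) (g 0)) (*ᶜ-cong (≈-refl {z}) (≈-trans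
    (evalF-+ (m ℕ.+ n) (λ i → f 0 *ᶻ g (suc i)) (conv (f ∘ suc) g) z)
    (+ᶜ-cong (evalF-scale (m ℕ.+ n) (f 0) (g ∘ suc) z) (evalF-conv m n (f ∘ suc) g (Bounded-suc bf) bg z)))))
  (≈-trans
    (solveᶜ 6 (λ a b z v w x → a :*ᶜ b :+ᶜ z :*ᶜ (a :*ᶜ v :+ᶜ w :*ᶜ x) :=ᶜ a :*ᶜ (b :+ᶜ z :*ᶜ v) :+ᶜ z :*ᶜ w :*ᶜ x) ≈-refl
      (intᶜ (f 0)) (intᶜ (g 0)) z (evalF (m ℕ.+ n) (g ∘ suc) z) (evalF m (f ∘ suc) z) (evalF n g z))
    (≈-trans (+ᶜ-cong (*ᶜ-cong ≈-refl (evalF-extend {n} {suc m ℕ.+ n} g bg (ℕ.m≤n+m n (suc m)) z)) ≈-refl)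
      (solveᶜ 4 (λ a z w x → a :*ᶜ x :+ᶜ z :*ᶜ w :*ᶜ x :=ᶜ (a :+ᶜ z :*ᶜ w) :*ᶜ x) ≈-refl (intᶜ (f 0)) z (evalF m (f ∘ suc) z) (evalF n g z))))

evalF-mono : ∀ {n} k c → k ℕ.< n → ∀ z → evalF n (mono k c) z ≈ intᶜ c *ᶜ z ^ᶜ k
evalF-mono {suc n} zero    c _ z = ≈-trans (+ᶜ-cong ≈-refl (*ᶜ-cong ≈-refl (evalF-zero n (λ _ → refl) z)))
  (solveᶜ 2 (λ c z → c :+ᶜ z :*ᶜ conᶜ (+ 0) :=ᶜ c :*ᶜ conᶜ (+ 1)) ≈-refl (intᶜ c) z)
evalF-mono {suc n} (suc k) c (s≤s k<n) z = ≈-trans (+ᶜ-cong ≈-refl (*ᶜ-cong ≈-refl (evalF-mono {n} k c k<n z)))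
  (solveᶜ 3 (λ c z y → conᶜ (+ 0) :+ᶜ z :*ᶜ (c :*ᶜ y) :=ᶜ c :*ᶜ (z :*ᶜ y)) ≈-refl (intᶜ c) z (z ^ᶜ k))

-- Coefficient vectors and linear factors

coeff : ∀ {n} → Vec ℤ n → ℕ → ℤ
coeff []       _       = + 0
coeff (x ∷ xs) zero    = x
coeff (x ∷ xs) (suc i) = coeff xs i

coeff-Bounded : ∀ {n} (v : Vec ℤ n) → Bounded n (coeff v)
coeff-Bounded []       i       _         = refl
coeff-Bounded (x ∷ xs) (suc i) (s≤s n≤i) = coeff-Bounded xs i n≤i

coeff-last : ∀ {n} (v : Vec ℤ (suc n)) → last v ≡ coeff v n
coeff-last (x ∷ [])     = refl
coeff-last (x ∷ y ∷ v) = coeff-last (y ∷ v)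

truncate : ∀ n → (ℕ → ℤ) → Vec ℤ n
truncate zero    f = []
truncate (suc n) f = f 0 ∷ truncate n (f ∘ suc)

coeff-replicate : ∀ n i → coeff (replicate n (+ 0)) i ≡ + 0
coeff-replicate zero    i       = refl
coeff-replicate (suc n) zero    = refl
coeff-replicate (suc n) (suc i) = coeff-replicate n i

coeff-truncate : ∀ n f → Bounded n f → coeff (truncate n f) ≗ f
coeff-truncate zero    f b i       = sym (b i z≤n)
coeff-truncate (suc n) f b zero    = refl
coeff-truncate (suc n) f b (suc i) = coeff-truncate n (f ∘ suc) (Bounded-suc b) i

eval≡evalF : ∀ {n} (v : Vec ℤ n) z → eval v z ≡ evalF n (coeff v) z
eval≡evalF []       z = 0ℂ≡0ᶜ
eval≡evalF (x ∷ xs) z = trans (+≡+ᶜ (intℂ x) (z Defs.* eval xs z))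
  (cong₂ _+ᶜ_ (intℂ≡intᶜ x) (trans (*≡*ᶜ z (eval xs z)) (cong (z *ᶜ_) (eval≡evalF xs z))))

content-greatest : ∀ {n p} (v : Vec ℤ n) → (∀ i → + p ∣ᶻ coeff v i) → + p ∣ᶻ content v
content-greatest []       h = ∣-zero refl
content-greatest (x ∷ xs) h = ℤ.∣ᵤ⇒∣ (ℤ.gcd-greatest {x} {content xs} {+ _} (ℤ.∣⇒∣ᵤ (h 0)) (ℤ.∣⇒∣ᵤ (content-greatest xs (h ∘ suc))))

-- The values of `fromRoots`. All later arguments use the factorisation of a minimal polynomial
-- through its values at points.
linearProduct : ∀ {n} → Vec ℂ n → ℂ → ℂ
linearProduct []       z = 1ᶜ
linearProduct (r ∷ rs) z = (z +ᶜ -ᶜ r) *ᶜ linearProduct rs z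

private
  -- Serves to turn the coefficientwise equation `factors` into an equation between values.
  evalV : ∀ {n} → Vec ℂ n → ℂ → ℂ
  evalV []       z = 0ᶜ
  evalV (c ∷ cs) z = c +ᶜ z *ᶜ evalV cs z

  evalV-int : ∀ {n} (v : Vec ℤ n) z → evalV (Vec.map intℂ v) z ≡ evalF n (coeff v) z
  evalV-int []       z = refl
  evalV-int (x ∷ xs) z = cong₂ _+ᶜ_ (intℂ≡intᶜ x) (cong (z *ᶜ_) (evalV-int xs z))

  evalV-cong : ∀ {n} {u v : Vec ℂ n} → Pointwise _≈_ u v → ∀ z → evalV u z ≈ evalV v z
  evalV-cong []       z = ≈-refl
  evalV-cong (h ∷ hs) z = +ᶜ-cong h (*ᶜ-cong ≈-refl (evalV-cong hs z))

  evalV-scale : ∀ {n} c (v : Vec ℂ n) z → evalV (Vec.map (c Defs.*_) v) z ≈ c *ᶜ evalV v z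
  evalV-scale c []       z = solveᶜ 1 (λ m → conᶜ (+ 0) :=ᶜ m :*ᶜ conᶜ (+ 0)) ≈-refl c
  evalV-scale c (x ∷ xs) z = ≈-trans (+ᶜ-cong (≡⇒≈ (*≡*ᶜ c x)) (*ᶜ-cong (≈-refl {z}) (evalV-scale c xs z)))
    (solveᶜ 4 (λ m a z v → m :*ᶜ a :+ᶜ z :*ᶜ (m :*ᶜ v) :=ᶜ m :*ᶜ (a :+ᶜ z :*ᶜ v)) ≈-refl c x z (evalV xs z))

  evalV-+ : ∀ {n} (u v : Vec ℂ n) z → evalV (zipWith Defs._+_ u v) z ≈ evalV u z +ᶜ evalV v z
  evalV-+ []       []       z = solveᶜ 0 (conᶜ (+ 0) :=ᶜ conᶜ (+ 0) :+ᶜ conᶜ (+ 0)) ≈-refl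
  evalV-+ (x ∷ xs) (y ∷ ys) z = ≈-trans (+ᶜ-cong (≡⇒≈ (+≡+ᶜ x y)) (*ᶜ-cong (≈-refl {z}) (evalV-+ xs ys z)))
    (solveᶜ 5 (λ a b z v w → a :+ᶜ b :+ᶜ z :*ᶜ (v :+ᶜ w) :=ᶜ a :+ᶜ z :*ᶜ v :+ᶜ (b :+ᶜ z :*ᶜ w)) ≈-refl x y z (evalV xs z) (evalV ys z))

  evalV-∷ʳ0 : ∀ {n} (v : Vec ℂ n) z → evalV (v ∷ʳ 0ℂ) z ≈ evalV v z
  evalV-∷ʳ0 []       z = ≈-trans (+ᶜ-cong (≡⇒≈ 0ℂ≡0ᶜ) ≈-refl)
    (solveᶜ 1 (λ z → conᶜ (+ 0) :+ᶜ z :*ᶜ conᶜ (+ 0) :=ᶜ conᶜ (+ 0)) ≈-refl z)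
  evalV-∷ʳ0 (x ∷ xs) z = +ᶜ-cong ≈-refl (*ᶜ-cong ≈-refl (evalV-∷ʳ0 xs z))

  evalV-fromRoots : ∀ {n} (rs : Vec ℂ n) z → evalV (fromRoots rs) z ≈ linearProduct rs z
  evalV-fromRoots []       z = ≈-trans (+ᶜ-cong (≡⇒≈ 1ℂ≡1ᶜ) ≈-refl)
    (solveᶜ 1 (λ z → conᶜ (+ 1) :+ᶜ z :*ᶜ conᶜ (+ 0) :=ᶜ conᶜ (+ 1)) ≈-refl z)
  evalV-fromRoots (r ∷ rs) z = ≈-trans (evalV-+ (0ℂ ∷ p) (Vec.map ((Defs.- r) Defs.*_) p ∷ʳ 0ℂ) z)
    (≈-trans (+ᶜ-cong (+ᶜ-cong (≡⇒≈ 0ℂ≡0ᶜ) ≈-refl)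
        (≈-trans (evalV-∷ʳ0 (Vec.map ((Defs.- r) Defs.*_) p) z)
          (≈-trans (evalV-scale (Defs.- r) p z) (*ᶜ-cong (≡⇒≈ (-≡-ᶜ r)) ≈-refl))))
      (≈-trans (solveᶜ 3 (λ z r v → conᶜ (+ 0) :+ᶜ z :*ᶜ v :+ᶜ (:-ᶜ r) :*ᶜ v :=ᶜ (z :+ᶜ :-ᶜ r) :*ᶜ v) ≈-refl z r (evalV p z))
        (*ᶜ-cong ≈-refl (evalV-fromRoots rs z))))
    where p = fromRoots rs

linearProduct-roots : ∀ {n} {P : ℂ → Set} (rs : Vec ℂ n) → (∀ r → linearProduct rs r ≈ 0ᶜ → P r) → All P rs
linearProduct-roots []       h = []
linearProduct-roots (r ∷ rs) h =
  h r (solveᶜ 2 (λ r v → (r :+ᶜ :-ᶜ r) :*ᶜ v :=ᶜ conᶜ (+ 0)) ≈-refl r (linearProduct rs r))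
  ∷ linearProduct-roots rs λ s e → h s (≈-trans (*ᶜ-cong ≈-refl e)
      (solveᶜ 1 (λ x → x :*ᶜ conᶜ (+ 0) :=ᶜ conᶜ (+ 0)) ≈-refl (s +ᶜ -ᶜ r)))

measure : ∀ {n} → ℝ → Vec ℂ n → ℝ
measure x []       = x
measure x (z ∷ zs) = (1ʳ ⊔ʳ modulus z) *ʳ measure x zs

private
  step : ℂ → ℝ → ℝ
  step z m = (fromℚ 1ℚ ⊔ᴿ ∣ z ∣) *ᴿ m

  step≡ : ∀ z m → step z m ≡ (1ʳ ⊔ʳ modulus z) *ʳ m
  step≡ z m = trans (*ᴿ≡*ʳ (fromℚ 1ℚ ⊔ᴿ ∣ z ∣) m) (cong (_*ʳ m)
    (trans (⊔ᴿ≡⊔ʳ (fromℚ 1ℚ) ∣ z ∣) (cong₂ _⊔ʳ_ (trans (fromℚ≡ratʳ 1ℚ) ratʳ-1) (∣∣≡modulus z))))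

  foldr≡measure : ∀ {n} x (zs : Vec ℂ n) → foldr (λ _ → ℝ) step x zs ≡ measure x zs
  foldr≡measure x []       = refl
  foldr≡measure x (z ∷ zs) = trans (step≡ z (foldr (λ _ → ℝ) step x zs))
    (cong ((1ʳ ⊔ʳ modulus z) *ʳ_) (foldr≡measure x zs))

  fromℚ-int : ∀ n → fromℚ (n ℚ./ 1) ≡ intʳ n
  fromℚ-int n = trans (fromℚ≡ratʳ (n ℚ./ 1)) (trans (cong ratʳ (/1≡intᵠ n)) (sym (intʳ≡ratʳ n)))
    where
    /1≡intᵠ : ∀ n → n ℚ./ 1 ≡ intᵠ n
    /1≡intᵠ n = refl

-- Divisibility by a minimal polynomial

module Minimal {γ : ℂ} (f : MinimalPolynomial γ) where
  open MinimalPolynomial f using (coefficients; vanishes; minimal; contentOne; leading>0; conjugates; factors) renaming (degree to deg)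

  h : ℕ → ℤ
  h = coeff coefficients

  A : ℤ
  A = h deg

  h-Bounded : Bounded (suc deg) h
  h-Bounded = coeff-Bounded coefficients

  A>0 : + 0 ℤ.< A
  A>0 = subst (+ 0 ℤ.<_) (coeff-last coefficients) leading>0

  A≢0 : A ≢ + 0
  A≢0 e = ℤ.<-irrefl (sym e) A>0

  h-primitive : Primitive h
  h-primitive {p} pr k = ¬prime[1] (subst Prime (ℕ.∣1⇒≡1 (ℤ.∣⇒∣ᵤ {+ p} {+ 1} (subst (+ p ∣ᶻ_) contentOne (content-greatest coefficients k)))) pr)

  vanishing : evalF (suc deg) h γ ≈ 0ᶜ
  vanishing = subst₂ _≈_ (eval≡evalF coefficients γ) 0ℂ≡0ᶜ vanishes

  -- The contrapositive of the field `minimal`; integer vectors have decidable equality, so it holds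
  -- without double negation.
  minimality : ∀ {k} q → Bounded (suc k) q → evalF (suc k) q γ ≈ 0ᶜ → suc k ℕ.≤ deg → ∀ i → q i ≡ + 0
  minimality {k} q b e k<d i = compare (Vec.≡-dec ℤ._≟_ (truncate (suc k) q) (replicate (suc k) (+ 0)))
    where
    compare : Dec (truncate (suc k) q ≡ replicate (suc k) (+ 0)) → q i ≡ + 0
    compare (yes eq) = trans (sym (coeff-truncate (suc k) q b i)) (trans (cong (λ v → coeff v i) eq) (coeff-replicate (suc k) i))
    compare (no ≢0)  = ⊥-elim (ℕ.<-irrefl refl (ℕ.≤-trans k<d (minimal (truncate (suc k) q) ≢0
      (subst₂ _≈_ (sym (eval≡evalF (truncate (suc k) q) γ)) (sym 0ℂ≡0ᶜ) (≈-trans (evalF-cong (suc k) (coeff-truncate (suc k) q b) γ) e)))))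

  factored : ∀ z → evalF (suc deg) h z ≈ intᶜ A *ᶜ linearProduct conjugates z
  factored z = ≈-trans (≡⇒≈ (sym (evalV-int coefficients z))) (≈-trans (evalV-cong factors z)
    (≈-trans (evalV-scale (intℂ (last coefficients)) (fromRoots conjugates) z)
      (*ᶜ-cong (≡⇒≈ (trans (intℂ≡intᶜ (last coefficients)) (cong intᶜ (coeff-last coefficients)))) (evalV-fromRoots conjugates z))))

  γ-root : linearProduct conjugates γ ≈ 0ᶜ
  γ-root = intᶜ-cancelˡ A≢0 (≈-trans (≈-sym (factored γ)) vanishing)

  deg≢0 : deg ≢ 0
  deg≢0 eq = A≢0 (trivial deg h eq vanishing)
    where
    trivial : ∀ d g → d ≡ 0 → evalF (suc d) g γ ≈ 0ᶜ → g d ≡ + 0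
    trivial zero g refl e = intᶜ-injective (≈-trans (solveᶜ 2 (λ a z → a :=ᶜ a :+ᶜ z :*ᶜ conᶜ (+ 0)) ≈-refl (intᶜ (g 0)) γ) e)

  private
    -- The remainder vanishes at γ and is shorter than the minimal polynomial, hence is zero.
    -- `pseudoDivision` wants the degree as a successor; as `deg` is a projection, that form is
    -- supplied by an equation.
    divide : ∀ e g → deg ≡ suc e → Bounded (suc deg) g → evalF (suc deg) g γ ≈ 0ᶜ →
      ∀ D P → Bounded (D ℕ.+ deg) P → evalF (D ℕ.+ deg) P γ ≈ 0ᶜ →
      ∃[ k ] ∃[ q ] Bounded D q × (∀ i → g deg ^ᶻ k *ᶻ P i ≡ conv q g i)
    divide e g deg≡ bg eg D P bP eP with pseudoDivision e g (subst (λ d → Bounded (suc d) g) deg≡ bg) D P (subst (λ d → Bounded (D ℕ.+ d) P) deg≡ bP)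
    ... | k , q , r , bq , br , eq = k , q , bq , λ i → trans (cong (λ d → g d ^ᶻ k *ᶻ P i) deg≡)
        (trans (eq i) (trans (cong (conv q g i +ᶻ_) (r≡0 i)) (ℤ.+-identityʳ _)))
      where
      N = D ℕ.+ suc deg
      m = g (suc e) ^ᶻ k
      d≤N : deg ℕ.≤ N
      d≤N = ℕ.≤-trans (ℕ.n≤1+n deg) (ℕ.m≤n+m (suc deg) D)
      qg : evalF N (conv q g) γ ≈ 0ᶜ
      qg = ≈-trans (evalF-conv D (suc deg) q g bq bg γ) (≈-trans (*ᶜ-cong ≈-refl eg)
        (solveᶜ 1 (λ x → x :*ᶜ conᶜ (+ 0) :=ᶜ conᶜ (+ 0)) ≈-refl (evalF D q γ)))
      mP : evalF N (λ i → m *ᶻ P i) γ ≈ 0ᶜ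
      mP = ≈-trans (evalF-scale N m P γ) (≈-trans (*ᶜ-cong ≈-refl
          (≈-trans (evalF-extend P bP (ℕ.+-monoʳ-≤ D (ℕ.n≤1+n deg)) γ) eP))
        (solveᶜ 1 (λ x → x :*ᶜ conᶜ (+ 0) :=ᶜ conᶜ (+ 0)) ≈-refl (intᶜ m)))
      eval-r : evalF (suc e) r γ ≈ 0ᶜ
      eval-r = ≈-trans (≈-sym (evalF-extend r br (subst (ℕ._≤ N) deg≡ d≤N) γ))
        (≈-trans (solveᶜ 2 (λ x y → y :=ᶜ (x :+ᶜ y) :+ᶜ :-ᶜ x) ≈-refl (evalF N (conv q g) γ) (evalF N r γ))
          (≈-trans (+ᶜ-cong (≈-trans (≈-sym (evalF-+ N (conv q g) r γ)) (≈-trans (evalF-cong N (λ i → sym (eq i)) γ) mP)) (-ᶜ-cong qg))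
            (solveᶜ 0 (conᶜ (+ 0) :+ᶜ :-ᶜ conᶜ (+ 0) :=ᶜ conᶜ (+ 0)) ≈-refl)))
      r≡0 : ∀ i → r i ≡ + 0
      r≡0 = minimality r br eval-r (ℕ.≤-reflexive (sym deg≡))

    division : ∀ D P → Bounded (D ℕ.+ deg) P → evalF (D ℕ.+ deg) P γ ≈ 0ᶜ →
      ∃[ k ] ∃[ q ] Bounded D q × (∀ i → A ^ᶻ k *ᶻ P i ≡ conv q h i)
    division = divide (ℕ.pred deg) h (sym (ℕ.suc-pred deg {{ℕ.≢-nonZero deg≢0}})) h-Bounded vanishing

  divides-vanishing : ∀ D P → Bounded (D ℕ.+ deg) P → evalF (D ℕ.+ deg) P γ ≈ 0ᶜ →
    ∃[ u ] Bounded D u × (∀ i → P i ≡ conv u h i)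
  divides-vanishing D P bP eP = let (k , q , bq , eq) = division D P bP eP in
    primitive-quotient {c = A ^ᶻ k} P q h h-primitive h-Bounded bq (^ᶻ-≢0 k A≢0) eq

  -- The substitute for Galois theory: integral relations satisfied by γ pass to all its conjugates
  -- because `h` divides them.
  conjugate-root : ∀ D P → Bounded (D ℕ.+ deg) P → evalF (D ℕ.+ deg) P γ ≈ 0ᶜ →
    ∀ z → linearProduct conjugates z ≈ 0ᶜ → evalF (D ℕ.+ deg) P z ≈ 0ᶜ
  conjugate-root D P bP eP z ez = let (u , bu , eq) = divides-vanishing D P bP eP in
    ≈-trans (≈-sym (evalF-extend P bP (ℕ.+-monoʳ-≤ D (ℕ.n≤1+n deg)) z))
    (≈-trans (evalF-cong (D ℕ.+ suc deg) eq z) (≈-trans (evalF-conv D (suc deg) u h bu h-Bounded z)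
      (≈-trans (*ᶜ-cong ≈-refl (≈-trans (factored z) (*ᶜ-cong ≈-refl ez)))
        (solveᶜ 2 (λ x y → x :*ᶜ (y :*ᶜ conᶜ (+ 0)) :=ᶜ conᶜ (+ 0)) ≈-refl (evalF D u z) (intᶜ A)))))

  constant : intᶜ (h 0) ≈ intᶜ A *ᶜ linearProduct conjugates 0ᶜ
  constant = ≈-trans (solveᶜ 2 (λ a x → a :=ᶜ a :+ᶜ conᶜ (+ 0) :*ᶜ x) ≈-refl (intᶜ (h 0)) (evalF deg (h ∘ suc) 0ᶜ)) (factored 0ᶜ)

  M≡measure : M f ≡ measure (intʳ A) conjugates
  M≡measure = trans (foldr≡measure (fromℚ (last coefficients ℚ./ 1)) conjugates)
    (cong (λ x → measure x conjugates) (trans (fromℚ-int (last coefficients)) (cong intʳ (coeff-last coefficients))))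

-- The lower bound

^ᶜ-+ : ∀ z m n → z ^ᶜ (m ℕ.+ n) ≈ z ^ᶜ m *ᶜ z ^ᶜ n
^ᶜ-+ z zero    n = solveᶜ 1 (λ x → x :=ᶜ conᶜ (+ 1) :*ᶜ x) ≈-refl (z ^ᶜ n)
^ᶜ-+ z (suc m) n = ≈-trans (*ᶜ-cong ≈-refl (^ᶜ-+ z m n)) (≈-sym (*ᶜ-assoc z (z ^ᶜ m) (z ^ᶜ n)))

^ᶜ-* : ∀ z w n → (z *ᶜ w) ^ᶜ n ≈ z ^ᶜ n *ᶜ w ^ᶜ n
^ᶜ-* z w zero    = solveᶜ 0 (conᶜ (+ 1) :=ᶜ conᶜ (+ 1) :*ᶜ conᶜ (+ 1)) ≈-refl
^ᶜ-* z w (suc n) = ≈-trans (*ᶜ-cong ≈-refl (^ᶜ-* z w n))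
  (solveᶜ 4 (λ z w x y → z :*ᶜ w :*ᶜ (x :*ᶜ y) :=ᶜ z :*ᶜ x :*ᶜ (w :*ᶜ y)) ≈-refl z w (z ^ᶜ n) (w ^ᶜ n))

intᶜ-^ : ∀ x n → intᶜ (x ^ᶻ n) ≈ intᶜ x ^ᶜ n
intᶜ-^ x zero    = ≈-refl
intᶜ-^ x (suc n) = ≈-trans (intᶜ-* x (x ^ᶻ n)) (*ᶜ-cong ≈-refl (intᶜ-^ x n))

^ʳ-+ : ∀ x m n → x ^ʳ (m ℕ.+ n) ≈ᴿ x ^ʳ m *ʳ x ^ʳ n
^ʳ-+ x zero    n = ≈ᴿ-sym (*ʳ-identityˡ (x ^ʳ n))
^ʳ-+ x (suc m) n = ≈ᴿ-trans (*ʳ-cong ≈ᴿ-refl (^ʳ-+ x m n)) (≈ᴿ-sym (*ʳ-assoc x (x ^ʳ m) (x ^ʳ n)))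

^ʳ-* : ∀ x y n → (x *ʳ y) ^ʳ n ≈ᴿ x ^ʳ n *ʳ y ^ʳ n
^ʳ-* x y zero    = ≈ᴿ-sym (*ʳ-identityˡ 1ʳ)
^ʳ-* x y (suc n) = ≈ᴿ-trans (*ʳ-cong ≈ᴿ-refl (^ʳ-* x y n))
  (solveʳ 4 (λ z w x y → z :*ʳ w :*ʳ (x :*ʳ y) :=ʳ z :*ʳ x :*ʳ (w :*ʳ y)) ≈ᴿ-refl x y (x ^ʳ n) (y ^ʳ n))

^ʳ-≥1 : ∀ {x} n → 1ʳ ≤ᴿ x → 1ʳ ≤ᴿ x ^ʳ n
^ʳ-≥1 zero    h = ≤ᴿ-refl
^ʳ-≥1 {x} (suc n) h = ≤ᴿ-respˡ (*ʳ-identityˡ 1ʳ) (*ʳ-mono 0≤1 (^ʳ-nonneg n (≤ᴿ-trans 0≤1 h)) h (^ʳ-≥1 n h))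

natʳ-* : ∀ m n → natʳ (m ℕ.* n) ≈ᴿ natʳ m *ʳ natʳ n
natʳ-* m n = ≈ᴿ-trans (≡⇒≈ᴿ (cong intʳ (ℤ.pos-* m n))) (intʳ-* (+ m) (+ n))

natʳ-^ : ∀ m n → natʳ (m ℕ.^ n) ≈ᴿ natʳ m ^ʳ n
natʳ-^ m zero    = ≈ᴿ-refl
natʳ-^ m (suc n) = ≈ᴿ-trans (natʳ-* m (m ℕ.^ n)) (*ʳ-cong ≈ᴿ-refl (natʳ-^ m n))

natʳ-injective : ∀ {m n} → natʳ m ≈ᴿ natʳ n → m ≡ n
natʳ-injective h = ℤ.+-injective (intʳ-injective h)

natʳ-mono : ∀ {m n} → m ℕ.≤ n → natʳ m ≤ᴿ natʳ n
natʳ-mono h = intʳ-mono (ℤ.+≤+ h)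

max₁ : ℝ → ℝ
max₁ x = 1ʳ ⊔ʳ x

max₁≥1 : ∀ x → 1ʳ ≤ᴿ max₁ x
max₁≥1 x = x≤x⊔y 1ʳ x

max₁≥0 : ∀ x → 0ʳ ≤ᴿ max₁ x
max₁≥0 x = ≤ᴿ-trans 0≤1 (max₁≥1 x)

max₁-cong : ∀ {x y} → x ≈ᴿ y → max₁ x ≈ᴿ max₁ y
max₁-cong h = ⊔ʳ-cong ≈ᴿ-refl h

-- Counts how many entries have each modulus, retaining only what the Mahler measure and the norm
-- need. If both moduli agree the counts are not unique, which does no harm to the two products.
record Split {n} (ρ₁ ρ₂ : ℝ) (zs : Vec ℂ n) : Set where
  constructor split
  field
    d₁ d₂    : ℕ
    d₁+d₂    : d₁ ℕ.+ d₂ ≡ n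
    measure≈ : ∀ x → measure x zs ≈ᴿ max₁ ρ₁ ^ʳ d₁ *ʳ max₁ ρ₂ ^ʳ d₂ *ʳ x
    norm≈    : modulus (linearProduct zs 0ᶜ) ≈ᴿ ρ₁ ^ʳ d₁ *ʳ ρ₂ ^ʳ d₂

split-moduli : ∀ {n} ρ₁ ρ₂ (zs : Vec ℂ n) → All (λ z → ¬ ¬ (modulus z ≈ᴿ ρ₁ ⊎ modulus z ≈ᴿ ρ₂)) zs → ¬ ¬ Split ρ₁ ρ₂ zs
split-moduli ρ₁ ρ₂ [] [] k = k (split 0 0 refl
  (solveʳ 1 (λ x → x :=ʳ conʳ (+ 1) :*ʳ conʳ (+ 1) :*ʳ x) ≈ᴿ-refl)
  (≈ᴿ-trans modulus-1 (≈ᴿ-sym (*ʳ-identityˡ 1ʳ))))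
split-moduli ρ₁ ρ₂ (z ∷ zs) (h ∷ hs) k = split-moduli ρ₁ ρ₂ zs hs λ s → h λ
  { (inj₁ e) → k (add₁ s e) ; (inj₂ e) → k (add₂ s e) }
  where
  head : modulus (linearProduct (z ∷ zs) 0ᶜ) ≈ᴿ modulus z *ʳ modulus (linearProduct zs 0ᶜ)
  head = ≈ᴿ-trans (modulus-* (0ᶜ +ᶜ -ᶜ z) (linearProduct zs 0ᶜ)) (*ʳ-congʳ (modulus (linearProduct zs 0ᶜ))
    (≈ᴿ-trans (modulus-cong (solveᶜ 1 (λ z → conᶜ (+ 0) :+ᶜ :-ᶜ z :=ᶜ conᶜ -[1+ 0 ] :*ᶜ z) ≈-refl z))
      (≈ᴿ-trans (modulus-* (intᶜ -[1+ 0 ]) z) (≈ᴿ-trans (*ʳ-congʳ (modulus z) (modulus-intᶜ -[1+ 0 ])) (*ʳ-identityˡ (modulus z))))))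
  add₁ : Split ρ₁ ρ₂ zs → modulus z ≈ᴿ ρ₁ → Split ρ₁ ρ₂ (z ∷ zs)
  add₁ (split d₁ d₂ eq m n) e = split (suc d₁) d₂ (cong suc eq)
    (λ x → ≈ᴿ-trans (*ʳ-cong (max₁-cong e) (m x))
      (solveʳ 4 (λ a b c x → a :*ʳ (b :*ʳ c :*ʳ x) :=ʳ a :*ʳ b :*ʳ c :*ʳ x) ≈ᴿ-refl (max₁ ρ₁) (max₁ ρ₁ ^ʳ d₁) (max₁ ρ₂ ^ʳ d₂) x))
    (≈ᴿ-trans head (≈ᴿ-trans (*ʳ-cong e n) (≈ᴿ-sym (*ʳ-assoc ρ₁ (ρ₁ ^ʳ d₁) (ρ₂ ^ʳ d₂)))))
  add₂ : Split ρ₁ ρ₂ zs → modulus z ≈ᴿ ρ₂ → Split ρ₁ ρ₂ (z ∷ zs)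
  add₂ (split d₁ d₂ eq m n) e = split d₁ (suc d₂) (trans (ℕ.+-suc d₁ d₂) (cong suc eq))
    (λ x → ≈ᴿ-trans (*ʳ-cong (max₁-cong e) (m x))
      (solveʳ 4 (λ a b c x → a :*ʳ (b :*ʳ c :*ʳ x) :=ʳ b :*ʳ (a :*ʳ c) :*ʳ x) ≈ᴿ-refl (max₁ ρ₂) (max₁ ρ₁ ^ʳ d₁) (max₁ ρ₂ ^ʳ d₂) x))
    (≈ᴿ-trans head (≈ᴿ-trans (*ʳ-cong e n)
      (solveʳ 3 (λ a b c → a :*ʳ (b :*ʳ c) :=ʳ b :*ʳ (a :*ʳ c)) ≈ᴿ-refl ρ₂ (ρ₁ ^ʳ d₁) (ρ₂ ^ʳ d₂))))

-- Vieta's relations are the interface, so that the same computation serves a quadratic minimal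
-- polynomial, the square of a linear one, and the equation of a root of unity and its conjugate.
module QuadraticRoots (a b c : ℤ) (γ₁ γ₂ : ℂ)
  (sum≈ : intᶜ a *ᶜ (γ₁ +ᶜ γ₂) ≈ intᶜ (-ᶻ b)) (product≈ : intᶜ a *ᶜ (γ₁ *ᶜ γ₂) ≈ intᶜ c) where

  open Quadratic a b c

  powerSum≈ : ∀ n → intᶜ (powerSum n) ≈ intᶜ a ^ᶜ n *ᶜ (γ₁ ^ᶜ n +ᶜ γ₂ ^ᶜ n)
  powerSum≈ zero          = solveᶜ 0 (conᶜ (+ 2) :=ᶜ conᶜ (+ 1) :*ᶜ (conᶜ (+ 1) :+ᶜ conᶜ (+ 1))) ≈-refl
  powerSum≈ (suc zero)    = ≈-trans (≈-sym sum≈)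
    (solveᶜ 3 (λ a x y → a :*ᶜ (x :+ᶜ y) :=ᶜ a :*ᶜ conᶜ (+ 1) :*ᶜ (x :*ᶜ conᶜ (+ 1) :+ᶜ y :*ᶜ conᶜ (+ 1))) ≈-refl (intᶜ a) γ₁ γ₂)
  powerSum≈ (suc (suc n)) = ≈-trans (intᶜ-+ (-ᶻ b *ᶻ powerSum (suc n)) (-ᶻ (a *ᶻ c *ᶻ powerSum n)))
    (≈-trans (+ᶜ-cong
        (≈-trans (intᶜ-* (-ᶻ b) (powerSum (suc n))) (*ᶜ-cong (≈-sym sum≈) (powerSum≈ (suc n))))
        (≈-trans (intᶜ-neg (a *ᶻ c *ᶻ powerSum n)) (-ᶜ-cong (≈-trans (intᶜ-* (a *ᶻ c) (powerSum n))
          (*ᶜ-cong (≈-trans (intᶜ-* a c) (*ᶜ-cong ≈-refl (≈-sym product≈))) (powerSum≈ n))))))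
      (solveᶜ 6 (λ a x y p xn yn →
          a :*ᶜ (x :+ᶜ y) :*ᶜ (a :*ᶜ p :*ᶜ (x :*ᶜ xn :+ᶜ y :*ᶜ yn)) :+ᶜ :-ᶜ (a :*ᶜ (a :*ᶜ (x :*ᶜ y)) :*ᶜ (p :*ᶜ (xn :+ᶜ yn)))
          :=ᶜ a :*ᶜ (a :*ᶜ p) :*ᶜ (x :*ᶜ (x :*ᶜ xn) :+ᶜ y :*ᶜ (y :*ᶜ yn))) ≈-refl
        (intᶜ a) γ₁ γ₂ (intᶜ a ^ᶜ n) (γ₁ ^ᶜ n) (γ₂ ^ᶜ n)))

  product-^ : ∀ n → intᶜ (c ^ᶻ n) ≈ intᶜ a ^ᶜ n *ᶜ (γ₁ ^ᶜ n *ᶜ γ₂ ^ᶜ n)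
  product-^ n = ≈-trans (intᶜ-^ c n) (≈-trans (^ᶜ-cong n (≈-sym product≈))
    (≈-trans (^ᶜ-* (intᶜ a) (γ₁ *ᶜ γ₂) n) (*ᶜ-cong ≈-refl (^ᶜ-* γ₁ γ₂ n))))

  trinomial≈ : ∀ {N} n → n ℕ.+ n ℕ.< N → ∀ z →
    evalF N (powerTrinomial n) z ≈ intᶜ a ^ᶜ n *ᶜ ((z ^ᶜ n +ᶜ -ᶜ γ₁ ^ᶜ n) *ᶜ (z ^ᶜ n +ᶜ -ᶜ γ₂ ^ᶜ n))
  trinomial≈ {N} n 2n<N z = ≈-trans (evalF-+ N (λ i → mono 0 (c ^ᶻ n) i +ᶻ mono n (-ᶻ powerSum n) i) (mono (n ℕ.+ n) (a ^ᶻ n)) z)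
    (≈-trans (+ᶜ-cong (≈-trans (evalF-+ N (mono 0 (c ^ᶻ n)) (mono n (-ᶻ powerSum n)) z) (+ᶜ-cong
        (≈-trans (evalF-mono 0 (c ^ᶻ n) (ℕ.≤-<-trans z≤n 2n<N) z) (*ᶜ-cong (product-^ n) ≈-refl))
        (≈-trans (evalF-mono n (-ᶻ powerSum n) (ℕ.≤-<-trans (ℕ.m≤m+n n n) 2n<N) z)
          (*ᶜ-cong (≈-trans (intᶜ-neg (powerSum n)) (-ᶜ-cong (powerSum≈ n))) ≈-refl))))
        (≈-trans (evalF-mono (n ℕ.+ n) (a ^ᶻ n) 2n<N z) (*ᶜ-cong (intᶜ-^ a n) (^ᶜ-+ z n n))))
      (solveᶜ 4 (λ p x y z → p :*ᶜ (x :*ᶜ y) :*ᶜ conᶜ (+ 1) :+ᶜ (:-ᶜ (p :*ᶜ (x :+ᶜ y))) :*ᶜ z :+ᶜ p :*ᶜ (z :*ᶜ z) :=ᶜ p :*ᶜ ((z :+ᶜ :-ᶜ x) :*ᶜ (z :+ᶜ :-ᶜ y))) ≈-refl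
        (intᶜ a ^ᶜ n) (γ₁ ^ᶜ n) (γ₂ ^ᶜ n) (z ^ᶜ n)))

  product-modulus : natʳ ℤ.∣ a ∣ *ʳ (modulus γ₁ *ʳ modulus γ₂) ≈ᴿ natʳ ℤ.∣ c ∣
  product-modulus = ≈ᴿ-trans (*ʳ-cong (≈ᴿ-sym (modulus-intᶜ a)) (≈ᴿ-sym (modulus-* γ₁ γ₂)))
    (≈ᴿ-trans (≈ᴿ-sym (modulus-* (intᶜ a) (γ₁ *ᶜ γ₂))) (≈ᴿ-trans (modulus-cong product≈) (modulus-intᶜ c)))

z-w≈0⇒z≈w : ∀ {z w} → z +ᶜ -ᶜ w ≈ 0ᶜ → z ≈ w
z-w≈0⇒z≈w {z} {w} h = ≈-trans (solveᶜ 2 (λ z w → z :=ᶜ (z :+ᶜ :-ᶜ w) :+ᶜ w) ≈-refl z w)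
  (≈-trans (+ᶜ-cong h ≈-refl) (solveᶜ 1 (λ w → conᶜ (+ 0) :+ᶜ w :=ᶜ w) ≈-refl w))

modulus-root : ∀ {z w} n → z ^ᶜ suc n ≈ w ^ᶜ suc n → modulus z ≈ᴿ modulus w
modulus-root {z} {w} n h = ^ʳ-injective n (modulus-nonneg z) (modulus-nonneg w)
  (≈ᴿ-trans (≈ᴿ-sym (modulus-^ z (suc n))) (≈ᴿ-trans (modulus-cong h) (modulus-^ w (suc n))))

-- What remains of the Galois action on absolute values. It is trivial when γ₁ = γ₂ and is derived
-- from complex conjugation when γ is quadratic.
RationalPowerSymmetric : ℝ → ℝ → Set
RationalPowerSymmetric ρ₁ ρ₂ = ∀ X Y k → X ≢ 0 → natʳ X *ʳ ρ₁ ^ʳ suc k ≈ᴿ natʳ Y → ρ₁ ≈ᴿ ρ₂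

compare : ∀ m n → m ≡ n ⊎ (∃[ k ] m ≡ n ℕ.+ suc k) ⊎ (∃[ k ] n ≡ m ℕ.+ suc k)
compare m n with ℕ.compare m n
... | ℕ.equal _     = inj₁ refl
... | ℕ.less m k    = inj₂ (inj₂ (k , sym (ℕ.+-suc m k)))
... | ℕ.greater n k = inj₂ (inj₁ (k , sym (ℕ.+-suc n k)))

m^n≢0 : ∀ m n → m ≢ 0 → m ℕ.^ n ≢ 0
m^n≢0 m n m≢0 = ℕ.≢-nonZero⁻¹ (m ℕ.^ n) {{ℕ.m^n≢0 m n {{ℕ.≢-nonZero m≢0}}}}

m*n≢0 : ∀ m n → m ≢ 0 → n ≢ 0 → m ℕ.* n ≢ 0
m*n≢0 m n m≢0 n≢0 = ℕ.≢-nonZero⁻¹ (m ℕ.* n) {{ℕ.m*n≢0 m n {{ℕ.≢-nonZero m≢0}} {{ℕ.≢-nonZero n≢0}}}}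

natʳ-*-^ : ∀ x y k → natʳ (x ℕ.* y ℕ.^ k) ≈ᴿ natʳ x *ʳ natʳ y ^ʳ k
natʳ-*-^ x y k = ≈ᴿ-trans (natʳ-* x (y ℕ.^ k)) (*ʳ-cong ≈ᴿ-refl (natʳ-^ y k))

-- If d₁ ≠ d₂ then the two equations make a power of ρ₁ rational.
balanced : ∀ {ρ₁ ρ₂} (a c A C : ℕ) → a ≢ 0 → c ≢ 0 → A ≢ 0 → C ≢ 0 → RationalPowerSymmetric ρ₁ ρ₂ →
  natʳ a *ʳ (ρ₁ *ʳ ρ₂) ≈ᴿ natʳ c → ∀ d₁ d₂ → natʳ A *ʳ (ρ₁ ^ʳ d₁ *ʳ ρ₂ ^ʳ d₂) ≈ᴿ natʳ C → d₁ ≡ d₂ ⊎ ρ₁ ≈ᴿ ρ₂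
balanced {ρ₁} {ρ₂} a c A C a≢0 c≢0 A≢0 C≢0 sym-ρ aρρ≈c d₁ d₂ norm = by-cases d₁ d₂ norm (compare d₁ d₂)
  where
  aρρ^ : ∀ j → natʳ a ^ʳ j *ʳ (ρ₁ ^ʳ j *ʳ ρ₂ ^ʳ j) ≈ᴿ natʳ c ^ʳ j
  aρρ^ j = ≈ᴿ-trans (*ʳ-cong ≈ᴿ-refl (≈ᴿ-sym (^ʳ-* ρ₁ ρ₂ j))) (≈ᴿ-trans (≈ᴿ-sym (^ʳ-* (natʳ a) (ρ₁ *ʳ ρ₂) j)) (^ʳ-cong j aρρ≈c))
  by-cases : ∀ d₁ d₂ → natʳ A *ʳ (ρ₁ ^ʳ d₁ *ʳ ρ₂ ^ʳ d₂) ≈ᴿ natʳ C →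
    d₁ ≡ d₂ ⊎ (∃[ k ] d₁ ≡ d₂ ℕ.+ suc k) ⊎ (∃[ k ] d₂ ≡ d₁ ℕ.+ suc k) → d₁ ≡ d₂ ⊎ ρ₁ ≈ᴿ ρ₂
  by-cases d₁ d₂ norm (inj₁ eq) = inj₁ eq
  -- Dividing the norm equation by (ρ₁ ρ₂)^d₂ = (c / a)^d₂ eliminates ρ₂ and leaves A c^d₂ ρ₁^(k+1)
  -- = C a^d₂.
  by-cases d₁ d₂ norm (inj₂ (inj₁ (k , refl))) = inj₂ (sym-ρ (A ℕ.* c ℕ.^ d₂) (C ℕ.* a ℕ.^ d₂) k (m*n≢0 A (c ℕ.^ d₂) A≢0 (m^n≢0 c d₂ c≢0))
    (≈ᴿ-trans (*ʳ-congʳ (ρ₁ ^ʳ suc k) (≈ᴿ-trans (natʳ-*-^ A c d₂) (*ʳ-cong ≈ᴿ-refl (≈ᴿ-sym (aρρ^ d₂)))))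
    (≈ᴿ-trans (solveʳ 5 (λ A p x y z → A :*ʳ (p :*ʳ (x :*ʳ y)) :*ʳ z :=ʳ A :*ʳ (x :*ʳ z :*ʳ y) :*ʳ p) ≈ᴿ-refl
        (natʳ A) (natʳ a ^ʳ d₂) (ρ₁ ^ʳ d₂) (ρ₂ ^ʳ d₂) (ρ₁ ^ʳ suc k))
    (≈ᴿ-trans (*ʳ-congʳ (natʳ a ^ʳ d₂) (≈ᴿ-trans (*ʳ-cong ≈ᴿ-refl (*ʳ-congʳ (ρ₂ ^ʳ d₂) (≈ᴿ-sym (^ʳ-+ ρ₁ d₂ (suc k))))) norm))
      (≈ᴿ-sym (natʳ-*-^ C a d₂))))))
  -- Multiplying the norm equation by ρ₁^(k+1) completes ρ₁^d₁ to ρ₁^d₂, so that again a power of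
  -- ρ₁, and not of ρ₂, turns out rational.
  by-cases d₁ d₂ norm (inj₂ (inj₂ (k , refl))) = inj₂ (sym-ρ (C ℕ.* a ℕ.^ d₂) (A ℕ.* c ℕ.^ d₂) k (m*n≢0 C (a ℕ.^ d₂) C≢0 (m^n≢0 a d₂ a≢0))
    (≈ᴿ-trans (*ʳ-congʳ (ρ₁ ^ʳ suc k) (≈ᴿ-trans (natʳ-*-^ C a d₂) (*ʳ-congʳ (natʳ a ^ʳ d₂) (≈ᴿ-sym norm))))
    (≈ᴿ-trans (solveʳ 5 (λ A p x y z → A :*ʳ (x :*ʳ y) :*ʳ p :*ʳ z :=ʳ A :*ʳ (p :*ʳ (x :*ʳ z :*ʳ y))) ≈ᴿ-refl
        (natʳ A) (natʳ a ^ʳ d₂) (ρ₁ ^ʳ d₁) (ρ₂ ^ʳ d₂) (ρ₁ ^ʳ suc k))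
    (≈ᴿ-trans (*ʳ-cong ≈ᴿ-refl (≈ᴿ-trans (*ʳ-cong ≈ᴿ-refl (*ʳ-congʳ (ρ₂ ^ʳ d₂) (≈ᴿ-sym (^ʳ-+ ρ₁ d₁ (suc k))))) (aρρ^ d₂)))
      (≈ᴿ-sym (natʳ-*-^ A c d₂))))))

-- The norm is squared because d₁ + d₂ may be odd when ρ₁ = ρ₂.
norm-square : ∀ {ρ₁ ρ₂} d₁ d₂ → d₁ ≡ d₂ ⊎ ρ₁ ≈ᴿ ρ₂ →
  (ρ₁ ^ʳ d₁ *ʳ ρ₂ ^ʳ d₂) *ʳ (ρ₁ ^ʳ d₁ *ʳ ρ₂ ^ʳ d₂) ≈ᴿ (ρ₁ *ʳ ρ₂) ^ʳ (d₁ ℕ.+ d₂)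
norm-square {ρ₁} {ρ₂} d₁ d₂ (inj₁ refl) = ≈ᴿ-trans
  (*ʳ-cong (≈ᴿ-sym (^ʳ-* ρ₁ ρ₂ d₁)) (≈ᴿ-sym (^ʳ-* ρ₁ ρ₂ d₁))) (≈ᴿ-sym (^ʳ-+ (ρ₁ *ʳ ρ₂) d₁ d₁))
norm-square {ρ₁} {ρ₂} d₁ d₂ (inj₂ e) = ≈ᴿ-trans
  (*ʳ-cong (*ʳ-cong ≈ᴿ-refl (^ʳ-cong d₂ (≈ᴿ-sym e))) (*ʳ-cong (^ʳ-cong d₁ e) ≈ᴿ-refl))
  (≈ᴿ-trans (*ʳ-cong (≈ᴿ-sym (^ʳ-+ ρ₁ d₁ d₂)) (≈ᴿ-sym (^ʳ-+ ρ₂ d₁ d₂))) (≈ᴿ-sym (^ʳ-* ρ₁ ρ₂ (d₁ ℕ.+ d₂))))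

+∣∣≡ : ∀ {x} → + 0 ℤ.< x → + ℤ.∣ x ∣ ≡ x
+∣∣≡ h = ℤ.0≤i⇒+∣i∣≡i (ℤ.<⇒≤ h)

x≤x*y : ∀ {x y} → 0ʳ ≤ᴿ x → 1ʳ ≤ᴿ y → x ≤ᴿ x *ʳ y
x≤x*y {x} {y} x≥0 y≥1 = ≤ᴿ-respˡ (solveʳ 1 (λ x → x :*ʳ conʳ (+ 1) :=ʳ x) ≈ᴿ-refl x) (*ʳ-monoʳ x x≥0 y≥1)

square-cancel-≤ : ∀ {m n} → m ℕ.* m ℕ.≤ n ℕ.* n → m ℕ.≤ n
square-cancel-≤ h = ℕ.≮⇒≥ λ n<m → ℕ.<-irrefl refl (ℕ.<-≤-trans (ℕ.*-mono-< n<m n<m) h)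

module RotatedConjugates (a b c : ℤ) (γ₁ γ₂ : ℂ)
  (sum≈ : intᶜ a *ᶜ (γ₁ +ᶜ γ₂) ≈ intᶜ (-ᶻ b)) (product≈ : intᶜ a *ᶜ (γ₁ *ᶜ γ₂) ≈ intᶜ c)
  (a≢0 : a ≢ + 0) (c≢0 : c ≢ + 0) (coprime : Quadratic.Coprime₃ a b c)
  (symmetric : RationalPowerSymmetric (modulus γ₁) (modulus γ₂))
  {β : ℂ} (f : MinimalPolynomial β) (m : ℕ) (β^n≈γ₁^n : β ^ᶜ suc m ≈ γ₁ ^ᶜ suc m) where

  open Quadratic a b c
  open QuadraticRoots a b c γ₁ γ₂ sum≈ product≈
  open Minimal f
  open MinimalPolynomial f using (conjugates) renaming (degree to deg)

  private
    n = suc m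
    Φ = powerTrinomial n
    ρ₁ = modulus γ₁
    ρ₂ = modulus γ₂

    aⁿ≢0 : a ^ᶻ n ≢ + 0
    aⁿ≢0 = ^ᶻ-≢0 n a≢0

    Φβ≈0 : ∀ {N} → n ℕ.+ n ℕ.< N → evalF N Φ β ≈ 0ᶜ
    Φβ≈0 2n<N = ≈-trans (trinomial≈ n 2n<N β) (≈-trans (*ᶜ-cong ≈-refl (*ᶜ-cong (+ᶜ-cong β^n≈γ₁^n ≈-refl) ≈-refl))
      (solveᶜ 3 (λ p x y → p :*ᶜ ((x :+ᶜ :-ᶜ x) :*ᶜ y) :=ᶜ conᶜ (+ 0)) ≈-refl (intᶜ a ^ᶜ n) (γ₁ ^ᶜ n) (β ^ᶜ n +ᶜ -ᶜ γ₂ ^ᶜ n)))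

    deg≤2n : deg ℕ.≤ n ℕ.+ n
    deg≤2n = ℕ.≮⇒≥ λ 2n<deg → aⁿ≢0 (trans (sym (trinomial-2n m))
      (minimality Φ (trinomial-Bounded m) (Φβ≈0 ℕ.≤-refl) 2n<deg (n ℕ.+ n)))

    D = n ℕ.+ n ℕ.∸ deg

    D+deg≡2n : D ℕ.+ deg ≡ n ℕ.+ n
    D+deg≡2n = ℕ.m∸n+n≡m deg≤2n

    2n<N : n ℕ.+ n ℕ.< suc D ℕ.+ deg
    2n<N = ℕ.≤-reflexive (cong suc (sym D+deg≡2n))

    Φ-Bounded : Bounded (suc D ℕ.+ deg) Φ
    Φ-Bounded = Bounded-weaken 2n<N (trinomial-Bounded m)

    quotient : ∃[ u ] Bounded (suc D) u × (∀ i → Φ i ≡ conv u h i)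
    quotient = divides-vanishing (suc D) Φ Φ-Bounded (Φβ≈0 2n<N)

    u = proj₁ quotient

    h₀≢0 : h 0 ≢ + 0
    h₀≢0 e = ^ᶻ-≢0 n c≢0 (trans (sym (trinomial-0 m)) (trans (proj₂ (proj₂ quotient) 0) (trans (cong (u 0 *ᶻ_) e) (ℤ.*-zeroʳ (u 0)))))

    conjugate-moduli : All (λ z → ¬ ¬ (modulus z ≈ᴿ ρ₁ ⊎ modulus z ≈ᴿ ρ₂)) conjugates
    conjugate-moduli = linearProduct-roots conjugates λ z e k → *ᶜ-domain
      (intᶜ-cancelˡ {z = (z ^ᶜ n +ᶜ -ᶜ γ₁ ^ᶜ n) *ᶜ (z ^ᶜ n +ᶜ -ᶜ γ₂ ^ᶜ n)} aⁿ≢0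
        (≈-trans (*ᶜ-cong (intᶜ-^ a n) ≈-refl) (≈-trans (≈-sym (trinomial≈ n 2n<N z)) (conjugate-root (suc D) Φ Φ-Bounded (Φβ≈0 2n<N) z e))))
      λ { (inj₁ e) → k (inj₁ (modulus-root m (z-w≈0⇒z≈w e))) ; (inj₂ e) → k (inj₂ (modulus-root m (z-w≈0⇒z≈w e))) }

  record Conclusion : Set where
    field
      d₁ d₂    : ℕ
      d₁+d₂    : d₁ ℕ.+ d₂ ≡ deg
      M≈       : M f ≈ᴿ max₁ ρ₁ ^ʳ d₁ *ʳ max₁ ρ₂ ^ʳ d₂ *ʳ natʳ ℤ.∣ A ∣
      balance  : d₁ ≡ d₂ ⊎ ρ₁ ≈ᴿ ρ₂
      leading∣ : ℤ.∣ a ∣ ℕ.^ deg ℕ.∣ ℤ.∣ A ∣ ℕ.* ℤ.∣ A ∣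

  conclusion : ¬ ¬ Conclusion
  conclusion k = split-moduli ρ₁ ρ₂ conjugates conjugate-moduli λ s → k (conclude s)
    where
    conclude : Split ρ₁ ρ₂ conjugates → Conclusion
    conclude (split d₁ d₂ d₁+d₂≡deg measure≈ norm≈) = record
      { d₁ = d₁ ; d₂ = d₂ ; d₁+d₂ = d₁+d₂≡deg
      ; M≈ = ≈ᴿ-trans (≡⇒≈ᴿ M≡measure) (≈ᴿ-trans (measure≈ (intʳ A)) (*ʳ-cong ≈ᴿ-refl (≡⇒≈ᴿ (cong intʳ (sym (+∣∣≡ A>0))))))
      ; balance = balance
      ; leading∣ = leading-bound m {deg} {D} {h} {u} coprime a≢0 c≢0 h-Bounded (proj₁ (proj₂ quotient)) D+deg≡2n (proj₂ (proj₂ quotient))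
          (natʳ-injective norm-identity) }
      where
      C′ = ℤ.∣ h 0 ∣
      A′ = ℤ.∣ A ∣
      π = ρ₁ ^ʳ d₁ *ʳ ρ₂ ^ʳ d₂
      norm : natʳ A′ *ʳ π ≈ᴿ natʳ C′
      norm = ≈ᴿ-trans (*ʳ-cong (≈ᴿ-sym (modulus-intᶜ A)) (≈ᴿ-sym norm≈)) (≈ᴿ-trans (≈ᴿ-sym (modulus-* (intᶜ A) (linearProduct conjugates 0ᶜ)))
        (≈ᴿ-trans (modulus-cong (≈-sym constant)) (modulus-intᶜ (h 0))))
      balance : d₁ ≡ d₂ ⊎ ρ₁ ≈ᴿ ρ₂
      balance = balanced ℤ.∣ a ∣ ℤ.∣ c ∣ A′ C′ (a≢0 ∘ ℤ.∣i∣≡0⇒i≡0) (c≢0 ∘ ℤ.∣i∣≡0⇒i≡0) (A≢0 ∘ ℤ.∣i∣≡0⇒i≡0) (h₀≢0 ∘ ℤ.∣i∣≡0⇒i≡0)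
        symmetric product-modulus d₁ d₂ norm
      -- From |h 0| = A π with π² = (ρ₁ ρ₂)^deg and ρ₁ ρ₂ = |c| / |a|. Both sides are integers, so
      -- the identity of reals descends to ℕ.
      norm-identity : natʳ (C′ ℕ.* C′ ℕ.* ℤ.∣ a ∣ ℕ.^ deg) ≈ᴿ natʳ (A′ ℕ.* A′ ℕ.* ℤ.∣ c ∣ ℕ.^ deg)
      norm-identity = ≈ᴿ-trans (natʳ-*-^ (C′ ℕ.* C′) ℤ.∣ a ∣ deg)
        (≈ᴿ-trans (*ʳ-congʳ (natʳ ℤ.∣ a ∣ ^ʳ deg) (≈ᴿ-trans (natʳ-* C′ C′) (*ʳ-cong (≈ᴿ-sym norm) (≈ᴿ-sym norm))))
        (≈ᴿ-trans (solveʳ 3 (λ A p a → A :*ʳ p :*ʳ (A :*ʳ p) :*ʳ a :=ʳ A :*ʳ A :*ʳ (a :*ʳ (p :*ʳ p))) ≈ᴿ-refl (natʳ A′) π (natʳ ℤ.∣ a ∣ ^ʳ deg))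
        (≈ᴿ-trans (*ʳ-cong (≈ᴿ-sym (natʳ-* A′ A′)) (≈ᴿ-trans (*ʳ-cong ≈ᴿ-refl
            (≈ᴿ-trans (norm-square d₁ d₂ balance) (≡⇒≈ᴿ (cong ((ρ₁ *ʳ ρ₂) ^ʳ_) d₁+d₂≡deg))))
            (≈ᴿ-trans (≈ᴿ-sym (^ʳ-* (natʳ ℤ.∣ a ∣) (ρ₁ *ʳ ρ₂) deg)) (^ʳ-cong deg product-modulus))))
          (≈ᴿ-sym (natʳ-*-^ (A′ ℕ.* A′) ℤ.∣ c ∣ deg)))))

  -- Two conjugates of β of moduli ρ₁ and ρ₂ already account for the bound.
  M-bound : 2 ℕ.≤ deg → natʳ ℤ.∣ a ∣ *ʳ (max₁ ρ₁ *ʳ max₁ ρ₂) ≤ᴿ M f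
  M-bound 2≤deg = ≤ᴿ-stable λ k → conclusion λ con → let open Conclusion con in
    k (≤ᴿ-respʳ (≈ᴿ-sym M≈) (≤ᴿ-respˡ (*ʳ-comm (max₁ ρ₁ *ʳ max₁ ρ₂) (natʳ ℤ.∣ a ∣))
      (*ʳ-mono (*ʳ-nonneg (max₁≥0 ρ₁) (max₁≥0 ρ₂)) (natʳ-nonneg ℤ.∣ A ∣)
        (max-product d₁ d₂ (subst (2 ℕ.≤_) (sym d₁+d₂) 2≤deg) balance) (natʳ-mono (a≤A leading∣)))))
    where
    a≤A : ℤ.∣ a ∣ ℕ.^ deg ℕ.∣ ℤ.∣ A ∣ ℕ.* ℤ.∣ A ∣ → ℤ.∣ a ∣ ℕ.≤ ℤ.∣ A ∣
    a≤A h = square-cancel-≤ (ℕ.≤-trans (ℕ.≤-reflexive (cong (ℤ.∣ a ∣ ℕ.*_) (sym (ℕ.*-identityʳ ℤ.∣ a ∣))))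
        (ℕ.≤-trans (ℕ.^-monoʳ-≤ ℤ.∣ a ∣ {{ℕ.≢-nonZero (a≢0 ∘ ℤ.∣i∣≡0⇒i≡0)}} 2≤deg)
          (ℕ.∣⇒≤ {{ℕ.m*n≢0 ℤ.∣ A ∣ ℤ.∣ A ∣ {{ℕ.≢-nonZero (A≢0 ∘ ℤ.∣i∣≡0⇒i≡0)}} {{ℕ.≢-nonZero (A≢0 ∘ ℤ.∣i∣≡0⇒i≡0)}}}} h)))
    max-product : ∀ d₁ d₂ → 2 ℕ.≤ d₁ ℕ.+ d₂ → d₁ ≡ d₂ ⊎ ρ₁ ≈ᴿ ρ₂ → max₁ ρ₁ *ʳ max₁ ρ₂ ≤ᴿ max₁ ρ₁ ^ʳ d₁ *ʳ max₁ ρ₂ ^ʳ d₂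
    max-product zero    .zero () (inj₁ refl)
    max-product (suc d) .(suc d) _ (inj₁ refl) = *ʳ-mono (max₁≥0 ρ₁) (^ʳ-nonneg (suc d) (max₁≥0 ρ₂))
      (x≤x*y (max₁≥0 ρ₁) (^ʳ-≥1 d (max₁≥1 ρ₁))) (x≤x*y (max₁≥0 ρ₂) (^ʳ-≥1 d (max₁≥1 ρ₂)))
    max-product d₁ d₂ 2≤ (inj₂ e) = ≤ᴿ-respʳ (≈ᴿ-trans (^ʳ-+ (max₁ ρ₁) d₁ d₂) (*ʳ-cong ≈ᴿ-refl (^ʳ-cong d₂ (max₁-cong e))))
      (≤ᴿ-respˡ (*ʳ-cong ≈ᴿ-refl (max₁-cong e)) (square≤power 2≤))
      where
      square≤power : ∀ {n} → 2 ℕ.≤ n → max₁ ρ₁ *ʳ max₁ ρ₁ ≤ᴿ max₁ ρ₁ ^ʳ n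
      square≤power {suc (suc n)} (s≤s (s≤s z≤n)) =
        *ʳ-monoʳ (max₁ ρ₁) (max₁≥0 ρ₁) (x≤x*y (max₁≥0 ρ₁) (^ʳ-≥1 n (max₁≥1 ρ₁)))

-- The lower bound for rational γ

module Degree₁ {γ : ℂ} (γ≉0 : ¬ (γ ≈ 0ᶜ)) (f : MinimalPolynomial γ) (deg≡1 : degree f ≡ 1) where
  open Minimal f
  open MinimalPolynomial f using (conjugates)

  C : ℤ
  C = h 0

  linear : intᶜ A *ᶜ γ ≈ intᶜ (-ᶻ C)
  linear = ≈-trans (solveᶜ 3 (λ a c z → a :*ᶜ z :=ᶜ (c :+ᶜ z :*ᶜ (a :+ᶜ z :*ᶜ conᶜ (+ 0))) :+ᶜ :-ᶜ c) ≈-refl (intᶜ A) (intᶜ C) γ)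
    (≈-trans (+ᶜ-cong (expand (degree f) deg≡1 vanishing) (≈-sym (intᶜ-neg C)))
      (solveᶜ 1 (λ c → conᶜ (+ 0) :+ᶜ c :=ᶜ c) ≈-refl (intᶜ (-ᶻ C))))
    where
    expand : ∀ d → d ≡ 1 → evalF (suc d) h γ ≈ 0ᶜ → intᶜ C +ᶜ γ *ᶜ (intᶜ (h d) +ᶜ γ *ᶜ 0ᶜ) ≈ 0ᶜ
    expand .1 refl e = e

  private
    α = ℤ.∣ A ∣

    C≢0 : C ≢ + 0
    C≢0 C≡0 = γ≉0 (intᶜ-cancelˡ A≢0 (≈-trans linear (≡⇒≈ (cong (intᶜ ∘ -ᶻ_) C≡0))))

    M-linear : M f ≈ᴿ max₁ (modulus γ) *ʳ natʳ α
    M-linear = ≈ᴿ-trans (≡⇒≈ᴿ M≡measure) (≈ᴿ-trans (single conjugates deg≡1 γ-root)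
      (*ʳ-cong ≈ᴿ-refl (≡⇒≈ᴿ (cong intʳ (sym (+∣∣≡ A>0))))))
      where
      single : ∀ {d x} (rs : Vec ℂ d) → d ≡ 1 → linearProduct rs γ ≈ 0ᶜ → measure x rs ≈ᴿ max₁ (modulus γ) *ʳ x
      single (r ∷ []) refl e = *ʳ-cong (max₁-cong (modulus-cong (≈-sym (z-w≈0⇒z≈w
        (≈-trans (solveᶜ 2 (λ z r → z :+ᶜ :-ᶜ r :=ᶜ (z :+ᶜ :-ᶜ r) :*ᶜ conᶜ (+ 1)) ≈-refl γ r) e))))) ≈ᴿ-refl

    square≢0 : ∀ {x} → x ≢ + 0 → x *ᶻ x ≢ + 0
    square≢0 {x} x≢0 e = [ x≢0 , x≢0 ]′ (ℤ.i*j≡0⇒i≡0∨j≡0 x e)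

    coprime : Quadratic.Coprime₃ (A *ᶻ A) (+ 2 *ᶻ (A *ᶻ C)) (C *ᶻ C)
    coprime {p} pr p∣A² _ p∣C² = h-primitive pr (all (degree f) deg≡1 h-Bounded (p∣ A p∣A²) (p∣ C p∣C²))
      where
      p∣ : ∀ x → + p ∣ᶻ x *ᶻ x → + p ∣ᶻ x
      p∣ x h = [ id , id ]′ (euclidᶻ pr x x h)
      all : ∀ d → d ≡ 1 → Bounded (suc d) h → + p ∣ᶻ h d → + p ∣ᶻ h 0 → ∀ i → + p ∣ᶻ h i
      all .1 refl b h₁ h₀ zero          = h₀
      all .1 refl b h₁ h₀ (suc zero)    = h₁
      all .1 refl b h₁ h₀ (suc (suc i)) = ∣-zero (b (suc (suc i)) (s≤s (s≤s z≤n)))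

    sum≈ : intᶜ (A *ᶻ A) *ᶜ (γ +ᶜ γ) ≈ intᶜ (-ᶻ (+ 2 *ᶻ (A *ᶻ C)))
    sum≈ = ≈-trans (*ᶜ-cong (intᶜ-* A A) ≈-refl)
      (≈-trans (solveᶜ 2 (λ a z → a :*ᶜ a :*ᶜ (z :+ᶜ z) :=ᶜ conᶜ (+ 2) :*ᶜ (a :*ᶜ (a :*ᶜ z))) ≈-refl (intᶜ A) γ)
      (≈-trans (*ᶜ-cong ≈-refl (*ᶜ-cong ≈-refl (≈-trans linear (intᶜ-neg C))))
      (≈-trans (solveᶜ 2 (λ a c → conᶜ (+ 2) :*ᶜ (a :*ᶜ (:-ᶜ c)) :=ᶜ :-ᶜ (conᶜ (+ 2) :*ᶜ (a :*ᶜ c))) ≈-refl (intᶜ A) (intᶜ C))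
        (≈-sym (≈-trans (intᶜ-neg (+ 2 *ᶻ (A *ᶻ C))) (-ᶜ-cong (≈-trans (intᶜ-* (+ 2) (A *ᶻ C)) (*ᶜ-cong ≈-refl (intᶜ-* A C)))))))))

    product≈ : intᶜ (A *ᶻ A) *ᶜ (γ *ᶜ γ) ≈ intᶜ (C *ᶻ C)
    product≈ = ≈-trans (*ᶜ-cong (intᶜ-* A A) ≈-refl)
      (≈-trans (solveᶜ 2 (λ a z → a :*ᶜ a :*ᶜ (z :*ᶜ z) :=ᶜ a :*ᶜ z :*ᶜ (a :*ᶜ z)) ≈-refl (intᶜ A) γ)
      (≈-trans (*ᶜ-cong (≈-trans linear (intᶜ-neg C)) (≈-trans linear (intᶜ-neg C)))
      (≈-trans (solveᶜ 1 (λ c → (:-ᶜ c) :*ᶜ (:-ᶜ c) :=ᶜ c :*ᶜ c) ≈-refl (intᶜ C)) (≈-sym (intᶜ-* C C)))))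

  -- The argument for quadratic γ applies to the square of the linear f.
  M-≤ : ∀ {β} (F : MinimalPolynomial β) m → β ^ᶜ suc m ≈ γ ^ᶜ suc m → M f ≤ᴿ M F
  M-≤ {β} F m eq = ≤ᴿ-stable λ k → conclusion λ con → k (bound con)
    where
    open RotatedConjugates (A *ᶻ A) (+ 2 *ᶻ (A *ᶻ C)) (C *ᶻ C) γ γ sum≈ product≈
      (square≢0 A≢0) (square≢0 C≢0) coprime (λ _ _ _ _ _ → ≈ᴿ-refl) F m eq
    A′ = Minimal.A F
    d = degree F
    d≥1 : 1 ℕ.≤ d
    d≥1 = ℕ.n≢0⇒n>0 (Minimal.deg≢0 F)
    -- The leading coefficient in question is now A², so degree 1 already suffices: A² ≤ (A²)^d ≤
    -- A′².
    α≤A′ : ℤ.∣ A *ᶻ A ∣ ℕ.^ d ℕ.∣ ℤ.∣ A′ ∣ ℕ.* ℤ.∣ A′ ∣ → α ℕ.≤ ℤ.∣ A′ ∣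
    α≤A′ h = square-cancel-≤ (ℕ.≤-trans (ℕ.≤-reflexive (trans (sym (ℤ.abs-* A A)) (sym (ℕ.^-identityʳ ℤ.∣ A *ᶻ A ∣))))
      (ℕ.≤-trans (ℕ.^-monoʳ-≤ ℤ.∣ A *ᶻ A ∣ {{nonZero}} d≥1) (ℕ.∣⇒≤ {{ℕ.m*n≢0 ℤ.∣ A′ ∣ ℤ.∣ A′ ∣ {{A′-nonZero}} {{A′-nonZero}}}} h)))
      where
      A′-nonZero = ℕ.≢-nonZero (Minimal.A≢0 F ∘ ℤ.∣i∣≡0⇒i≡0)
      α-nonZero = ℕ.≢-nonZero (A≢0 ∘ ℤ.∣i∣≡0⇒i≡0)
      nonZero : ℕ.NonZero ℤ.∣ A *ᶻ A ∣
      nonZero = subst ℕ.NonZero (sym (ℤ.abs-* A A)) (ℕ.m*n≢0 α α {{α-nonZero}} {{α-nonZero}})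
    x≤x^ : ∀ {x} n → 1ʳ ≤ᴿ x → 1 ℕ.≤ n → x ≤ᴿ x ^ʳ n
    x≤x^ (suc n) h _ = x≤x*y (≤ᴿ-trans 0≤1 h) (^ʳ-≥1 n h)
    bound : Conclusion → M f ≤ᴿ M F
    bound con = let open Conclusion con in
      ≤ᴿ-respˡ (≈ᴿ-sym M-linear) (≤ᴿ-respʳ (≈ᴿ-sym M≈) (*ʳ-mono (max₁≥0 (modulus γ)) (natʳ-nonneg ℤ.∣ A′ ∣)
        (≤ᴿ-respʳ (^ʳ-+ (max₁ (modulus γ)) d₁ d₂) (x≤x^ (d₁ ℕ.+ d₂) (max₁≥1 (modulus γ)) (subst (1 ℕ.≤_) (sym d₁+d₂) d≥1)))
        (natʳ-mono (α≤A′ leading∣))))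

-- The lower bound for quadratic γ

conj-evalF : ∀ n f z → evalF n f (conj z) ≈ conj (evalF n f z)
conj-evalF zero    f z = ≈-sym (conj-realᶜ 0ʳ)
conj-evalF (suc n) f z = ≈-sym (≈-trans (conj-+ (intᶜ (f 0)) (z *ᶜ evalF n (f ∘ suc) z))
  (+ᶜ-cong (conj-realᶜ (intʳ (f 0))) (≈-trans (conj-* z (evalF n (f ∘ suc) z)) (*ᶜ-cong ≈-refl (≈-sym (conj-evalF n (f ∘ suc) z))))))

realᶜ-^ : ∀ x n → realᶜ (x ^ʳ n) ≈ realᶜ x ^ᶜ n
realᶜ-^ x zero    = ≈-refl
realᶜ-^ x (suc n) = ≈-trans (realᶜ-* x (x ^ʳ n)) (*ᶜ-cong ≈-refl (realᶜ-^ x n))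

conj-fixed⇒square : ∀ {z} → conj z ≈ z → z *ᶜ z ≈ realᶜ (modulus z *ʳ modulus z)
conj-fixed⇒square {z} e = ≈-trans (*ᶜ-cong ≈-refl (≈-sym e)) (≈-trans (*ᶜ-conj z) (realᶜ-cong (≈ᴿ-sym (modulus-square z))))

-- One of the two listed conjugates equals γ, but which one cannot be decided; the other root is
-- therefore obtained only under a double negation.
record Roots {γ : ℂ} (f : MinimalPolynomial γ) : Set where
  field
    γ₂       : ℂ
    factored : ∀ z → evalF 3 (Minimal.h f) z ≈ intᶜ (Minimal.h f 2) *ᶜ ((z +ᶜ -ᶜ γ) *ᶜ (z +ᶜ -ᶜ γ₂))
    root₂    : linearProduct (MinimalPolynomial.conjugates f) γ₂ ≈ 0ᶜ
    M≈       : M f ≈ᴿ natʳ ℤ.∣ Minimal.h f 2 ∣ *ʳ (max₁ (modulus γ) *ʳ max₁ (modulus γ₂))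

roots : ∀ {γ} (f : MinimalPolynomial γ) → degree f ≡ 2 → ¬ ¬ Roots f
roots {γ} f deg≡2 = go (degree f) deg≡2 conjugates (λ _ → id) γ-root factored (≈ᴿ-trans (≡⇒≈ᴿ M≡measure)
    (≡⇒≈ᴿ (cong (λ x → measure x conjugates) (cong intʳ (sym (+∣∣≡ A>0))))))
  where
  open Minimal f
  open MinimalPolynomial f using (conjugates)
  -- The degree and the vector of conjugates are generalised together, so that matching on `d ≡ 2`
  -- exposes both roots.
  go : ∀ d → d ≡ 2 → (rs : Vec ℂ d) → (∀ z → linearProduct rs z ≈ 0ᶜ → linearProduct conjugates z ≈ 0ᶜ) → linearProduct rs γ ≈ 0ᶜ →
    (∀ z → evalF (suc d) h z ≈ intᶜ (h d) *ᶜ linearProduct rs z) → M f ≈ᴿ measure (natʳ ℤ.∣ h d ∣) rs → ¬ ¬ Roots f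
  go .2 refl (r ∷ s ∷ []) roots⊆ γ-root factored M≈ k = *ᶜ-domain
    (≈-trans (solveᶜ 3 (λ z r s → (z :+ᶜ :-ᶜ r) :*ᶜ (z :+ᶜ :-ᶜ s) :=ᶜ (z :+ᶜ :-ᶜ r) :*ᶜ ((z :+ᶜ :-ᶜ s) :*ᶜ conᶜ (+ 1))) ≈-refl γ r s) γ-root)
    λ { (inj₁ e) → k (record
          { γ₂ = s
          ; factored = λ z → ≈-trans (factored z) (≈-trans (regroup r s z)
              (*ᶜ-cong ≈-refl (*ᶜ-cong (+ᶜ-cong ≈-refl (-ᶜ-cong (≈-sym (z-w≈0⇒z≈w e)))) ≈-refl)))
          ; root₂ = roots⊆ s (solveᶜ 2 (λ r s → (s :+ᶜ :-ᶜ r) :*ᶜ ((s :+ᶜ :-ᶜ s) :*ᶜ conᶜ (+ 1)) :=ᶜ conᶜ (+ 0)) ≈-refl r s)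
          ; M≈ = ≈ᴿ-trans M≈ (≈ᴿ-trans (*ʳ-congʳ (max₁ (modulus s) *ʳ natʳ ℤ.∣ h 2 ∣) (max₁-cong (modulus-cong (≈-sym (z-w≈0⇒z≈w e)))))
              (solveʳ 3 (λ x y a → x :*ʳ (y :*ʳ a) :=ʳ a :*ʳ (x :*ʳ y)) ≈ᴿ-refl (max₁ (modulus γ)) (max₁ (modulus s)) (natʳ ℤ.∣ h 2 ∣))) })
      ; (inj₂ e) → k (record
          { γ₂ = r
          ; factored = λ z → ≈-trans (factored z) (≈-trans (regroup r s z) (≈-trans (*ᶜ-cong ≈-refl (*ᶜ-comm (z +ᶜ -ᶜ r) (z +ᶜ -ᶜ s)))
              (*ᶜ-cong ≈-refl (*ᶜ-cong (+ᶜ-cong ≈-refl (-ᶜ-cong (≈-sym (z-w≈0⇒z≈w e)))) ≈-refl))))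
          ; root₂ = roots⊆ r (solveᶜ 2 (λ r s → (r :+ᶜ :-ᶜ r) :*ᶜ ((r :+ᶜ :-ᶜ s) :*ᶜ conᶜ (+ 1)) :=ᶜ conᶜ (+ 0)) ≈-refl r s)
          ; M≈ = ≈ᴿ-trans M≈ (≈ᴿ-trans (*ʳ-cong ≈ᴿ-refl (*ʳ-congʳ (natʳ ℤ.∣ h 2 ∣) (max₁-cong (modulus-cong (≈-sym (z-w≈0⇒z≈w e))))))
              (solveʳ 3 (λ x y a → y :*ʳ (x :*ʳ a) :=ʳ a :*ʳ (x :*ʳ y)) ≈ᴿ-refl (max₁ (modulus γ)) (max₁ (modulus r)) (natʳ ℤ.∣ h 2 ∣))) }) }
    where
    regroup : ∀ r s z → intᶜ (h 2) *ᶜ ((z +ᶜ -ᶜ r) *ᶜ ((z +ᶜ -ᶜ s) *ᶜ 1ᶜ)) ≈ intᶜ (h 2) *ᶜ ((z +ᶜ -ᶜ r) *ᶜ (z +ᶜ -ᶜ s))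
    regroup r s z = solveᶜ 4 (λ a z r s → a :*ᶜ ((z :+ᶜ :-ᶜ r) :*ᶜ ((z :+ᶜ :-ᶜ s) :*ᶜ conᶜ (+ 1))) :=ᶜ a :*ᶜ ((z :+ᶜ :-ᶜ r) :*ᶜ (z :+ᶜ :-ᶜ s))) ≈-refl (intᶜ (h 2)) z r s

module Degree₂ {γ : ℂ} (γ≉0 : ¬ (γ ≈ 0ᶜ)) (f : MinimalPolynomial γ) (deg≡2 : degree f ≡ 2) (rs : Roots f) where
  open Minimal f using (h; A≢0; h-primitive; h-Bounded; minimality; conjugate-root)
  open Roots rs

  a b c : ℤ
  a = h 2
  b = h 1
  c = h 0

  a≢0 : a ≢ + 0
  a≢0 = subst (λ d → h d ≢ + 0) deg≡2 A≢0

  -- Evaluate at 0 and at 1.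
  product≈ : intᶜ a *ᶜ (γ *ᶜ γ₂) ≈ intᶜ c
  product≈ = ≈-sym (≈-trans (solveᶜ 2 (λ c x → c :=ᶜ c :+ᶜ conᶜ (+ 0) :*ᶜ x) ≈-refl (intᶜ c) (evalF 2 (h ∘ suc) 0ᶜ))
    (≈-trans (factored 0ᶜ) (solveᶜ 3 (λ a x y → a :*ᶜ ((conᶜ (+ 0) :+ᶜ :-ᶜ x) :*ᶜ (conᶜ (+ 0) :+ᶜ :-ᶜ y)) :=ᶜ a :*ᶜ (x :*ᶜ y)) ≈-refl (intᶜ a) γ γ₂)))

  sum≈ : intᶜ a *ᶜ (γ +ᶜ γ₂) ≈ intᶜ (-ᶻ b)
  sum≈ = ≈-trans (solveᶜ 4 (λ a c x y → a :*ᶜ (x :+ᶜ y) :=ᶜ (a :+ᶜ a :*ᶜ (x :*ᶜ y)) :+ᶜ :-ᶜ (a :*ᶜ ((conᶜ (+ 1) :+ᶜ :-ᶜ x) :*ᶜ (conᶜ (+ 1) :+ᶜ :-ᶜ y)))) ≈-refl (intᶜ a) (intᶜ c) γ γ₂)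
    (≈-trans (+ᶜ-cong (+ᶜ-cong ≈-refl product≈) (-ᶜ-cong (≈-sym (factored 1ᶜ))))
    (≈-trans (solveᶜ 3 (λ a b c → a :+ᶜ c :+ᶜ :-ᶜ (c :+ᶜ conᶜ (+ 1) :*ᶜ (b :+ᶜ conᶜ (+ 1) :*ᶜ (a :+ᶜ conᶜ (+ 1) :*ᶜ conᶜ (+ 0)))) :=ᶜ :-ᶜ b) ≈-refl (intᶜ a) (intᶜ b) (intᶜ c))
      (≈-sym (intᶜ-neg b))))

  vanishing₂ : evalF 3 h γ ≈ 0ᶜ
  vanishing₂ = ≈-trans (factored γ) (solveᶜ 3 (λ a x y → a :*ᶜ ((x :+ᶜ :-ᶜ x) :*ᶜ y) :=ᶜ conᶜ (+ 0)) ≈-refl (intᶜ a) γ (γ +ᶜ -ᶜ γ₂))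

  irrational : ∀ q → Bounded 2 q → evalF 2 q γ ≈ 0ᶜ → ∀ i → q i ≡ + 0
  irrational q bq e = minimality q bq e (ℕ.≤-reflexive (sym deg≡2))

  -- Otherwise γ (a γ + b) = 0, and γ would be zero or rational.
  c≢0 : c ≢ + 0
  c≢0 c≡0 = *ᶜ-domain {γ} {evalF 2 (h ∘ suc) γ}
    (≈-trans (solveᶜ 1 (λ x → x :=ᶜ conᶜ (+ 0) :+ᶜ x) ≈-refl (γ *ᶜ evalF 2 (h ∘ suc) γ))
      (≈-trans (+ᶜ-cong (≡⇒≈ (cong intᶜ (sym c≡0))) ≈-refl) vanishing₂))
    [ γ≉0 , (λ e → a≢0 (irrational (h ∘ suc) (Bounded-suc (subst (λ d → Bounded (suc d) h) deg≡2 h-Bounded)) e 1)) ]′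

  coprime : Quadratic.Coprime₃ a b c
  coprime {p} pr p∣a p∣b p∣c = h-primitive pr all
    where
    all : ∀ i → + p ∣ᶻ h i
    all zero                = p∣c
    all (suc zero)          = p∣b
    all (suc (suc zero))    = p∣a
    all (suc (suc (suc i))) = ∣-zero (h-Bounded (3 ℕ.+ i) (ℕ.≤-trans (s≤s (ℕ.≤-reflexive deg≡2)) (s≤s (s≤s (s≤s z≤n)))))

  conj-root : ¬ ¬ (conj γ ≈ γ ⊎ conj γ ≈ γ₂)
  conj-root k = *ᶜ-domain (intᶜ-cancelˡ a≢0 (≈-trans (≈-sym (factored (conj γ)))
      (≈-trans (conj-evalF 3 h γ) (≈-trans (conj-cong vanishing₂) (conj-realᶜ 0ʳ)))))
    λ { (inj₁ e) → k (inj₁ (z-w≈0⇒z≈w e)) ; (inj₂ e) → k (inj₂ (z-w≈0⇒z≈w e)) }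

  binomial-root : ∀ X Y K → intᶜ X *ᶜ γ ^ᶜ K ≈ intᶜ Y → intᶜ X *ᶜ γ₂ ^ᶜ K ≈ intᶜ Y
  binomial-root X Y K e = z-w≈0⇒z≈w (≈-trans (≈-sym (value γ₂)) (conjugate-root (suc K) P P-Bounded
      (≈-trans (value γ) (≈-trans (+ᶜ-cong e ≈-refl) (solveᶜ 1 (λ y → y :+ᶜ :-ᶜ y :=ᶜ conᶜ (+ 0)) ≈-refl (intᶜ Y)))) γ₂ root₂))
    where
    N = suc K ℕ.+ degree f
    K<N : K ℕ.< N
    K<N = ℕ.m≤m+n (suc K) (degree f)
    P : ℕ → ℤ
    P i = mono K X i +ᶻ mono 0 (-ᶻ Y) i
    P-Bounded : Bounded N P
    P-Bounded i N≤i = cong₂ _+ᶻ_ (mono-Bounded {N} K X K<N i N≤i) (mono-Bounded {N} 0 (-ᶻ Y) (s≤s z≤n) i N≤i)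
    value : ∀ z → evalF N P z ≈ intᶜ X *ᶜ z ^ᶜ K +ᶜ -ᶜ intᶜ Y
    value z = ≈-trans (evalF-+ N (mono K X) (mono 0 (-ᶻ Y)) z) (+ᶜ-cong (evalF-mono K X K<N z)
      (≈-trans (evalF-mono {N} 0 (-ᶻ Y) (s≤s z≤n) z) (≈-trans (solveᶜ 1 (λ y → y :*ᶜ conᶜ (+ 1) :=ᶜ y) ≈-refl (intᶜ (-ᶻ Y))) (intᶜ-neg Y))))

  -- If the complex conjugate of γ is γ₂, the moduli agree outright. Otherwise γ is real and γ² =
  -- |γ|², so a rational |γ|^K makes γ^(2K) rational; the resulting binomial also vanishes at γ₂,
  -- and comparing absolute values gives |γ₂| = |γ|. Doubling the exponent disposes of the sign of
  -- γ.
  symmetric : RationalPowerSymmetric (modulus γ) (modulus γ₂)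
  symmetric X Y k X≢0 e = ≈ᴿ-stable λ ¬eq → conj-root
    λ { (inj₂ conjγ≈γ₂) → ¬eq (≈ᴿ-trans (≈ᴿ-sym (modulus-conj γ)) (modulus-cong conjγ≈γ₂))
      ; (inj₁ conjγ≈γ) → ¬eq (real-case conjγ≈γ) }
    where
    K = suc k
    ρ₁ = modulus γ
    ρ₂ = modulus γ₂
    X² = + (X ℕ.* X)
    Y² = + (Y ℕ.* Y)
    e² : natʳ (X ℕ.* X) *ʳ ρ₁ ^ʳ (K ℕ.+ K) ≈ᴿ natʳ (Y ℕ.* Y)
    e² = ≈ᴿ-trans (*ʳ-cong (natʳ-* X X) (^ʳ-+ ρ₁ K K)) (≈ᴿ-trans
      (solveʳ 2 (λ x p → x :*ʳ x :*ʳ (p :*ʳ p) :=ʳ x :*ʳ p :*ʳ (x :*ʳ p)) ≈ᴿ-refl (natʳ X) (ρ₁ ^ʳ K))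
      (≈ᴿ-trans (*ʳ-cong e e) (≈ᴿ-sym (natʳ-* Y Y))))
    real-case : conj γ ≈ γ → ρ₁ ≈ᴿ ρ₂
    real-case conjγ≈γ = ^ʳ-injective (k ℕ.+ K) (modulus-nonneg γ) (modulus-nonneg γ₂)
        (cancel (X ℕ.* X) (m*n≢0 X X X≢0 X≢0) (≈ᴿ-trans e² (≈ᴿ-sym e₂)))
      where
      γ^2K : γ ^ᶜ (K ℕ.+ K) ≈ realᶜ (ρ₁ ^ʳ (K ℕ.+ K))
      γ^2K = ≈-trans (^ᶜ-+ γ K K) (≈-trans (≈-sym (^ᶜ-* γ γ K)) (≈-trans (^ᶜ-cong K (conj-fixed⇒square conjγ≈γ))
        (≈-trans (≈-sym (realᶜ-^ (ρ₁ *ʳ ρ₁) K)) (realᶜ-cong (≈ᴿ-trans (^ʳ-* ρ₁ ρ₁ K) (≈ᴿ-sym (^ʳ-+ ρ₁ K K)))))))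
      root : intᶜ X² *ᶜ γ₂ ^ᶜ (K ℕ.+ K) ≈ intᶜ Y²
      root = binomial-root X² Y² (K ℕ.+ K) (≈-trans (*ᶜ-cong ≈-refl γ^2K) (≈-trans (≈-sym (realᶜ-* (natʳ (X ℕ.* X)) (ρ₁ ^ʳ (K ℕ.+ K)))) (realᶜ-cong e²)))
      e₂ : natʳ (X ℕ.* X) *ʳ ρ₂ ^ʳ (K ℕ.+ K) ≈ᴿ natʳ (Y ℕ.* Y)
      e₂ = ≈ᴿ-trans (*ʳ-cong (≈ᴿ-sym (modulus-intᶜ X²)) (≈ᴿ-sym (modulus-^ γ₂ (K ℕ.+ K))))
        (≈ᴿ-trans (≈ᴿ-sym (modulus-* (intᶜ X²) (γ₂ ^ᶜ (K ℕ.+ K)))) (≈ᴿ-trans (modulus-cong root) (modulus-intᶜ Y²)))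
      cancel : ∀ {x y} n → n ≢ 0 → natʳ n *ʳ x ≈ᴿ natʳ n *ʳ y → x ≈ᴿ y
      cancel {x} {y} n n≢0 h = realᶜ-injective (z-w≈0⇒z≈w (intᶜ-cancelˡ {+ n} (n≢0 ∘ ℤ.+-injective)
        (≈-trans (solveᶜ 3 (λ n x y → n :*ᶜ (x :+ᶜ :-ᶜ y) :=ᶜ n :*ᶜ x :+ᶜ :-ᶜ (n :*ᶜ y)) ≈-refl (intᶜ (+ n)) (realᶜ x) (realᶜ y))
        (≈-trans (+ᶜ-cong (≈-trans (≈-sym (realᶜ-* (natʳ n) x)) (≈-trans (realᶜ-cong h) (realᶜ-* (natʳ n) y))) ≈-refl)
          (solveᶜ 1 (λ x → x :+ᶜ :-ᶜ x :=ᶜ conᶜ (+ 0)) ≈-refl (intᶜ (+ n) *ᶜ realᶜ y))))))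

  M-≤ : ∀ {β} (F : MinimalPolynomial β) m → β ^ᶜ suc m ≈ γ ^ᶜ suc m → 2 ℕ.≤ degree F → M f ≤ᴿ M F
  M-≤ F m eq 2≤deg = ≤ᴿ-respˡ (≈ᴿ-sym M≈) (RotatedConjugates.M-bound a b c γ γ₂ sum≈ product≈ a≢0 c≢0 coprime symmetric F m eq 2≤deg)

-- Quadratic numbers with a rational power

ratᶜ-* : ∀ p q → ratᶜ (p *ᵠ q) ≈ ratᶜ p *ᶜ ratᶜ q
ratᶜ-* p q = ≈-trans (realᶜ-cong (ratʳ-* p q)) (realᶜ-* (ratʳ p) (ratʳ q))

ratᶜ-neg : ∀ p → ratᶜ (-ᵠ p) ≈ -ᶜ ratᶜ p
ratᶜ-neg p = ≈-trans (realᶜ-cong (ratʳ-neg p)) (realᶜ-neg (ratʳ p))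

intᶜ≡ratᶜ : ∀ n → intᶜ n ≡ ratᶜ (intᵠ n)
intᶜ≡ratᶜ n = cong realᶜ (intʳ≡ratʳ n)

ratᶜ-1 : ratᶜ 1ℚ ≡ 1ᶜ
ratᶜ-1 = sym (intᶜ≡ratᶜ (+ 1))

ratᶜ-0 : ratᶜ 0ℚ ≡ 0ᶜ
ratᶜ-0 = sym (intᶜ≡ratᶜ (+ 0))

ratᶜ-cancelˡ : ∀ {p q} → p *ᵠ q ≡ 1ℚ → ∀ z → ratᶜ p *ᶜ (ratᶜ q *ᶜ z) ≈ z
ratᶜ-cancelˡ {p} {q} e z = ≈-trans (≈-sym (*ᶜ-assoc (ratᶜ p) (ratᶜ q) z))
  (≈-trans (*ᶜ-cong (≈-trans (≈-sym (ratᶜ-* p q)) (≡⇒≈ (trans (cong ratᶜ e) ratᶜ-1))) ≈-refl) (*ᶜ-identityˡ z))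

reciprocal : ∀ q → q ≢ 0ℚ → ∃[ s ] s *ᵠ q ≡ 1ℚ
reciprocal q q≢0 = (ℚ.1/ q) {{ℚ.≢-nonZero q≢0}} , ℚ.*-inverseˡ q {{ℚ.≢-nonZero q≢0}}

fraction : ∀ q → intᵠ (↧ q) *ᵠ q ≡ intᵠ (↥ q)
fraction q@record{} = ℚ.toℚᵘ-injective (ℚᵘ.≃-trans (ℚ.toℚᵘ-homo-* (intᵠ (↧ q)) q)
  (ℚᵘ.≃-trans (ℚᵘ.*-congʳ {toℚᵘ q} (toℚᵘ-intᵠ (↧ q)))
    (ℚᵘ.≃-trans (ℚᵘ.*≡* (trans (ℤ.*-identityʳ _) (trans (ℤ.*-comm (↧ q) (↥ q)) (cong (↥ q *ᶻ_) (sym (ℤ.*-identityˡ (↧ q)))))))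
      (ℚᵘ.≃-sym (toℚᵘ-intᵠ (↥ q))))))

fraction≈ : ∀ q → intᶜ (↧ q) *ᶜ ratᶜ q ≈ intᶜ (↥ q)
fraction≈ q = ≈-trans (*ᶜ-cong (≡⇒≈ (intᶜ≡ratᶜ (↧ q))) ≈-refl) (≈-trans (≈-sym (ratᶜ-* (intᵠ (↧ q)) q))
  (≡⇒≈ (trans (cong ratᶜ (fraction q)) (sym (intᶜ≡ratᶜ (↥ q))))))

1ᶜ^ : ∀ n → 1ᶜ ^ᶜ n ≈ 1ᶜ
1ᶜ^ zero    = ≈-refl
1ᶜ^ (suc n) = ≈-trans (*ᶜ-identityˡ (1ᶜ ^ᶜ n)) (1ᶜ^ n)

conj-^ : ∀ z n → conj (z ^ᶜ n) ≈ conj z ^ᶜ n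
conj-^ z zero    = conj-realᶜ 1ʳ
conj-^ z (suc n) = ≈-trans (conj-* z (z ^ᶜ n)) (*ᶜ-cong ≈-refl (conj-^ z n))

linear-polynomial : ∀ q {z} → z ≈ ratᶜ q → ∃[ P ] Bounded 2 P × P 1 ≢ + 0 × evalF 2 P z ≈ 0ᶜ
-- Matching on `q` exposes its denominator as a successor, which shows the leading coefficient to be
-- non-zero.
linear-polynomial q@record{} {z} e = P , P-Bounded , (λ ()) , ≈-trans (+ᶜ-cong (intᶜ-neg (↥ q)) ≈-refl)
    (≈-trans (solveᶜ 3 (λ n d z → :-ᶜ n :+ᶜ z :*ᶜ (d :+ᶜ z :*ᶜ conᶜ (+ 0)) :=ᶜ :-ᶜ n :+ᶜ d :*ᶜ z) ≈-refl (intᶜ (↥ q)) (intᶜ (↧ q)) z)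
      (≈-trans (+ᶜ-cong ≈-refl (≈-trans (*ᶜ-cong ≈-refl e) (fraction≈ q))) (solveᶜ 1 (λ n → :-ᶜ n :+ᶜ n :=ᶜ conᶜ (+ 0)) ≈-refl (intᶜ (↥ q)))))
  where
  P : ℕ → ℤ
  P zero          = -ᶻ (↥ q)
  P (suc zero)    = ↧ q
  P (suc (suc _)) = + 0
  P-Bounded : Bounded 2 P
  P-Bounded (suc (suc _)) _ = refl
  P-Bounded (suc zero) (s≤s ())

opaque
  unfolding _+ᶜ_

  √-3 : ℂ
  √-3 = 0ʳ +i (√ʳ intʳ (+ 3))

  √-3-square : √-3 *ᶜ √-3 ≈ intᶜ -[1+ 2 ]
  √-3-square = ≈ᴿ-trans (+ʳ-cong ≈ᴿ-refl (-ʳ-cong (√-square (intʳ-mono {+ 0} {+ 3} (ℤ.+≤+ z≤n)))))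
      (solveʳ 0 (conʳ (+ 0) :*ʳ conʳ (+ 0) :+ʳ :-ʳ conʳ (+ 3) :=ʳ conʳ -[1+ 2 ]) ≈ᴿ-refl)
    ,≈ solveʳ 1 (λ s → conʳ (+ 0) :*ʳ s :+ʳ s :*ʳ conʳ (+ 0) :=ʳ conʳ (+ 0)) ≈ᴿ-refl (√ʳ intʳ (+ 3))

  iᶜ-square : iᶜ *ᶜ iᶜ ≈ intᶜ -[1+ 0 ]
  iᶜ-square = solveʳ 0 (conʳ (+ 0) :*ʳ conʳ (+ 0) :+ʳ :-ʳ (conʳ (+ 1) :*ʳ conʳ (+ 1)) :=ʳ conʳ -[1+ 0 ]) ≈ᴿ-refl
    ,≈ solveʳ 0 (conʳ (+ 0) :*ʳ conʳ (+ 1) :+ʳ conʳ (+ 1) :*ʳ conʳ (+ 0) :=ʳ conʳ (+ 0)) ≈ᴿ-refl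

  i√3≡√-3 : i√3 ≡ √-3
  i√3≡√-3 = cong₂ _+i_ (trans (fromℚ≡ratʳ 0ℚ) ratʳ-0)
    (trans (√ᴿ≡√ʳ (fromℚ (+ 3 ℚ./ 1))) (cong √ʳ_ (trans (fromℚ≡ratʳ (+ 3 ℚ./ 1)) (sym (intʳ≡ratʳ (+ 3))))))

-- The non-real rational multiples of roots of unity of degree 2. The condition x = ±y singles out x
-- (1 ± √-3), the rational multiples of primitive third and sixth roots of unity.
data RationalTimesRootOfUnity (γ : ℂ) : Set where
  gaussian   : ∀ y → y ≢ 0ℚ → γ ≈ ratᶜ y *ᶜ iᶜ → RationalTimesRootOfUnity γ
  eisenstein : ∀ x y → x ≢ 0ℚ → x ≡ y ⊎ x ≡ -ᵠ y → γ ≈ ratᶜ x +ᶜ ratᶜ y *ᶜ √-3 → RationalTimesRootOfUnity γ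

module RationalRadical {γ : ℂ} (γ≉0 : ¬ (γ ≈ 0ᶜ)) (f : MinimalPolynomial γ) (deg≡2 : degree f ≡ 2) (rs : Roots f)
  (r s : ℚ) (sr≡1 : s *ᵠ r ≡ 1ℚ) (m : ℕ) (γⁿ≈rⁿ : γ ^ᶜ suc m ≈ ratᶜ r ^ᶜ suc m) where

  open Degree₂ γ≉0 f deg≡2 rs
  open Roots rs using (γ₂)

  private
    n = suc m

    -- This is γ / r, because s is the inverse of r.
    ξ : ℂ
    ξ = ratᶜ s *ᶜ γ

    ξ̄ : ℂ
    ξ̄ = conj ξ

    rξ≈γ : ratᶜ r *ᶜ ξ ≈ γ
    rξ≈γ = ratᶜ-cancelˡ {r} {s} (trans (ℚ.*-comm r s) sr≡1) γ

    1≢0 : 1ℚ ≢ 0ℚ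
    1≢0 ()

    r≢0 : r ≢ 0ℚ
    r≢0 r≡0 = 1≢0 (trans (sym sr≡1) (trans (cong (s *ᵠ_) r≡0) (ℚ.*-zeroʳ s)))

    ξⁿ≈1 : ξ ^ᶜ n ≈ 1ᶜ
    ξⁿ≈1 = ≈-trans (^ᶜ-* (ratᶜ s) γ n) (≈-trans (*ᶜ-cong ≈-refl γⁿ≈rⁿ) (≈-trans (≈-sym (^ᶜ-* (ratᶜ s) (ratᶜ r) n))
      (≈-trans (^ᶜ-cong n (≈-trans (≈-sym (ratᶜ-* s r)) (≡⇒≈ (trans (cong ratᶜ sr≡1) ratᶜ-1)))) (1ᶜ^ n))))

    modulus-ξ : modulus ξ ≈ᴿ 1ʳ
    modulus-ξ = ≈ᴿ-trans (modulus-root m (≈-trans ξⁿ≈1 (≈-sym (1ᶜ^ n)))) modulus-1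

    normSq-ξ : normSq ξ ≈ᴿ 1ʳ
    normSq-ξ = ≈ᴿ-trans (≈ᴿ-sym (modulus-square ξ)) (≈ᴿ-trans (*ʳ-cong modulus-ξ modulus-ξ) (*ʳ-identityˡ 1ʳ))

    ξξ̄≈1 : ξ *ᶜ ξ̄ ≈ 1ᶜ
    ξξ̄≈1 = ≈-trans (*ᶜ-conj ξ) (realᶜ-cong normSq-ξ)

    ξ̄≈ : ∀ {z} → conj γ ≈ z → ξ̄ ≈ ratᶜ s *ᶜ z
    ξ̄≈ e = ≈-trans (conj-* (ratᶜ s) γ) (*ᶜ-cong (conj-realᶜ (ratʳ s)) e)

    not-rational : ∀ q → ¬ (γ ≈ ratᶜ q)
    not-rational q e = let (P , bP , P₁≢0 , eP) = linear-polynomial q e in P₁≢0 (irrational P bP eP 1)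

    -- ξ = ±1 would make γ rational.
    ξ²≉1 : ¬ (ξ *ᶜ ξ ≈ 1ᶜ)
    ξ²≉1 e = *ᶜ-domain {ξ +ᶜ -ᶜ 1ᶜ} {ξ +ᶜ 1ᶜ}
      (≈-trans (solveᶜ 1 (λ x → (x :+ᶜ :-ᶜ conᶜ (+ 1)) :*ᶜ (x :+ᶜ conᶜ (+ 1)) :=ᶜ x :*ᶜ x :+ᶜ :-ᶜ conᶜ (+ 1)) ≈-refl ξ)
        (≈-trans (+ᶜ-cong e ≈-refl) (solveᶜ 0 (conᶜ (+ 1) :+ᶜ :-ᶜ conᶜ (+ 1) :=ᶜ conᶜ (+ 0)) ≈-refl)))
      λ { (inj₁ h) → not-rational r (≈-trans (≈-sym rξ≈γ) (≈-trans (*ᶜ-cong ≈-refl (z-w≈0⇒z≈w h)) (solveᶜ 1 (λ r → r :*ᶜ conᶜ (+ 1) :=ᶜ r) ≈-refl (ratᶜ r))))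
        ; (inj₂ h) → not-rational (-ᵠ r) (≈-trans (≈-sym rξ≈γ) (≈-trans (solveᶜ 2 (λ r x → r :*ᶜ x :=ᶜ r :*ᶜ (x :+ᶜ conᶜ (+ 1)) :+ᶜ :-ᶜ r) ≈-refl (ratᶜ r) ξ)
            (≈-trans (+ᶜ-cong (*ᶜ-cong ≈-refl h) ≈-refl) (≈-trans (solveᶜ 1 (λ r → r :*ᶜ conᶜ (+ 0) :+ᶜ :-ᶜ r :=ᶜ :-ᶜ r) ≈-refl (ratᶜ r)) (≈-sym (ratᶜ-neg r)))))) }

    -- The trace of ξ is p / q in lowest terms, and q = ±1 because qⁿ (ξⁿ + ξ̄ⁿ) = 2 qⁿ
    -- is congruent to pⁿ modulo q.
    integral-trace : ∀ p q → q ≢ + 0 → (∀ {ℓ} → Prime ℓ → + ℓ ∣ᶻ p → + ℓ ∣ᶻ q → ⊥) → intᶜ q *ᶜ (ξ +ᶜ ξ̄) ≈ intᶜ p → ℤ.∣ q ∣ ≡ 1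
    integral-trace p q q≢0 cop e = decide (ℤ.∣ q ∣ ℕ.≟ 1)
      where
      -- As ξ ξ̄ = 1, the numbers ξ and ξ̄ are the roots of q X² - p X + q.
      open QuadraticRoots q (-ᶻ p) q ξ ξ̄ (≈-trans e (≡⇒≈ (cong intᶜ (sym (ℤ.neg-involutive p)))))
        (≈-trans (*ᶜ-cong ≈-refl ξξ̄≈1) (solveᶜ 1 (λ q → q :*ᶜ conᶜ (+ 1) :=ᶜ q) ≈-refl (intᶜ q)))
      open Quadratic q (-ᶻ p) q using (powerSum; powerSum-mod; prime-∣-^ᶻ)
      ξ̄ⁿ≈1 : ξ̄ ^ᶜ n ≈ 1ᶜ
      ξ̄ⁿ≈1 = ≈-trans (≈-sym (conj-^ ξ n)) (≈-trans (conj-cong ξⁿ≈1) (conj-realᶜ 1ʳ))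
      powerSum≡ : powerSum n ≡ + 2 *ᶻ q ^ᶻ n
      powerSum≡ = intᶜ-injective (≈-trans (powerSum≈ n) (≈-trans (*ᶜ-cong (≈-sym (intᶜ-^ q n)) (+ᶜ-cong ξⁿ≈1 ξ̄ⁿ≈1))
        (≈-trans (solveᶜ 1 (λ x → x :*ᶜ (conᶜ (+ 1) :+ᶜ conᶜ (+ 1)) :=ᶜ conᶜ (+ 2) :*ᶜ x) ≈-refl (intᶜ (q ^ᶻ n))) (≈-sym (intᶜ-* (+ 2) (q ^ᶻ n))))))
      decide : Dec (ℤ.∣ q ∣ ≡ 1) → ℤ.∣ q ∣ ≡ 1
      decide (yes e) = e
      decide (no ≢1) = let (ℓ , pr , ℓ∣) = prime-divisor (q≢0 ∘ ℤ.∣i∣≡0⇒i≡0) ≢1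
                           ℓ∣q = ℤ.∣ᵤ⇒∣ {+ ℓ} {q} ℓ∣
                           (t , e) = powerSum-mod m
                           ℓ∣s = subst (+ ℓ ∣ᶻ_) (sym powerSum≡) (ℤ.∣n⇒∣m*n (+ 2) (ℤ.∣m⇒∣m*n (q ^ᶻ m) ℓ∣q))
                           ℓ∣pⁿ = ℤ.∣m+n∣n⇒∣m (subst (+ ℓ ∣ᶻ_) e ℓ∣s) (ℤ.∣m⇒∣m*n t (ℤ.∣m⇒∣m*n q ℓ∣q))
                       in ⊥-elim (cop pr (subst (+ ℓ ∣ᶻ_) (ℤ.neg-involutive p) (prime-∣-^ᶻ pr (-ᶻ (-ᶻ p)) n ℓ∣pⁿ)) ℓ∣q)

    reduced : ∀ P Q → Q ≢ + 0 → intᶜ Q *ᶜ (ξ +ᶜ ξ̄) ≈ intᶜ P → ∃[ τ ] ξ +ᶜ ξ̄ ≈ intᶜ τ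
    -- A denominator q = ±1 is its own inverse, so the trace p / q equals q p.
    reduced P Q Q≢0 e = q *ᶻ p , rescale (unit (integral-trace p q q≢0 coprime′ qt≈p))
      where
      g = ℕ.gcd ℤ.∣ P ∣ ℤ.∣ Q ∣
      g∣P : + g ∣ᶻ P
      g∣P = ℤ.∣ᵤ⇒∣ (ℕ.gcd[m,n]∣m ℤ.∣ P ∣ ℤ.∣ Q ∣)
      g∣Q : + g ∣ᶻ Q
      g∣Q = ℤ.∣ᵤ⇒∣ (ℕ.gcd[m,n]∣n ℤ.∣ P ∣ ℤ.∣ Q ∣)
      p = ℤ._∣_.quotient g∣P
      q = ℤ._∣_.quotient g∣Q
      P≡ : P ≡ + g *ᶻ p
      P≡ = trans (ℤ._∣_.equality g∣P) (ℤ.*-comm p (+ g))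
      Q≡ : Q ≡ + g *ᶻ q
      Q≡ = trans (ℤ._∣_.equality g∣Q) (ℤ.*-comm q (+ g))
      g≢0 : + g ≢ + 0
      g≢0 g≡0 = Q≢0 (trans Q≡ (cong (_*ᶻ q) g≡0))
      q≢0 : q ≢ + 0
      q≢0 q≡0 = Q≢0 (trans Q≡ (trans (cong (+ g *ᶻ_) q≡0) (ℤ.*-zeroʳ (+ g))))
      qt≈p : intᶜ q *ᶜ (ξ +ᶜ ξ̄) ≈ intᶜ p
      qt≈p = z-w≈0⇒z≈w (intᶜ-cancelˡ g≢0 (≈-trans
        (solveᶜ 4 (λ g q t p → g :*ᶜ (q :*ᶜ t :+ᶜ :-ᶜ p) :=ᶜ g :*ᶜ q :*ᶜ t :+ᶜ :-ᶜ (g :*ᶜ p)) ≈-refl (intᶜ (+ g)) (intᶜ q) (ξ +ᶜ ξ̄) (intᶜ p))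
        (≈-trans (+ᶜ-cong (≈-trans (*ᶜ-cong (≈-trans (≈-sym (intᶜ-* (+ g) q)) (≡⇒≈ (cong intᶜ (sym Q≡)))) ≈-refl) e)
            (-ᶜ-cong (≈-trans (≈-sym (intᶜ-* (+ g) p)) (≡⇒≈ (cong intᶜ (sym P≡))))))
          (solveᶜ 1 (λ p → p :+ᶜ :-ᶜ p :=ᶜ conᶜ (+ 0)) ≈-refl (intᶜ P)))))
      coprime′ : ∀ {ℓ} → Prime ℓ → + ℓ ∣ᶻ p → + ℓ ∣ᶻ q → ⊥
      coprime′ {ℓ} pr ℓ∣p ℓ∣q = ¬prime[1] (subst Prime (ℕ.∣1⇒≡1 (ℕ.*-cancelˡ-∣ g {{ℕ.≢-nonZero (g≢0 ∘ cong +_)}}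
        (subst (g ℕ.* ℓ ℕ.∣_) (sym (ℕ.*-identityʳ g)) (ℕ.gcd-greatest (lift P≡ ℓ∣p) (lift Q≡ ℓ∣q))))) pr)
        where
        lift : ∀ {X x} → X ≡ + g *ᶻ x → + ℓ ∣ᶻ x → g ℕ.* ℓ ℕ.∣ ℤ.∣ X ∣
        lift {X} {x} X≡ ℓ∣x = ℤ.∣⇒∣ᵤ {+ (g ℕ.* ℓ)} {X} (subst₂ _∣ᶻ_ (sym (ℤ.pos-* g ℓ)) (sym X≡) (ℤ.*-monoʳ-∣ (+ g) ℓ∣x))
      unit : ℤ.∣ q ∣ ≡ 1 → q *ᶻ q ≡ + 1
      unit e = trans (sym (∣∣*∣∣ q)) (cong (λ k → + k *ᶻ + k) e)
      rescale : q *ᶻ q ≡ + 1 → ξ +ᶜ ξ̄ ≈ intᶜ (q *ᶻ p)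
      rescale q²≡1 = ≈-trans (≈-sym (*ᶜ-identityˡ (ξ +ᶜ ξ̄))) (≈-trans (*ᶜ-cong (≈-trans (≡⇒≈ (cong intᶜ (sym q²≡1))) (intᶜ-* q q)) ≈-refl)
        (≈-trans (*ᶜ-assoc (intᶜ q) (intᶜ q) (ξ +ᶜ ξ̄)) (≈-trans (*ᶜ-cong ≈-refl qt≈p) (≈-sym (intᶜ-* q p)))))

    -- The trace is 2 Re ξ, and (Re ξ)² ≤ |ξ|² = 1. The extreme values ±2 are left to `trace-±2`.
    trace-bound : ∀ τ → ξ +ᶜ ξ̄ ≈ intᶜ τ → ℤ.∣ τ ∣ ℕ.≤ 2
    trace-bound τ e = square-cancel-≤ (ℤ.drop‿+≤+ (subst (ℤ._≤ + 4) (trans (sym (∣∣*∣∣ τ)) (sym (ℤ.pos-* ℤ.∣ τ ∣ ℤ.∣ τ ∣)))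
      (intʳ-cancel-≤ (≤ᴿ-respˡ (≈ᴿ-sym (≈ᴿ-trans (intʳ-* τ τ) (≈ᴿ-trans (*ʳ-cong (≈ᴿ-sym 2x≈τ) (≈ᴿ-sym 2x≈τ))
          (solveʳ 1 (λ x → (x :+ʳ x) :*ʳ (x :+ʳ x) :=ʳ conʳ (+ 4) :*ʳ (x :*ʳ x)) ≈ᴿ-refl x))))
        (≤ᴿ-respʳ (solveʳ 0 (conʳ (+ 4) :*ʳ conʳ (+ 1) :=ʳ conʳ (+ 4)) ≈ᴿ-refl)
          (*ʳ-monoʳ (intʳ (+ 4)) (natʳ-nonneg 4) (≤ᴿ-respʳ normSq-ξ
            (≤ᴿ-respˡ (solveʳ 1 (λ x → x :+ʳ conʳ (+ 0) :=ʳ x) ≈ᴿ-refl (x *ʳ x)) (+ʳ-mono ≤ᴿ-refl (square-nonneg (im ξ)))))))))))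
      where
      x = re ξ
      2x≈τ : x +ʳ x ≈ᴿ intʳ τ
      2x≈τ = ≈ᴿ-trans (≡⇒≈ᴿ (sym (trans (re-+ ξ ξ̄) (cong (x +ʳ_) (re-conj ξ))))) (≈ᴿ-trans (re≈ e) (≡⇒≈ᴿ (re-realᶜ (intʳ τ))))

    quadratic : ∀ τ → ξ +ᶜ ξ̄ ≈ intᶜ τ → ξ *ᶜ ξ +ᶜ -ᶜ (intᶜ τ *ᶜ ξ) ≈ intᶜ -[1+ 0 ]
    quadratic τ e = ≈-trans (+ᶜ-cong ≈-refl (-ᶜ-cong (*ᶜ-cong (≈-sym e) ≈-refl)))
      (≈-trans (solveᶜ 2 (λ x y → x :*ᶜ x :+ᶜ :-ᶜ ((x :+ᶜ y) :*ᶜ x) :=ᶜ :-ᶜ (x :*ᶜ y)) ≈-refl ξ ξ̄)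
        (≈-trans (-ᶜ-cong ξξ̄≈1) (solveᶜ 0 (:-ᶜ conᶜ (+ 1) :=ᶜ conᶜ -[1+ 0 ]) ≈-refl)))

    r-signed : ∀ y → γ ≈ ratᶜ r *ᶜ (-ᶜ y) → γ ≈ ratᶜ (-ᵠ r) *ᶜ y
    r-signed y e = ≈-trans e (≈-trans (solveᶜ 2 (λ r y → r :*ᶜ (:-ᶜ y) :=ᶜ (:-ᶜ r) :*ᶜ y) ≈-refl (ratᶜ r) y) (*ᶜ-cong (≈-sym (ratᶜ-neg r)) ≈-refl))

    -r≢0 : -ᵠ r ≢ 0ℚ
    -r≢0 e = r≢0 (ℚ.neg-injective e)

    trace-0 : ξ *ᶜ ξ +ᶜ -ᶜ (intᶜ (+ 0) *ᶜ ξ) ≈ intᶜ -[1+ 0 ] → ¬ ¬ RationalTimesRootOfUnity γ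
    trace-0 e k = *ᶜ-domain {ξ +ᶜ -ᶜ iᶜ} {ξ +ᶜ iᶜ}
      (≈-trans (solveᶜ 2 (λ x i → (x :+ᶜ :-ᶜ i) :*ᶜ (x :+ᶜ i) :=ᶜ x :*ᶜ x :+ᶜ :-ᶜ (conᶜ (+ 0) :*ᶜ x) :+ᶜ :-ᶜ (i :*ᶜ i)) ≈-refl ξ iᶜ)
        (≈-trans (+ᶜ-cong e (-ᶜ-cong iᶜ-square)) (solveᶜ 0 (conᶜ -[1+ 0 ] :+ᶜ :-ᶜ conᶜ -[1+ 0 ] :=ᶜ conᶜ (+ 0)) ≈-refl)))
      λ { (inj₁ h) → k (gaussian r r≢0 (≈-trans (≈-sym rξ≈γ) (*ᶜ-cong ≈-refl (z-w≈0⇒z≈w h))))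
        ; (inj₂ h) → k (gaussian (-ᵠ r) -r≢0 (r-signed iᶜ (≈-trans (≈-sym rξ≈γ) (*ᶜ-cong ≈-refl
            (z-w≈0⇒z≈w (≈-trans (solveᶜ 2 (λ x i → x :+ᶜ :-ᶜ (:-ᶜ i) :=ᶜ x :+ᶜ i) ≈-refl ξ iᶜ) h)))))) }

    ½r = r *ᵠ ½

    ½r≢0 : ½r ≢ 0ℚ
    ½r≢0 e = r≢0 (trans (solveᵠ 1 (λ r → r :=ᵠ r :*ᵠ conᵠ ½ :+ᵠ r :*ᵠ conᵠ ½) refl r)
      (cong (λ x → x +ᵠ x) e))

    half : ∀ x y → intᶜ (+ 2) *ᶜ ξ ≈ intᶜ x +ᶜ intᶜ y *ᶜ √-3 → γ ≈ ratᶜ (½r *ᵠ intᵠ x) +ᶜ ratᶜ (½r *ᵠ intᵠ y) *ᶜ √-3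
    half x y e = ≈-trans (≈-sym rξ≈γ) (≈-trans (*ᶜ-cong ≈-refl ξ≈)
      (≈-trans (solveᶜ 5 (λ r h x y w → r :*ᶜ (h :*ᶜ (x :+ᶜ y :*ᶜ w)) :=ᶜ r :*ᶜ h :*ᶜ x :+ᶜ r :*ᶜ h :*ᶜ y :*ᶜ w) ≈-refl (ratᶜ r) (ratᶜ ½) (intᶜ x) (intᶜ y) √-3)
        (+ᶜ-cong (scaled x) (*ᶜ-cong (scaled y) ≈-refl))))
      where
      ξ≈ : ξ ≈ ratᶜ ½ *ᶜ (intᶜ x +ᶜ intᶜ y *ᶜ √-3)
      ξ≈ = ≈-trans (≈-sym (ratᶜ-cancelˡ {½} {intᵠ (+ 2)} refl ξ)) (*ᶜ-cong ≈-refl (≈-trans (*ᶜ-cong (≡⇒≈ (sym (intᶜ≡ratᶜ (+ 2)))) ≈-refl) e))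
      scaled : ∀ x → ratᶜ r *ᶜ ratᶜ ½ *ᶜ intᶜ x ≈ ratᶜ (½r *ᵠ intᵠ x)
      scaled x = ≈-trans (*ᶜ-cong (≈-sym (ratᶜ-* r ½)) (≡⇒≈ (intᶜ≡ratᶜ x))) (≈-sym (ratᶜ-* ½r (intᵠ x)))

    *1≢0 : ½r *ᵠ intᵠ (+ 1) ≢ 0ℚ
    *1≢0 e = ½r≢0 (trans (sym (ℚ.*-identityʳ ½r)) e)

    *-1≡ : ½r *ᵠ intᵠ -[1+ 0 ] ≡ -ᵠ (½r *ᵠ intᵠ (+ 1))
    *-1≡ = sym (ℚ.neg-distribʳ-* ½r (intᵠ (+ 1)))

    *-1≢0 : ½r *ᵠ intᵠ -[1+ 0 ] ≢ 0ℚ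
    *-1≢0 e = *1≢0 (ℚ.neg-injective (trans (sym *-1≡) e))

    -- Completing the square gives (2 ξ - τ)² = -4 + 1 = -3. Working with 2 ξ keeps every constant
    -- of the ring identities in ℤ.
    trace-±1 : ∀ τ → τ *ᶻ τ ≡ + 1 → ξ *ᶜ ξ +ᶜ -ᶜ (intᶜ τ *ᶜ ξ) ≈ intᶜ -[1+ 0 ] →
      ¬ ¬ (intᶜ (+ 2) *ᶜ ξ ≈ intᶜ τ +ᶜ intᶜ (+ 1) *ᶜ √-3 ⊎ intᶜ (+ 2) *ᶜ ξ ≈ intᶜ τ +ᶜ intᶜ -[1+ 0 ] *ᶜ √-3)
    trace-±1 τ τ²≡1 e k = *ᶜ-domain {intᶜ (+ 2) *ᶜ ξ +ᶜ -ᶜ (intᶜ τ +ᶜ intᶜ (+ 1) *ᶜ √-3)} {intᶜ (+ 2) *ᶜ ξ +ᶜ -ᶜ (intᶜ τ +ᶜ intᶜ -[1+ 0 ] *ᶜ √-3)}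
      (≈-trans (solveᶜ 3 (λ x t w →
          (conᶜ (+ 2) :*ᶜ x :+ᶜ :-ᶜ (t :+ᶜ conᶜ (+ 1) :*ᶜ w)) :*ᶜ (conᶜ (+ 2) :*ᶜ x :+ᶜ :-ᶜ (t :+ᶜ conᶜ -[1+ 0 ] :*ᶜ w))
          :=ᶜ conᶜ (+ 4) :*ᶜ (x :*ᶜ x :+ᶜ :-ᶜ (t :*ᶜ x)) :+ᶜ (t :*ᶜ t :+ᶜ :-ᶜ (w :*ᶜ w))) ≈-refl ξ (intᶜ τ) √-3)
        (≈-trans (+ᶜ-cong (*ᶜ-cong ≈-refl e) (+ᶜ-cong (≈-trans (≈-sym (intᶜ-* τ τ)) (≡⇒≈ (cong intᶜ τ²≡1))) (-ᶜ-cong √-3-square)))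
          (solveᶜ 0 (conᶜ (+ 4) :*ᶜ conᶜ -[1+ 0 ] :+ᶜ (conᶜ (+ 1) :+ᶜ :-ᶜ conᶜ -[1+ 2 ]) :=ᶜ conᶜ (+ 0)) ≈-refl)))
      [ k ∘ inj₁ ∘ z-w≈0⇒z≈w , k ∘ inj₂ ∘ z-w≈0⇒z≈w ]′

    -- The discriminant vanishes, so ξ = τ / 2 = ±1, which `ξ²≉1` rules out.
    trace-±2 : ∀ τ → τ *ᶻ τ ≡ + 4 → ξ *ᶜ ξ +ᶜ -ᶜ (intᶜ τ *ᶜ ξ) ≈ intᶜ -[1+ 0 ] → ⊥
    trace-±2 τ τ²≡4 e = *ᶜ-domain {D} {D} (≈-trans
        (solveᶜ 2 (λ x t → (conᶜ (+ 2) :*ᶜ x :+ᶜ :-ᶜ t) :*ᶜ (conᶜ (+ 2) :*ᶜ x :+ᶜ :-ᶜ t) :=ᶜ conᶜ (+ 4) :*ᶜ (x :*ᶜ x :+ᶜ :-ᶜ (t :*ᶜ x)) :+ᶜ t :*ᶜ t) ≈-refl ξ (intᶜ τ))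
        (≈-trans (+ᶜ-cong (*ᶜ-cong ≈-refl e) (≈-trans (≈-sym (intᶜ-* τ τ)) (≡⇒≈ (cong intᶜ τ²≡4))))
          (solveᶜ 0 (conᶜ (+ 4) :*ᶜ conᶜ -[1+ 0 ] :+ᶜ conᶜ (+ 4) :=ᶜ conᶜ (+ 0)) ≈-refl)))
      [ contra , contra ]′
      where
      D = intᶜ (+ 2) *ᶜ ξ +ᶜ -ᶜ intᶜ τ
      contra : D ≈ 0ᶜ → ⊥
      contra h = ξ²≉1 (z-w≈0⇒z≈w (intᶜ-cancelˡ {+ 4} (λ ()) (≈-trans
        (solveᶜ 1 (λ x → conᶜ (+ 4) :*ᶜ (x :*ᶜ x :+ᶜ :-ᶜ conᶜ (+ 1)) :=ᶜ (conᶜ (+ 2) :*ᶜ x) :*ᶜ (conᶜ (+ 2) :*ᶜ x) :+ᶜ :-ᶜ conᶜ (+ 4)) ≈-refl ξ)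
        (≈-trans (+ᶜ-cong (≈-trans (*ᶜ-cong (z-w≈0⇒z≈w h) (z-w≈0⇒z≈w h)) (≈-trans (≈-sym (intᶜ-* τ τ)) (≡⇒≈ (cong intᶜ τ²≡4)))) ≈-refl)
          (solveᶜ 0 (conᶜ (+ 4) :+ᶜ :-ᶜ conᶜ (+ 4) :=ᶜ conᶜ (+ 0)) ≈-refl)))))

    by-trace : ∀ τ → ℤ.∣ τ ∣ ℕ.≤ 2 → ξ *ᶜ ξ +ᶜ -ᶜ (intᶜ τ *ᶜ ξ) ≈ intᶜ -[1+ 0 ] → ¬ ¬ RationalTimesRootOfUnity γ
    by-trace (+ 0) _ e = trace-0 e
    by-trace (+ 1) _ e k = trace-±1 (+ 1) refl e
      [ (λ h → k (eisenstein (½r *ᵠ intᵠ (+ 1)) (½r *ᵠ intᵠ (+ 1)) *1≢0 (inj₁ refl) (half (+ 1) (+ 1) h)))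
      , (λ h → k (eisenstein (½r *ᵠ intᵠ (+ 1)) (½r *ᵠ intᵠ -[1+ 0 ]) *1≢0
          (inj₂ (trans (sym (solveᵠ 1 (λ x → :-ᵠ (:-ᵠ x) :=ᵠ x) refl (½r *ᵠ intᵠ (+ 1)))) (cong -ᵠ_ (sym *-1≡))))
          (half (+ 1) -[1+ 0 ] h))) ]′
    by-trace (+ 2) _ e k = trace-±2 (+ 2) refl e
    by-trace (+ suc (suc (suc _))) (s≤s (s≤s ())) e
    by-trace -[1+ 0 ] _ e k = trace-±1 -[1+ 0 ] refl e
      [ (λ h → k (eisenstein (½r *ᵠ intᵠ -[1+ 0 ]) (½r *ᵠ intᵠ (+ 1)) *-1≢0 (inj₂ *-1≡) (half -[1+ 0 ] (+ 1) h)))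
      , (λ h → k (eisenstein (½r *ᵠ intᵠ -[1+ 0 ]) (½r *ᵠ intᵠ -[1+ 0 ]) *-1≢0 (inj₁ refl) (half -[1+ 0 ] -[1+ 0 ] h))) ]′
    by-trace -[1+ 1 ] _ e k = trace-±2 -[1+ 1 ] refl e
    by-trace -[1+ suc (suc _) ] (s≤s (s≤s ())) e

    ↥r≢0 : ↥ r ≢ + 0
    ↥r≢0 e = r≢0 (ℚ.↥p≡0⇒p≡0 r e)

    -- Clears denominators in r (ξ + ξ̄) = γ + γ₂ = -b / a.
    trace-rational : conj γ ≈ γ₂ → intᶜ (a *ᶻ ↥ r) *ᶜ (ξ +ᶜ ξ̄) ≈ intᶜ (↧ r *ᶻ -ᶻ b)
    trace-rational h = ≈-trans (*ᶜ-cong (≈-trans (intᶜ-* a (↥ r)) (*ᶜ-cong ≈-refl (≈-sym (fraction≈ r)))) ≈-refl)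
      (≈-trans (solveᶜ 5 (λ a d r x y → a :*ᶜ (d :*ᶜ r) :*ᶜ (x :+ᶜ y) :=ᶜ d :*ᶜ (a :*ᶜ (r :*ᶜ x :+ᶜ r :*ᶜ y))) ≈-refl (intᶜ a) (intᶜ (↧ r)) (ratᶜ r) ξ ξ̄)
      (≈-trans (*ᶜ-cong ≈-refl (≈-trans (*ᶜ-cong ≈-refl (+ᶜ-cong rξ≈γ
          (≈-trans (*ᶜ-cong ≈-refl (ξ̄≈ h)) (ratᶜ-cancelˡ {r} {s} (trans (ℚ.*-comm r s) sr≡1) γ₂)))) sum≈))
        (≈-sym (intᶜ-* (↧ r) (-ᶻ b)))))

  classification : ¬ ¬ RationalTimesRootOfUnity γ
  classification k = conj-root
    -- A real γ would make ξ real, hence ξ² = ξ ξ̄ = 1.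
    λ { (inj₁ h) → ξ²≉1 (≈-trans (*ᶜ-cong ≈-refl (≈-sym (ξ̄≈ h))) ξξ̄≈1)
      ; (inj₂ h) → let (τ , e) = reduced (↧ r *ᶻ -ᶻ b) (a *ᶻ ↥ r) (λ e → [ a≢0 , ↥r≢0 ]′ (ℤ.i*j≡0⇒i≡0∨j≡0 a e)) (trace-rational h)
                   in by-trace τ (trace-bound τ e) (quadratic τ e) k }

-- The three cases

eval-cong : ∀ {n} (v : Vec ℤ n) {z w} → z ≈ w → eval v z ≈ eval v w
eval-cong {n} v {z} {w} e = subst₂ _≈_ (sym (eval≡evalF v z)) (sym (eval≡evalF v w)) (evalF-congᶜ n (coeff v) e)

-- A rotated number ζ γ is only ≈-equal to the number whose minimal polynomial is at hand.
transport : ∀ {γ γ'} → γ ≈ γ' → MinimalPolynomial γ → MinimalPolynomial γ'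
transport e f = record
  { degree = f.degree ; coefficients = f.coefficients
  ; vanishes = ≈-trans (eval-cong f.coefficients (≈-sym e)) f.vanishes
  ; minimal = λ q q≢0 eq → f.minimal q q≢0 (≈-trans (eval-cong q e) eq)
  ; contentOne = f.contentOne ; leading>0 = f.leading>0 ; conjugates = f.conjugates ; factors = f.factors }
  where module f = MinimalPolynomial f

≉0-root : ∀ {z w} n → z ^ᶜ suc n ≈ w ^ᶜ suc n → ¬ (w ≈ 0ᶜ) → ¬ (z ≈ 0ᶜ)
≉0-root {z} {w} n e w≉0 z≈0 = w≉0 (normSq≤0 (≈ᴿ⇒≤ᴿ (≈ᴿ-trans (≈ᴿ-sym (modulus-square w))
  (≈ᴿ-trans (*ʳ-cong w≈0 w≈0) (solveʳ 0 (conʳ (+ 0) :*ʳ conʳ (+ 0) :=ʳ conʳ (+ 0)) ≈ᴿ-refl)))))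
  where
  w≈0 : modulus w ≈ᴿ 0ʳ
  w≈0 = ≈ᴿ-trans (≈ᴿ-sym (modulus-root n e)) (≈ᴿ-trans (modulus-cong z≈0) (modulus-intᶜ (+ 0)))

degree₁⇒rational : ∀ {β} (F : MinimalPolynomial β) → ¬ (β ≈ 0ᶜ) → degree F ≡ 1 → ∃[ r ] r ≢ 0ℚ × β ≈ ratᶜ r
degree₁⇒rational {β} F β≉0 deg≡1 =
  let (s , sA≡1) = reciprocal (intᵠ A) (λ e → A≢0 (intᵠ-injective e))
      r = s *ᵠ intᵠ (-ᶻ C)
      β≈r : β ≈ ratᶜ r
      β≈r = ≈-trans (≈-sym (ratᶜ-cancelˡ {s} {intᵠ A} sA≡1 β))
        (≈-trans (*ᶜ-cong ≈-refl (≈-trans (*ᶜ-cong (≡⇒≈ (sym (intᶜ≡ratᶜ A))) ≈-refl) (≈-trans linear (≡⇒≈ (intᶜ≡ratᶜ (-ᶻ C))))))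
          (≈-sym (ratᶜ-* s (intᵠ (-ᶻ C)))))
  in r , (λ r≡0 → β≉0 (≈-trans β≈r (≡⇒≈ (trans (cong ratᶜ r≡0) ratᶜ-0)))) , β≈r
  where
  open Minimal F using (A; A≢0)
  open Degree₁ β≉0 F deg≡1 using (C; linear)

M-lower-bound : ∀ {γ} → ¬ (γ ≈ 0ᶜ) → (f : MinimalPolynomial γ) → degree f ℕ.≤ 2 → ¬ RationalTimesRootOfUnity γ →
  ∀ {β} (F : MinimalPolynomial β) m → β ^ᶜ suc m ≈ γ ^ᶜ suc m → M f ≤ᴿ M F
M-lower-bound {γ} γ≉0 f deg≤2 ¬special {β} F m e = by-degree (degree f) refl deg≤2
  where
  quadratic : degree f ≡ 2 → ∀ d → degree F ≡ d → Roots f → M f ≤ᴿ M F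
  quadratic deg≡2 zero          eq rs = ⊥-elim (Minimal.deg≢0 F eq)
  quadratic deg≡2 (suc (suc d)) eq rs = Degree₂.M-≤ γ≉0 f deg≡2 rs F m e (subst (2 ℕ.≤_) (sym eq) (s≤s (s≤s z≤n)))
  quadratic deg≡2 (suc zero)    eq rs =
    let (r , r≢0 , β≈r) = degree₁⇒rational F (≉0-root m e γ≉0) eq
        (s , sr≡1) = reciprocal r r≢0
    in ⊥-elim (RationalRadical.classification γ≉0 f deg≡2 rs r s sr≡1 m (≈-trans (≈-sym e) (^ᶜ-cong (suc m) β≈r)) ¬special)
  by-degree : ∀ d → degree f ≡ d → d ℕ.≤ 2 → M f ≤ᴿ M F
  by-degree 0 eq _ = ⊥-elim (Minimal.deg≢0 f eq)
  by-degree 1 eq _ = Degree₁.M-≤ γ≉0 f eq F m e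
  by-degree 2 eq _ = ≤ᴿ-stable λ k → roots f eq λ rs → k (quadratic eq (degree F) refl rs)
  by-degree (suc (suc (suc _))) eq (s≤s (s≤s ()))

rotated-power : ∀ ζ γ m → ζ Defs.^ suc m ≈ 1ℂ → (ζ Defs.* γ) ^ᶜ suc m ≈ γ ^ᶜ suc m
rotated-power ζ γ m e = ≈-trans (^ᶜ-cong (suc m) (≡⇒≈ (*≡*ᶜ ζ γ))) (≈-trans (^ᶜ-* ζ γ (suc m))
  (≈-trans (*ᶜ-cong (subst₂ _≈_ (^≡^ᶜ ζ (suc m)) 1ℂ≡1ᶜ e) ≈-refl) (*ᶜ-identityˡ (γ ^ᶜ suc m))))

attained-infimum : ∀ {S : ℝ → Set} {x} → S x → (∀ y → S y → x ≤ᴿ y) → IsInfimum S x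
attained-infimum {S} {x} Sx lower = lower , λ ε ε>0 → x , Sx ,
  subst (x ≤ᴿ_) (sym (trans (+ᴿ≡+ʳ x (fromℚ ε)) (cong (x +ʳ_) (fromℚ≡ratʳ ε))))
    (≤ᴿ-respˡ (solveʳ 1 (λ x → x :+ʳ conʳ (+ 0) :=ʳ x) ≈ᴿ-refl x) (+ʳ-mono ≤ᴿ-refl (ratʳ-nonneg {ε} (ℚ.<⇒≤ {0ℚ} {ε} ε>0))))

-- The infimum is a minimum, attained at the rotation δ of γ. Every other rotation of γ shares a
-- power with δ, and the roots of unity matter to `lower` only in this way.
isM̄-by-rotation : ∀ {γ δ} ζ j → ζ ^ᶜ suc j ≈ 1ᶜ → ζ *ᶜ γ ≈ δ → (g : MinimalPolynomial δ) →
  (∀ {β} (F : MinimalPolynomial β) m → β ^ᶜ suc m ≈ δ ^ᶜ suc m → M g ≤ᴿ M F) → IsM̄ γ (M g)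
isM̄-by-rotation {γ} {δ} ζ j ζ^≈1 ζγ≈δ g lower = attained-infimum
  (ζ , (j , subst₂ _≈_ (sym (^≡^ᶜ ζ (suc j))) (sym 1ℂ≡1ᶜ) ζ^≈1) , transport {δ} {ζ Defs.* γ} (≈-sym (≈-trans (≡⇒≈ (*≡*ᶜ ζ γ)) ζγ≈δ)) g , ≈ᴿ-refl)
  λ { y (η , (m , η^≈1) , F , y≈MF) → ≤ᴿ-respʳ (≈ᴿ-sym y≈MF)
      -- The successor of this number is (m + 1)(j + 1), an exponent that trivialises both η and ζ.
      (lower F (j ℕ.+ m ℕ.* suc j) (≈-trans (^ᶜ-double (η Defs.* γ) m) (≈-trans (^ᶜ-cong (suc j) (rotated-power η γ m η^≈1))
        (≈-trans (≈-sym (^ᶜ-double γ m)) (γ^≈δ^ m))))) }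
  where
  ^ᶜ-assoc : ∀ z m n → z ^ᶜ (m ℕ.* n) ≈ (z ^ᶜ m) ^ᶜ n
  ^ᶜ-assoc z m zero    = ≡⇒≈ (cong (z ^ᶜ_) (ℕ.*-zeroʳ m))
  ^ᶜ-assoc z m (suc n) = ≈-trans (≡⇒≈ (cong (z ^ᶜ_) (ℕ.*-suc m n))) (≈-trans (^ᶜ-+ z m (m ℕ.* n)) (*ᶜ-cong ≈-refl (^ᶜ-assoc z m n)))
  ^ᶜ-double : ∀ z m → z ^ᶜ (suc m ℕ.* suc j) ≈ (z ^ᶜ suc m) ^ᶜ suc j
  ^ᶜ-double z m = ^ᶜ-assoc z (suc m) (suc j)
  γʲ≈δʲ : γ ^ᶜ suc j ≈ δ ^ᶜ suc j
  γʲ≈δʲ = ≈-trans (≈-sym (*ᶜ-identityˡ (γ ^ᶜ suc j))) (≈-trans (*ᶜ-cong (≈-sym ζ^≈1) ≈-refl)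
    (≈-trans (≈-sym (^ᶜ-* ζ γ (suc j))) (^ᶜ-cong (suc j) ζγ≈δ)))
  γ^≈δ^ : ∀ m → γ ^ᶜ (suc m ℕ.* suc j) ≈ δ ^ᶜ (suc m ℕ.* suc j)
  γ^≈δ^ m = ≈-trans (swap γ) (≈-trans (^ᶜ-cong (suc m) γʲ≈δʲ) (≈-sym (swap δ)))
    where
    swap : ∀ z → z ^ᶜ (suc m ℕ.* suc j) ≈ (z ^ᶜ suc j) ^ᶜ suc m
    swap z = ≈-trans (≡⇒≈ (cong (z ^ᶜ_) (ℕ.*-comm (suc m) (suc j)))) (^ᶜ-assoc z (suc j) (suc m))

isM̄-self : ∀ {γ} → ¬ (γ ≈ 0ᶜ) → (f : MinimalPolynomial γ) → degree f ℕ.≤ 2 → ¬ RationalTimesRootOfUnity γ → IsM̄ γ (M f)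
isM̄-self {γ} γ≉0 f deg≤2 ¬special = isM̄-by-rotation 1ᶜ 0 (*ᶜ-identityˡ 1ᶜ) (*ᶜ-identityˡ γ) f (M-lower-bound γ≉0 f deg≤2 ¬special)

isM̄-rational : ∀ {γ} → ¬ (γ ≈ 0ᶜ) → ∀ ζ j q → ζ ^ᶜ suc j ≈ 1ᶜ → ζ *ᶜ γ ≈ ratᶜ q → (g : MinimalPolynomial (ratℂ q)) → IsM̄ γ (M g)
isM̄-rational {γ} γ≉0 ζ j q ζ^≈1 ζγ≈q g = isM̄-by-rotation ζ j ζ^≈1 (≈-trans ζγ≈q (≡⇒≈ (sym (ratℂ≡ratᶜ q)))) g
  (Degree₁.M-≤ q≉0 g deg≡1)
  where
  ζ≉0 : ¬ (ζ ≈ 0ᶜ)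
  ζ≉0 = ≉0-root j (≈-trans ζ^≈1 (≈-sym (1ᶜ^ (suc j)))) λ e → 1≢0 (intᶜ-injective {+ 1} {+ 0} e)
    where
    1≢0 : + 1 ≢ + 0
    1≢0 ()
  q≉0 : ¬ (ratℂ q ≈ 0ᶜ)
  q≉0 e = *ᶜ-domain (≈-trans ζγ≈q (≈-trans (≡⇒≈ (sym (ratℂ≡ratᶜ q))) e)) [ ζ≉0 , γ≉0 ]′
  deg≡1 : degree g ≡ 1
  deg≡1 = ℕ.≤-antisym (ℕ.≮⇒≥ λ 2≤deg → let (P , bP , P₁≢0 , eP) = linear-polynomial q (≡⇒≈ (ratℂ≡ratᶜ q))
                         in P₁≢0 (Minimal.minimality g P bP eP 2≤deg 1))
                      (ℕ.n≢0⇒n>0 (Minimal.deg≢0 g))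

-- Equality of generated fields

ℚ⟨⟩-⊆ : ∀ {γ δ} → ℚ⟨ δ ⟩ γ → ∀ z → ℚ⟨ γ ⟩ z → ℚ⟨ δ ⟩ z
ℚ⟨⟩-⊆ {γ} {δ} h _ (rational q) = rational q
ℚ⟨⟩-⊆ {γ} {δ} h _ generator = h
ℚ⟨⟩-⊆ {γ} {δ} h _ (sum {z} {w} x y) = sum {δ} {z} {w} (ℚ⟨⟩-⊆ {γ} {δ} h z x) (ℚ⟨⟩-⊆ {γ} {δ} h w y)
ℚ⟨⟩-⊆ {γ} {δ} h _ (negation {z} x) = negation {δ} {z} (ℚ⟨⟩-⊆ {γ} {δ} h z x)
ℚ⟨⟩-⊆ {γ} {δ} h _ (product {z} {w} x y) = product {δ} {z} {w} (ℚ⟨⟩-⊆ {γ} {δ} h z x) (ℚ⟨⟩-⊆ {γ} {δ} h w y)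
ℚ⟨⟩-⊆ {γ} {δ} h _ (inverse {z} {w} e x) = inverse {δ} {z} {w} e (ℚ⟨⟩-⊆ {γ} {δ} h z x)
ℚ⟨⟩-⊆ {γ} {δ} h _ (respects {z} {w} e x) = respects {δ} {z} {w} e (ℚ⟨⟩-⊆ {γ} {δ} h z x)

a+b*≡ : ∀ a b z → ratℂ a Defs.+ ratℂ b Defs.* z ≡ ratᶜ a +ᶜ ratᶜ b *ᶜ z
a+b*≡ a b z = trans (+≡+ᶜ (ratℂ a) (ratℂ b Defs.* z)) (cong₂ _+ᶜ_ (ratℂ≡ratᶜ a)
  (trans (*≡*ᶜ (ratℂ b) z) (cong (_*ᶜ z) (ratℂ≡ratᶜ b))))

ℚ⟨⟩-≐ : ∀ {γ δ} x y → y ≢ 0ℚ → γ ≈ ratᶜ x +ᶜ ratᶜ y *ᶜ δ → ℚ⟨ γ ⟩ ≐ ℚ⟨ δ ⟩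
ℚ⟨⟩-≐ {γ} {δ} x y y≢0 e =
    (λ {z} → ℚ⟨⟩-⊆ {γ} {δ} (respects {z = ratℂ x Defs.+ ratℂ y Defs.* δ} {w = γ} (≈-trans (≡⇒≈ (a+b*≡ x y δ)) (≈-sym e)) 
      (sum {z = ratℂ x} {w = ratℂ y Defs.* δ} (rational x) (product {z = ratℂ y} {w = δ} (rational y) generator))) z)
  , (λ {z} → ℚ⟨⟩-⊆ {δ} {γ} (respects {z = ratℂ s Defs.* (γ Defs.+ ratℂ (-ᵠ x))} {w = δ} δ≈ 
      (product {z = ratℂ s} {w = γ Defs.+ ratℂ (-ᵠ x)} (rational s) (sum {z = γ} {w = ratℂ (-ᵠ x)} generator (rational (-ᵠ x))))) z)
  where
  s = proj₁ (reciprocal y y≢0)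
  δ≈ : ratℂ s Defs.* (γ Defs.+ ratℂ (-ᵠ x)) ≈ δ
  δ≈ = ≈-trans (≡⇒≈ (trans (*≡*ᶜ (ratℂ s) (γ Defs.+ ratℂ (-ᵠ x))) (cong₂ _*ᶜ_ (ratℂ≡ratᶜ s)
        (trans (+≡+ᶜ γ (ratℂ (-ᵠ x))) (cong (γ +ᶜ_) (ratℂ≡ratᶜ (-ᵠ x)))))))
    (≈-trans (*ᶜ-cong ≈-refl (≈-trans (+ᶜ-cong e (ratᶜ-neg x)) (solveᶜ 2 (λ x t → x :+ᶜ t :+ᶜ :-ᶜ x :=ᶜ t) ≈-refl (ratᶜ x) (ratᶜ y *ᶜ δ))))
      (ratᶜ-cancelˡ {s} {y} (proj₂ (reciprocal y y≢0)) δ))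

-- Irrationality of √3 and separation of the exceptional families

3-not-square : ∀ z → z *ᵠ z ≢ intᵠ (+ 3)
-- If 3 divides both terms of the fraction, it contradicts coprimality; `cop` is irrelevant inside a
-- rational and has to be recomputed before use.
3-not-square z@(ℚ.mkℚ num den-1 cop) e = ¬prime[1] (subst Prime (Coprimality.recompute cop (3∣n , 3∣d)) 3-prime)
  where
  3-prime : Prime 3
  3-prime = from-yes (prime? 3)
  n = ℤ.∣ num ∣
  d = suc den-1
  squares : num *ᶻ num ≡ + d *ᶻ + d *ᶻ + 3
  squares = intᵠ-injective (trans (intᵠ-* num num) (trans (cong₂ _*ᵠ_ (sym (fraction z)) (sym (fraction z)))
    (trans (solveᵠ 2 (λ d z → d :*ᵠ z :*ᵠ (d :*ᵠ z) :=ᵠ d :*ᵠ d :*ᵠ (z :*ᵠ z)) refl (intᵠ (+ d)) z)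
      (trans (cong (intᵠ (+ d) *ᵠ intᵠ (+ d) *ᵠ_) e) (sym (trans (intᵠ-* (+ d *ᶻ + d) (+ 3)) (cong (_*ᵠ intᵠ (+ 3)) (intᵠ-* (+ d) (+ d)))))))))
  n²≡3d² : n ℕ.* n ≡ d ℕ.* d ℕ.* 3
  n²≡3d² = trans (sym (ℤ.abs-* num num)) (trans (cong ℤ.∣_∣ squares) (trans (ℤ.abs-* (+ d *ᶻ + d) (+ 3)) (cong (ℕ._* 3) (ℤ.abs-* (+ d) (+ d)))))
  3∣n : 3 ℕ.∣ n
  3∣n = [ id , id ]′ (euclidsLemma n n 3-prime (ℕ.divides (d ℕ.* d) n²≡3d²))
  3∣d : 3 ℕ.∣ d
  3∣d = [ id , id ]′ (euclidsLemma d d 3-prime (ℕ.*-cancelʳ-∣ 3 (subst (3 ℕ.* 3 ℕ.∣_) n²≡3d² (ℕ.*-pres-∣ 3∣n 3∣n))))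

√3 : ℝ
√3 = √ʳ intʳ (+ 3)

√3-square : √3 *ʳ √3 ≈ᴿ intʳ (+ 3)
√3-square = √-square (intʳ-mono {+ 0} {+ 3} (ℤ.+≤+ z≤n))

-- Keeps the Gaussian and Eisenstein exceptions apart: a non-zero imaginary part cannot be both
-- rational and a rational multiple of √3.
√3-irrational : ∀ p q → ratʳ p ≈ᴿ ratʳ q *ʳ √3 → q ≡ 0ℚ
√3-irrational p q e = decide (q ℚ.≟ 0ℚ)
  where
  p²≡3q² : p *ᵠ p ≡ q *ᵠ q *ᵠ intᵠ (+ 3)
  p²≡3q² = ratʳ-injective (≈ᴿ-trans (ratʳ-* p p) (≈ᴿ-trans (*ʳ-cong e e)
    (≈ᴿ-trans (solveʳ 2 (λ q s → q :*ʳ s :*ʳ (q :*ʳ s) :=ʳ q :*ʳ q :*ʳ (s :*ʳ s)) ≈ᴿ-refl (ratʳ q) √3)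
      (≈ᴿ-sym (≈ᴿ-trans (ratʳ-* (q *ᵠ q) (intᵠ (+ 3))) (*ʳ-cong (ratʳ-* q q) (≈ᴿ-trans (≡⇒≈ᴿ (sym (intʳ≡ratʳ (+ 3)))) (≈ᴿ-sym √3-square))))))))
  decide : Dec (q ≡ 0ℚ) → q ≡ 0ℚ
  decide (yes e) = e
  decide (no q≢0) = let (s , sq≡1) = reciprocal q q≢0 in ⊥-elim (3-not-square (p *ᵠ s) (square s sq≡1))
    where
    square : ∀ s → s *ᵠ q ≡ 1ℚ → p *ᵠ s *ᵠ (p *ᵠ s) ≡ intᵠ (+ 3)
    square s sq≡1 = trans (solveᵠ 2 (λ p s → p :*ᵠ s :*ᵠ (p :*ᵠ s) :=ᵠ p :*ᵠ p :*ᵠ (s :*ᵠ s)) refl p s)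
      (trans (cong (_*ᵠ (s *ᵠ s)) p²≡3q²) (trans (solveᵠ 3 (λ q s t → q :*ᵠ q :*ᵠ t :*ᵠ (s :*ᵠ s) :=ᵠ s :*ᵠ q :*ᵠ (s :*ᵠ q) :*ᵠ t) refl q s (intᵠ (+ 3)))
        (trans (cong (λ u → u *ᵠ u *ᵠ intᵠ (+ 3)) sq≡1) (ℚ.*-identityˡ (intᵠ (+ 3))))))

opaque
  unfolding _+ᶜ_ √-3

  re-gaussian : ∀ a b → re (ratᶜ a +ᶜ ratᶜ b *ᶜ iᶜ) ≈ᴿ ratʳ a
  re-gaussian a b = solveʳ 2 (λ a b → a :+ʳ (b :*ʳ conʳ (+ 0) :+ʳ :-ʳ (conʳ (+ 0) :*ʳ conʳ (+ 1))) :=ʳ a) ≈ᴿ-refl (ratʳ a) (ratʳ b)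

  im-gaussian : ∀ a b → im (ratᶜ a +ᶜ ratᶜ b *ᶜ iᶜ) ≈ᴿ ratʳ b
  im-gaussian a b = solveʳ 1 (λ b → conʳ (+ 0) :+ʳ (b :*ʳ conʳ (+ 1) :+ʳ conʳ (+ 0) :*ʳ conʳ (+ 0)) :=ʳ b) ≈ᴿ-refl (ratʳ b)

  re-eisenstein : ∀ a b → re (ratᶜ a +ᶜ ratᶜ b *ᶜ √-3) ≈ᴿ ratʳ a
  re-eisenstein a b = solveʳ 3 (λ a b s → a :+ʳ (b :*ʳ conʳ (+ 0) :+ʳ :-ʳ (conʳ (+ 0) :*ʳ s)) :=ʳ a) ≈ᴿ-refl (ratʳ a) (ratʳ b) √3

  im-eisenstein : ∀ a b → im (ratᶜ a +ᶜ ratᶜ b *ᶜ √-3) ≈ᴿ ratʳ b *ʳ √3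
  im-eisenstein a b = solveʳ 2 (λ b s → conʳ (+ 0) :+ʳ (b :*ʳ s :+ʳ conʳ (+ 0) :*ʳ conʳ (+ 0)) :=ʳ b :*ʳ s) ≈ᴿ-refl (ratʳ b) √3

≢0-associate : ∀ {x y} → x ≢ 0ℚ → x ≡ y ⊎ x ≡ -ᵠ y → y ≢ 0ℚ
≢0-associate x≢0 h y≡0 = x≢0 ([ (λ e → trans e y≡0) , (λ e → trans e (cong -ᵠ_ y≡0)) ]′ h)

-- Multiplying by √3 once more leaves only the integer 3 to cancel.
√3*-injective : ∀ {p q} → ratʳ p *ʳ √3 ≈ᴿ ratʳ q *ʳ √3 → p ≡ q
√3*-injective {p} {q} e = ratʳ-injective (realᶜ-injective (z-w≈0⇒z≈w (intᶜ-cancelˡ {+ 3} (λ ())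
  (≈-trans (solveᶜ 3 (λ p q t → t :*ᶜ (p :+ᶜ :-ᶜ q) :=ᶜ p :*ᶜ t :+ᶜ :-ᶜ (q :*ᶜ t)) ≈-refl (ratᶜ p) (ratᶜ q) (intᶜ (+ 3)))
    (≈-trans (+ᶜ-cong (≈-trans (≈-sym (3* p)) (≈-trans (realᶜ-cong (*ʳ-congʳ √3 e)) (3* q))) ≈-refl)
      (solveᶜ 1 (λ x → x :+ᶜ :-ᶜ x :=ᶜ conᶜ (+ 0)) ≈-refl (ratᶜ q *ᶜ intᶜ (+ 3))))))))
  where
  3* : ∀ p → realᶜ (ratʳ p *ʳ √3 *ʳ √3) ≈ ratᶜ p *ᶜ intᶜ (+ 3)
  3* p = ≈-trans (realᶜ-cong (≈ᴿ-trans (*ʳ-assoc (ratʳ p) √3 √3) (*ʳ-cong ≈ᴿ-refl √3-square))) (realᶜ-* (ratʳ p) (intʳ (+ 3)))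

gaussian-form : ∀ {γ} y → γ ≈ ratᶜ y *ᶜ iᶜ → γ ≈ ratᶜ 0ℚ +ᶜ ratᶜ y *ᶜ iᶜ
gaussian-form y e = ≈-trans e (≈-trans (solveᶜ 1 (λ t → t :=ᶜ conᶜ (+ 0) :+ᶜ t) ≈-refl (ratᶜ y *ᶜ iᶜ)) (+ᶜ-cong (≡⇒≈ (sym ratᶜ-0)) ≈-refl))

distinct-fields⇒¬special : ∀ {γ} → ¬ (ℚ⟨ γ ⟩ ≐ ℚ⟨ i ⟩) → ¬ (ℚ⟨ γ ⟩ ≐ ℚ⟨ i√3 ⟩) → ¬ RationalTimesRootOfUnity γ
distinct-fields⇒¬special {γ} ≢i ≢i√3 (gaussian y y≢0 e) = ≢i (ℚ⟨⟩-≐ 0ℚ y y≢0 (subst (λ w → γ ≈ ratᶜ 0ℚ +ᶜ ratᶜ y *ᶜ w) (sym i≡iᶜ) (gaussian-form y e)))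
distinct-fields⇒¬special {γ} ≢i ≢i√3 (eisenstein x y x≢0 h e) =
  ≢i√3 (ℚ⟨⟩-≐ x y (≢0-associate x≢0 h) (subst (λ w → γ ≈ ratᶜ x +ᶜ ratᶜ y *ᶜ w) (sym i√3≡√-3) e))

re≢0⇒¬special : ∀ {γ} a b → γ ≈ ratᶜ a +ᶜ ratᶜ b *ᶜ iᶜ → a ≢ 0ℚ → ¬ RationalTimesRootOfUnity γ
re≢0⇒¬special a b e a≢0 (gaussian y y≢0 e') = a≢0 (ratʳ-injective
  (≈ᴿ-trans (≈ᴿ-sym (re-gaussian a b)) (≈ᴿ-trans (re≈ (≈-trans (≈-sym e) (gaussian-form y e'))) (re-gaussian 0ℚ y))))
re≢0⇒¬special a b e a≢0 (eisenstein x y x≢0 h e') = ≢0-associate x≢0 h (√3-irrational b y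
  (≈ᴿ-trans (≈ᴿ-sym (im-gaussian a b)) (≈ᴿ-trans (im≈ (≈-trans (≈-sym e) e')) (im-eisenstein x y))))

a≢±b⇒¬special : ∀ {γ} a b → γ ≈ ratᶜ a +ᶜ ratᶜ b *ᶜ √-3 → ¬ (a ≡ b ⊎ a ≡ -ᵠ b) → ¬ RationalTimesRootOfUnity γ
a≢±b⇒¬special a b e a≢±b (gaussian y y≢0 e') = y≢0 (ratʳ-injective (≈ᴿ-trans y≈b√3
    (≈ᴿ-trans (*ʳ-congʳ √3 (≡⇒≈ᴿ (trans (cong ratʳ (√3-irrational y b y≈b√3)) ratʳ-0)))
      (≈ᴿ-trans (solveʳ 1 (λ s → conʳ (+ 0) :*ʳ s :=ʳ conʳ (+ 0)) ≈ᴿ-refl √3) (≡⇒≈ᴿ (sym ratʳ-0))))))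
  where
  y≈b√3 : ratʳ y ≈ᴿ ratʳ b *ʳ √3
  y≈b√3 = ≈ᴿ-trans (≈ᴿ-sym (im-gaussian 0ℚ y)) (≈ᴿ-trans (im≈ (≈-trans (≈-sym (gaussian-form y e')) e)) (im-eisenstein a b))
a≢±b⇒¬special a b e a≢±b (eisenstein x y x≢0 h e') = a≢±b (subst₂ (λ x y → x ≡ y ⊎ x ≡ -ᵠ y) x≡a y≡b h)
  where
  x≡a : x ≡ a
  x≡a = ratʳ-injective (≈ᴿ-trans (≈ᴿ-sym (re-eisenstein x y)) (≈ᴿ-trans (re≈ (≈-trans (≈-sym e') e)) (re-eisenstein a b)))
  y≡b : y ≡ b
  y≡b = √3*-injective (≈ᴿ-trans (≈ᴿ-sym (im-eisenstein x y)) (≈ᴿ-trans (im≈ (≈-trans (≈-sym e') e)) (im-eisenstein a b)))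

-- Explicit rotations to rational numbers

-iᶜ-order : (-ᶜ iᶜ) ^ᶜ 4 ≈ 1ᶜ
-iᶜ-order = ≈-trans (solveᶜ 1 (λ i → (:-ᶜ i) :*ᶜ ((:-ᶜ i) :*ᶜ ((:-ᶜ i) :*ᶜ ((:-ᶜ i) :*ᶜ conᶜ (+ 1)))) :=ᶜ i :*ᶜ i :*ᶜ (i :*ᶜ i)) ≈-refl iᶜ)
  (≈-trans (*ᶜ-cong iᶜ-square iᶜ-square) (solveᶜ 0 (conᶜ -[1+ 0 ] :*ᶜ conᶜ -[1+ 0 ] :=ᶜ conᶜ (+ 1)) ≈-refl))

-iᶜ-rotation : ∀ a b → a ≡ 0ℚ → (-ᶜ iᶜ) *ᶜ (ratᶜ a +ᶜ ratᶜ b *ᶜ iᶜ) ≈ ratᶜ b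
-iᶜ-rotation a b a≡0 = ≈-trans (*ᶜ-cong ≈-refl (+ᶜ-cong (≡⇒≈ (trans (cong ratᶜ a≡0) ratᶜ-0)) ≈-refl))
  (≈-trans (solveᶜ 2 (λ b i → (:-ᶜ i) :*ᶜ (conᶜ (+ 0) :+ᶜ b :*ᶜ i) :=ᶜ (:-ᶜ (i :*ᶜ i)) :*ᶜ b) ≈-refl (ratᶜ b) iᶜ)
    (≈-trans (*ᶜ-cong (-ᶜ-cong iᶜ-square) ≈-refl) (solveᶜ 1 (λ b → (:-ᶜ conᶜ -[1+ 0 ]) :*ᶜ b :=ᶜ b) ≈-refl (ratᶜ b))))

-- Taking v = √-3 or v = -√-3 covers a = b and a = -b at once. The primitive sixth root of unity ω =
-- (1 - v) / 2 is chosen because (1 - v)(1 + v) = 1 - v² = 4, so it rotates a (1 + v) to 2a.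
module SixthRoot (v : ℂ) (v²≈-3 : v *ᶜ v ≈ intᶜ -[1+ 2 ]) where
  ω : ℂ
  ω = ratᶜ ½ *ᶜ (1ᶜ +ᶜ -ᶜ v)

  2ω≈1-v : intᶜ (+ 2) *ᶜ ω ≈ 1ᶜ +ᶜ -ᶜ v
  2ω≈1-v = ≈-trans (*ᶜ-cong (≡⇒≈ (intᶜ≡ratᶜ (+ 2))) ≈-refl) (ratᶜ-cancelˡ {intᵠ (+ 2)} {½} refl (1ᶜ +ᶜ -ᶜ v))

  ω²≈ω-1 : ω *ᶜ ω ≈ ω +ᶜ -ᶜ 1ᶜ
  ω²≈ω-1 = z-w≈0⇒z≈w (intᶜ-cancelˡ {+ 4} (λ ()) (≈-trans
    (solveᶜ 1 (λ w → conᶜ (+ 4) :*ᶜ (w :*ᶜ w :+ᶜ :-ᶜ (w :+ᶜ :-ᶜ conᶜ (+ 1))) :=ᶜ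
      (conᶜ (+ 2) :*ᶜ w) :*ᶜ (conᶜ (+ 2) :*ᶜ w) :+ᶜ :-ᶜ (conᶜ (+ 2) :*ᶜ (conᶜ (+ 2) :*ᶜ w)) :+ᶜ conᶜ (+ 4)) ≈-refl ω)
    (≈-trans (+ᶜ-cong (+ᶜ-cong (*ᶜ-cong 2ω≈1-v 2ω≈1-v) (-ᶜ-cong (*ᶜ-cong ≈-refl 2ω≈1-v))) ≈-refl)
    (≈-trans (solveᶜ 1 (λ v → (conᶜ (+ 1) :+ᶜ :-ᶜ v) :*ᶜ (conᶜ (+ 1) :+ᶜ :-ᶜ v) :+ᶜ :-ᶜ (conᶜ (+ 2) :*ᶜ (conᶜ (+ 1) :+ᶜ :-ᶜ v)) :+ᶜ conᶜ (+ 4) :=ᶜ v :*ᶜ v :+ᶜ conᶜ (+ 3)) ≈-refl v)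
    (≈-trans (+ᶜ-cong v²≈-3 ≈-refl) (solveᶜ 0 (conᶜ -[1+ 2 ] :+ᶜ conᶜ (+ 3) :=ᶜ conᶜ (+ 0)) ≈-refl))))))

  ω³≈-1 : ω *ᶜ (ω *ᶜ ω) ≈ intᶜ -[1+ 0 ]
  ω³≈-1 = ≈-trans (*ᶜ-cong ≈-refl ω²≈ω-1) (≈-trans (solveᶜ 1 (λ w → w :*ᶜ (w :+ᶜ :-ᶜ conᶜ (+ 1)) :=ᶜ w :*ᶜ w :+ᶜ :-ᶜ w) ≈-refl ω)
    (≈-trans (+ᶜ-cong ω²≈ω-1 ≈-refl) (solveᶜ 1 (λ w → w :+ᶜ :-ᶜ conᶜ (+ 1) :+ᶜ :-ᶜ w :=ᶜ conᶜ -[1+ 0 ]) ≈-refl ω)))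

  order : ω ^ᶜ 6 ≈ 1ᶜ
  order = ≈-trans (solveᶜ 1 (λ w → w :*ᶜ (w :*ᶜ (w :*ᶜ (w :*ᶜ (w :*ᶜ (w :*ᶜ conᶜ (+ 1)))))) :=ᶜ w :*ᶜ (w :*ᶜ w) :*ᶜ (w :*ᶜ (w :*ᶜ w))) ≈-refl ω)
    (≈-trans (*ᶜ-cong ω³≈-1 ω³≈-1) (solveᶜ 0 (conᶜ -[1+ 0 ] :*ᶜ conᶜ -[1+ 0 ] :=ᶜ conᶜ (+ 1)) ≈-refl))

  rotation : ∀ a → ω *ᶜ (ratᶜ a +ᶜ ratᶜ a *ᶜ v) ≈ ratᶜ (a +ᵠ a)
  rotation a = ≈-trans (z-w≈0⇒z≈w (intᶜ-cancelˡ {+ 2} (λ ()) (≈-trans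
      (solveᶜ 3 (λ w a v → conᶜ (+ 2) :*ᶜ (w :*ᶜ (a :+ᶜ a :*ᶜ v) :+ᶜ :-ᶜ (a :+ᶜ a)) :=ᶜ (conᶜ (+ 2) :*ᶜ w) :*ᶜ (a :+ᶜ a :*ᶜ v) :+ᶜ :-ᶜ (conᶜ (+ 4) :*ᶜ a)) ≈-refl ω (ratᶜ a) v)
      (≈-trans (+ᶜ-cong (*ᶜ-cong 2ω≈1-v ≈-refl) ≈-refl)
      (≈-trans (solveᶜ 2 (λ a v → (conᶜ (+ 1) :+ᶜ :-ᶜ v) :*ᶜ (a :+ᶜ a :*ᶜ v) :+ᶜ :-ᶜ (conᶜ (+ 4) :*ᶜ a) :=ᶜ :-ᶜ (a :*ᶜ (v :*ᶜ v :+ᶜ conᶜ (+ 3)))) ≈-refl (ratᶜ a) v)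
      (≈-trans (-ᶜ-cong (*ᶜ-cong ≈-refl (+ᶜ-cong v²≈-3 ≈-refl)))
        (solveᶜ 1 (λ a → :-ᶜ (a :*ᶜ (conᶜ -[1+ 2 ] :+ᶜ conᶜ (+ 3))) :=ᶜ conᶜ (+ 0)) ≈-refl (ratᶜ a))))))))
    (≈-sym (≈-trans (realᶜ-cong (ratʳ-+ a a)) (realᶜ-+ (ratʳ a) (ratʳ a))))

isM̄-eisenstein : ∀ {γ} → ¬ (γ ≈ 0ᶜ) → ∀ a b → γ ≈ ratᶜ a +ᶜ ratᶜ b *ᶜ √-3 → a ≡ b ⊎ a ≡ -ᵠ b →
  (g : MinimalPolynomial (ratℂ (a +ᵠ a))) → IsM̄ γ (M g)
isM̄-eisenstein γ≉0 a .a e (inj₁ refl) g = isM̄-rational γ≉0 ω 5 (a +ᵠ a) order (≈-trans (*ᶜ-cong ≈-refl e) (rotation a)) g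
  where open SixthRoot √-3 √-3-square
isM̄-eisenstein γ≉0 a b e (inj₂ a≡-b) g = isM̄-rational γ≉0 ω 5 (a +ᵠ a) order (≈-trans (*ᶜ-cong ≈-refl γ≈) (rotation a)) g
  where
  open SixthRoot (-ᶜ √-3) (≈-trans (solveᶜ 1 (λ w → (:-ᶜ w) :*ᶜ (:-ᶜ w) :=ᶜ w :*ᶜ w) ≈-refl √-3) √-3-square)
  γ≈ : _ ≈ ratᶜ a +ᶜ ratᶜ a *ᶜ (-ᶜ √-3)
  γ≈ = ≈-trans e (+ᶜ-cong ≈-refl (≈-trans (solveᶜ 2 (λ b w → b :*ᶜ w :=ᶜ (:-ᶜ b) :*ᶜ (:-ᶜ w)) ≈-refl (ratᶜ b) √-3)
    (*ᶜ-cong (≈-trans (≈-sym (ratᶜ-neg b)) (≡⇒≈ (cong ratᶜ (sym a≡-b)))) ≈-refl)))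

open Defs using (_+_; _*_)

mainTheorem4 : (γ : ℂ) → ¬ (γ ≈ 0ℂ) → (f : MinimalPolynomial γ) → degree f ≤ 2 →
    (¬ (ℚ⟨ γ ⟩ ≐ ℚ⟨ i ⟩) → ¬ (ℚ⟨ γ ⟩ ≐ ℚ⟨ i√3 ⟩) → IsM̄ γ (M f))
    × ((a b : ℚ) → γ ≈ ratℂ a + ratℂ b * i →
    (a ≡ 0ℚ → (g : MinimalPolynomial (ratℂ b)) → IsM̄ γ (M g))
    × (a ≢ 0ℚ → IsM̄ γ (M f)))
    × ((a b : ℚ) → γ ≈ ratℂ a + ratℂ b * i√3 →
    (a ≡ b ⊎ a ≡ -ᵠ b → (g : MinimalPolynomial (ratℂ (a +ᵠ a))) → IsM̄ γ (M g))
    × (¬ (a ≡ b ⊎ a ≡ -ᵠ b) → IsM̄ γ (M f)))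
mainTheorem4 γ γ≉0ℂ f deg≤2 =
    (λ ≢i ≢i√3 → isM̄-self γ≉0 f deg≤2 (distinct-fields⇒¬special ≢i ≢i√3))
  , (λ a b e → let e′ = gaussian-coordinates a b e in
        (λ a≡0 g → isM̄-rational γ≉0 (-ᶜ iᶜ) 3 b -iᶜ-order (≈-trans (*ᶜ-cong ≈-refl e′) (-iᶜ-rotation a b a≡0)) g)
      , (λ a≢0 → isM̄-self γ≉0 f deg≤2 (re≢0⇒¬special a b e′ a≢0)))
  , (λ a b e → let e′ = eisenstein-coordinates a b e in
        (λ a≡±b g → isM̄-eisenstein γ≉0 a b e′ a≡±b g)
      , (λ a≢±b → isM̄-self γ≉0 f deg≤2 (a≢±b⇒¬special a b e′ a≢±b)))
  where
  γ≉0 : ¬ (γ ≈ 0ᶜ)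
  γ≉0 = γ≉0ℂ ∘ subst (γ ≈_) (sym 0ℂ≡0ᶜ)
  gaussian-coordinates : ∀ a b → γ ≈ ratℂ a + ratℂ b * i → γ ≈ ratᶜ a +ᶜ ratᶜ b *ᶜ iᶜ
  gaussian-coordinates a b = subst (γ ≈_) (trans (a+b*≡ a b i) (cong (λ w → ratᶜ a +ᶜ ratᶜ b *ᶜ w) i≡iᶜ))
  eisenstein-coordinates : ∀ a b → γ ≈ ratℂ a + ratℂ b * i√3 → γ ≈ ratᶜ a +ᶜ ratᶜ b *ᶜ √-3
  eisenstein-coordinates a b = subst (γ ≈_) (trans (a+b*≡ a b i√3) (cong (λ w → ratᶜ a +ᶜ ratᶜ b *ᶜ w) i√3≡√-3))
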